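{- For every $\beta$ with $0<\beta<1/4$ there exists $d_0=d_0(\beta)$ such that for every integer $d\ge d_0$ and every $d$-regular graph $G$ on $n$ vertices, \[ s(G) < \frac{n}{d}\left(1+\frac{14}{d^{\beta}}\right)+28. \]
   Context: All graphs are finite and simple. For a graph $G$ and a positive integer $k$, an edge-weighting $f:E(G)\to\{1,\dots,k\}$ is $k$-irregular if the weighted degrees $f^V(v)=\sum_{u:\{u,v\}\in E(G)} f(\{u,v\})$ are pairwise distinct over $v\in V(G)$. The irregularity strength $s(G)$ is the least $k$ for which a $k$-irregular edge-weighting exists ($s(G)=\infty$ if none exists). -}

module Defs where

open import Data.Nat using (ℕ; zero; suc; _+_; _*_; _∸_; _^_; _≤_; _<_)
open import Data.Fin using (Fin; zero; suc)
open import Data.Bool using (Bool; true; false; if_then_else_)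
open import Data.Product using (_×_; Σ)
open import Data.Sum using (_⊎_)
open import Relation.Binary.PropositionalEquality using (_≡_; _≢_)
open import Relation.Nullary using (¬_)

∑ : (n : ℕ) → (Fin n → ℕ) → ℕ
∑ zero    f = 0
∑ (suc n) f = f zero + ∑ n (λ i → f (suc i))

record Graph (n : ℕ) : Set where
  field
    adj    : Fin n → Fin n → Bool
    adj-sym : ∀ u v → adj u v ≡ adj v u
    adj-irr : ∀ v → adj v v ≡ false
open Graph public

deg : ∀ {n} → Graph n → Fin n → ℕ
deg {n} G v = ∑ n (λ u → if adj G v u then 1 else 0)

Regular : ∀ {n} → ℕ → Graph n → Set
Regular d G = ∀ v → deg G v ≡ d

-- An edge-weighting f : E(G) → {1,…,k}, given as a function on vertex pairs
-- that is symmetric on edges and takes values in {1,…,k} on edges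
-- (its values on non-edges are irrelevant).
record Weighting {n : ℕ} (G : Graph n) (k : ℕ) : Set where
  field
    w      : Fin n → Fin n → ℕ
    w-sym  : ∀ u v → adj G u v ≡ true → w u v ≡ w v u
    w-pos  : ∀ u v → adj G u v ≡ true → 1 ≤ w u v
    w-le   : ∀ u v → adj G u v ≡ true → w u v ≤ k
open Weighting public

wdeg : ∀ {n} {G : Graph n} {k} → Weighting G k → Fin n → ℕ
wdeg {n} {G} f v = ∑ n (λ u → if adj G v u then w f v u else 0)

Irregular : ∀ {n} {G : Graph n} {k} → Weighting G k → Set
Irregular {n} f = ∀ (u v : Fin n) → u ≢ v → wdeg f u ≢ wdeg f v

HasIrregularWeighting : ∀ {n} → Graph n → ℕ → Set
HasIrregularWeighting G k = Σ (Weighting G k) Irregular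

IrregularityStrength : ∀ {n} → Graph n → ℕ → Set
IrregularityStrength G k =
  1 ≤ k × HasIrregularWeighting G k × (∀ j → 1 ≤ j → j < k → ¬ HasIrregularWeighting G j)

-- For β = p/q and d ≥ 1, n ≥ 0:
--   k < (n/d)(1 + 14/d^(p/q)) + 28
-- Multiplying by d: d k < 28 d + n + 14 n / d^(p/q).  If d k < 28 d + n this holds;
-- otherwise with m = d k − (28 d + n) ≥ 0 it is  m · d^(p/q) < 14 n,
-- equivalently (raising to the q-th power) m^q · d^p < (14 n)^q.
BoundRat : (p q d n k : ℕ) → Set
BoundRat p q d n k = (d * k < 28 * d + n) ⊎ ((d * k ∸ (28 * d + n)) ^ q * d ^ p < (14 * n) ^ q)

{-# OPTIONS --safe #-}
module Submission where

open import Defs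
open import Data.Nat
open import Data.Nat.Properties
open import Data.Nat.DivMod
open import Data.Nat.Divisibility using (m∣m*n)
open import Data.Nat.Tactic.RingSolver using (solve-∀)
open import Data.Bool using (Bool; true; false; if_then_else_; not; _∧_) renaming (T to IsTrue)
open import Data.Bool.Properties using (∧-zeroʳ; ∧-identityʳ)
import Data.Bool.Properties as Bool
open import Data.Fin using (Fin; zero; suc; toℕ; fromℕ<; finToFun; funToFin)
open import Data.Fin.Properties using (all?; any?; toℕ-fromℕ<; finToFun-funToFin; toℕ≤pred[n]; toℕ<n; toℕ-injective; nonZeroIndex)
import Data.Fin.Properties as Fin
open import Data.List using (List; []; _∷_; length; tabulate; allFin; cartesianProduct)
open import Data.List.Membership.Propositional using (_∈_)
open import Data.List.Membership.Propositional.Properties using (∈-allFin; ∈-cartesianProduct⁺)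
open import Data.List.Relation.Unary.Any using (here; there)
open import Data.Product using (Σ; ∃; ∃₂; _×_; _,_; proj₁; proj₂)
open import Data.Sum using (_⊎_; inj₁; inj₂)
import Data.Sum as Sum
open import Data.Vec using (Vec; []; _∷_; lookup)
open import Function using (_∘_; case_of_)
open import Relation.Binary.Definitions using (tri<; tri≈; tri>)
open import Relation.Binary.PropositionalEquality
open import Relation.Nullary using (¬_; Dec; yes; no; contradiction)
open import Relation.Nullary.Decidable using (_×-dec_; _→-dec_; ¬?; map′)

-- Label the vertices at random with Q labels so that every neighbourhood of size d sees every initial
-- segment of the labels about as often as expected (local lemma and a large deviation bound). By
-- regularity the labels are then globally equidistributed as well. The labels split the vertices into a
-- bulk and two small classes, toggle and rest, each with levels j spread evenly. Giving an edge the
-- maximal weight exactly when the levels of its ends add up to at least a threshold F makes the weighted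
-- degree of a vertex of level j nearly proportional to j, and only weights of order n / d are needed.
--
-- The edges between bulk and rest with level sum just below the threshold are left free: with them each
-- bulk vertex is moved exactly to a prescribed value, and each toggle vertex likewise by its edges to rest
-- vertices, the values being assigned in label order. Afterwards a toggle vertex may still move up by α. The rest
-- vertices are completed one after the other: toggling neighbours moves such a vertex in steps of α, and
-- a weight below α on one edge inside the rest class provides the fine adjustment. A maximal matching
-- orders this process: unmatched vertices first, each using an edge to a matched one, then the matched
-- pairs, whose common fine weight is found by the pigeonhole principle. Since a rest vertex only competes
-- with the few rest vertices of nearby level, a small proportion of reserved values suffices.

-- Finite sums

-- The range of β comes from one chain of sizes. Bulk vertices may use only a proportion T / H of
-- all numbers, H = T + 3, so placing n vertices in a range of about κ d needs κ near (n / d)(1 + 3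
-- / T), and the error term asks for T near d^β. To reach `lk` candidate values, which lie H steps
-- apart, a rest vertex needs H `lk` toggle neighbours; this forces X to be of order T. Label counts
-- are known only up to t = R h with R at least √(2 d), while the slots of a bulk vertex take up W
-- of about W X² labels. So t may be at most of order d / X², and h T² must stay below √d up to a
-- constant: this is where β < 1/4 enters, h being a small power of d. The constant 4 in κ = 4 α is
-- dictated by the edges between toggle and rest vertices, which carry two independent adjustments
-- of up to 2 α each. Probabilities are replaced by counts of outcomes with denominators cleared,
-- and real powers of d by powers of an integer root h, so the whole argument stays in ℕ.

𝟙 : Bool → ℕ
𝟙 b = if b then 1 else 0

𝟙≤1 : ∀ b → 𝟙 b ≤ 1
𝟙≤1 false = z≤n
𝟙≤1 true  = ≤-refl

<ᵇ-false : ∀ m n → (m <ᵇ n) ≡ false → n ≤ m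
<ᵇ-false m n eq with n ≤? m
... | yes n≤m = n≤m
... | no  n≰m = contradiction (subst IsTrue eq (<⇒<ᵇ (≰⇒> n≰m))) λ ()

<ᵇ-true : ∀ m n → (m <ᵇ n) ≡ true → m < n
<ᵇ-true m n eq = <ᵇ⇒< m n (subst IsTrue (sym eq) _)

<⇒<ᵇ-true : ∀ {m n} → m < n → (m <ᵇ n) ≡ true
<⇒<ᵇ-true {m} {n} m<n with m <ᵇ n in eq
... | true  = refl
... | false = contradiction m<n (≤⇒≯ (<ᵇ-false m n eq))

≤⇒<ᵇ-false : ∀ {m n} → n ≤ m → (m <ᵇ n) ≡ false
≤⇒<ᵇ-false {m} {n} n≤m with m <ᵇ n in eq
... | false = refl
... | true  = contradiction n≤m (<⇒≱ (<ᵇ-true m n eq))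

𝟙≡0⇒false : ∀ {b} → 𝟙 b ≡ 0 → b ≡ false
𝟙≡0⇒false {false} _ = refl

𝟙-positive≤ : ∀ x → 𝟙 (0 <ᵇ x) ≤ x
𝟙-positive≤ zero    = z≤n
𝟙-positive≤ (suc x) = s≤s z≤n

𝟙-∧ : ∀ x y → 𝟙 (x ∧ y) ≡ 𝟙 x * 𝟙 y
𝟙-∧ true  y = sym (+-identityʳ (𝟙 y))
𝟙-∧ false y = refl

≡ᵇ-refl : ∀ m → (m ≡ᵇ m) ≡ true
≡ᵇ-refl zero    = refl
≡ᵇ-refl (suc m) = ≡ᵇ-refl m

≡ᵇ-true : ∀ m n → (m ≡ᵇ n) ≡ true → m ≡ n
≡ᵇ-true m n eq = ≡ᵇ⇒≡ m n (subst IsTrue (sym eq) _)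

𝟙-true : ∀ {b} → 1 ≤ 𝟙 b → b ≡ true
𝟙-true {true} _ = refl

∑-cong : ∀ n {f g : Fin n → ℕ} → (∀ i → f i ≡ g i) → ∑ n f ≡ ∑ n g
∑-cong zero    f≗g = refl
∑-cong (suc n) f≗g = cong₂ _+_ (f≗g zero) (∑-cong n (λ i → f≗g (suc i)))

∑-mono : ∀ n {f g : Fin n → ℕ} → (∀ i → f i ≤ g i) → ∑ n f ≤ ∑ n g
∑-mono zero    f≤g = z≤n
∑-mono (suc n) f≤g = +-mono-≤ (f≤g zero) (∑-mono n (λ i → f≤g (suc i)))

∑-const : ∀ n c → ∑ n (λ _ → c) ≡ n * c
∑-const zero    c = refl
∑-const (suc n) c = cong (c +_) (∑-const n c)

∑-zero : ∀ n → ∑ n (λ _ → 0) ≡ 0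
∑-zero n = trans (∑-const n 0) (*-zeroʳ n)

+-interchange : ∀ a b c d → (a + b) + (c + d) ≡ (a + c) + (b + d)
+-interchange = solve-∀

∑-distrib-+ : ∀ n (f g : Fin n → ℕ) → ∑ n (λ i → f i + g i) ≡ ∑ n f + ∑ n g
∑-distrib-+ zero    f g = refl
∑-distrib-+ (suc n) f g =
  trans (cong (f zero + g zero +_) (∑-distrib-+ n (f ∘ suc) (g ∘ suc)))
        (+-interchange (f zero) (g zero) _ _)

∑-*ˡ : ∀ n c (f : Fin n → ℕ) → ∑ n (λ i → c * f i) ≡ c * ∑ n f
∑-*ˡ zero    c f = sym (*-zeroʳ c)
∑-*ˡ (suc n) c f =
  trans (cong (c * f zero +_) (∑-*ˡ n c (f ∘ suc))) (sym (*-distribˡ-+ c (f zero) _))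

∑-*ʳ : ∀ n c (f : Fin n → ℕ) → ∑ n (λ i → f i * c) ≡ ∑ n f * c
∑-*ʳ n c f = trans (∑-cong n (λ i → *-comm (f i) c)) (trans (∑-*ˡ n c f) (*-comm c _))

∑-swap : ∀ m n (f : Fin m → Fin n → ℕ) →
         ∑ m (λ i → ∑ n (f i)) ≡ ∑ n (λ j → ∑ m (λ i → f i j))
∑-swap zero    n f = sym (∑-zero n)
∑-swap (suc m) n f =
  trans (cong (∑ n (f zero) +_) (∑-swap m n (f ∘ suc)))
        (sym (∑-distrib-+ n (f zero) _))

term≤∑ : ∀ n (f : Fin n → ℕ) i → f i ≤ ∑ n f
term≤∑ (suc n) f zero    = m≤m+n (f zero) _
term≤∑ (suc n) f (suc i) = ≤-trans (term≤∑ n (f ∘ suc) i) (m≤n+m _ (f zero))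

∑≡0⇒≡0 : ∀ n (f : Fin n → ℕ) → ∑ n f ≡ 0 → ∀ i → f i ≡ 0
∑≡0⇒≡0 n f eq i = n≤0⇒n≡0 (≤-trans (term≤∑ n f i) (≤-reflexive eq))

≡0⇒∑≡0 : ∀ n {f : Fin n → ℕ} → (∀ i → f i ≡ 0) → ∑ n f ≡ 0
≡0⇒∑≡0 n f≡0 = trans (∑-cong n f≡0) (∑-zero n)

∑-pos⇒∃ : ∀ n (f : Fin n → ℕ) → 1 ≤ ∑ n f → ∃ λ i → 1 ≤ f i
∑-pos⇒∃ (suc n) f 1≤ with 1 ≤? f zero
... | yes p = zero , p
... | no ¬p with ∑-pos⇒∃ n (f ∘ suc) (subst (λ x → 1 ≤ x + ∑ n (f ∘ suc)) (n<1⇒n≡0 (≰⇒> ¬p)) 1≤)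
...   | i , p = suc i , p

∑<⇒∃≡0 : ∀ n (f : Fin n → ℕ) → ∑ n f < n → ∃ λ i → f i ≡ 0
∑<⇒∃≡0 (suc n) f lt with f zero in eq
... | zero  = zero , eq
... | suc k with ∑<⇒∃≡0 n (f ∘ suc) (≤-trans (s≤s (m≤n+m _ k)) (s≤s⁻¹ lt))
...   | i , p = suc i , p

∑-atMostOne : ∀ n (f : Fin n → ℕ) → (∀ i → f i ≤ 1) →
              (∀ i j → 1 ≤ f i → 1 ≤ f j → i ≡ j) → ∑ n f ≤ 1
∑-atMostOne zero    f f≤1 inj = z≤n
∑-atMostOne (suc n) f f≤1 inj with f zero in eq
... | zero  = ∑-atMostOne n (f ∘ suc) (f≤1 ∘ suc) (λ i j p q → Fin.suc-injective (inj (suc i) (suc j) p q))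
... | suc k = ≤-trans (≤-reflexive (trans (cong (suc k +_) rest) (+-identityʳ _)))
                      (subst (_≤ 1) eq (f≤1 zero))
  where
  rest : ∑ n (f ∘ suc) ≡ 0
  rest = ≡0⇒∑≡0 n λ i → case f (suc i) ≟ 0 of λ where
    (yes p) → p
    (no ¬p) → contradiction (inj zero (suc i) (subst (1 ≤_) (sym eq) (s≤s z≤n)) (n≢0⇒n>0 ¬p)) λ ()

∑-single : ∀ n (f : Fin n → ℕ) i → (∀ j → j ≢ i → f j ≡ 0) → ∑ n f ≡ f i
∑-single (suc n) f zero    off =
  trans (cong (f zero +_) (≡0⇒∑≡0 n (λ i → off (suc i) λ ()))) (+-identityʳ _)
∑-single (suc n) f (suc i) off =
  trans (cong (_+ ∑ n (f ∘ suc)) (off zero λ ()))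
        (∑-single n (f ∘ suc) i (λ j j≢i → off (suc j) (j≢i ∘ Fin.suc-injective)))

-- Truncated subtraction would lose information, so the effect of a change at one point is stated
-- with the old and the new term added crosswise.
∑-update : ∀ n (f g : Fin n → ℕ) i → (∀ j → j ≢ i → f j ≡ g j) → ∑ n f + g i ≡ ∑ n g + f i
∑-update (suc n) f g zero    off =
  trans (cong (λ s → f zero + s + g zero) (∑-cong n (λ j → off (suc j) λ ())))
  (trans (cong (_+ g zero) (+-comm (f zero) _))
  (trans (+-assoc _ (f zero) (g zero))
  (trans (cong (∑ n (g ∘ suc) +_) (+-comm (f zero) (g zero)))
  (trans (sym (+-assoc _ (g zero) (f zero))) (cong (_+ f zero) (+-comm _ (g zero)))))))
∑-update (suc n) f g (suc i) off =
  trans (+-assoc (f zero) _ _)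
  (trans (cong₂ _+_ (off zero λ ()) (∑-update n (f ∘ suc) (g ∘ suc) i (λ j j≢i → off (suc j) (j≢i ∘ Fin.suc-injective))))
         (sym (+-assoc (g zero) _ _)))

-- Greedy: each admissible position takes as much as its cap and the remaining demand allow. This is
-- how free edges meet a prescribed value exactly; with `cap` equal to 1 it selects a set of
-- prescribed size.
fill : ∀ n (s : Fin n → Bool) cap total → total ≤ cap * ∑ n (𝟙 ∘ s) →
       ∃ λ (x : Fin n → ℕ) → (∀ i → x i ≤ cap) × (∀ i → s i ≡ false → x i ≡ 0) × ∑ n x ≡ total
fill zero    s cap total le = (λ ()) , (λ ()) , (λ ()) , sym (n≤0⇒n≡0 (≤-trans le (≤-reflexive (*-zeroʳ cap))))
fill (suc n) s cap total le with s zero in eq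
... | false with fill n (s ∘ suc) cap total le
...   | x , x≤ , x0 , x∑ = x′ , x′≤ , x′0 , x∑
  where
  x′ : Fin (suc n) → ℕ
  x′ zero = 0
  x′ (suc i) = x i
  x′≤ : ∀ i → x′ i ≤ cap
  x′≤ zero = z≤n
  x′≤ (suc i) = x≤ i
  x′0 : ∀ i → s i ≡ false → x′ i ≡ 0
  x′0 zero _ = refl
  x′0 (suc i) = x0 i
fill (suc n) s cap total le | true
  with fill n (s ∘ suc) cap (total ∸ (total ⊓ cap)) le′
  where
  le′ : total ∸ (total ⊓ cap) ≤ cap * ∑ n (𝟙 ∘ s ∘ suc)
  le′ with ≤-total total cap
  ... | inj₁ t≤c = subst (_≤ cap * ∑ n (𝟙 ∘ s ∘ suc))
                     (sym (trans (cong (total ∸_) (m≤n⇒m⊓n≡m t≤c)) (n∸n≡0 total))) z≤n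
  ... | inj₂ c≤t = subst (_≤ cap * ∑ n (𝟙 ∘ s ∘ suc)) (sym (cong (total ∸_) (m≥n⇒m⊓n≡n c≤t)))
                     (m≤n+o⇒m∸n≤o total cap (subst (total ≤_) (*-suc cap _) le))
...   | x , x≤ , x0 , x∑ = x′ , x′≤ , x′0 , trans (cong (total ⊓ cap +_) x∑) (m+[n∸m]≡n (m⊓n≤m total cap))
  where
  x′ : Fin (suc n) → ℕ
  x′ zero = total ⊓ cap
  x′ (suc i) = x i
  x′≤ : ∀ i → x′ i ≤ cap
  x′≤ zero = m⊓n≤n total cap
  x′≤ (suc i) = x≤ i
  x′0 : ∀ i → s i ≡ false → x′ i ≡ 0
  x′0 zero h = contradiction (trans (sym eq) h) λ ()
  x′0 (suc i) = x0 i

-- Deciding irregularity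

module _ {n : ℕ} (G : Graph n) (k : ℕ) where

  -- `IrregularityStrength` demands a least weight bound, so existence has to be decidable. Coding
  -- all matrices with entries up to `k` in one `Fin` makes it a finite search.
  Code : Set
  Code = Fin ((suc k ^ n) ^ n)

  matrix : Code → Fin n → Fin n → ℕ
  matrix i u v = toℕ (finToFun {suc k} {n} (finToFun {suc k ^ n} {n} i u) v)

  private
    wsum : (Fin n → Fin n → ℕ) → Fin n → ℕ
    wsum m v = ∑ n (λ u → if adj G v u then m v u else 0)

    Good : Code → Set
    Good i = (∀ u v → adj G u v ≡ true → matrix i u v ≡ matrix i v u × 1 ≤ matrix i u v)
           × (∀ u v → u ≢ v → wsum (matrix i) u ≢ wsum (matrix i) v)

    good? : ∀ i → Dec (Good i)
    good? i =
      all? (λ u → all? λ v → (adj G u v Bool.≟ true) →-dec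
              ((matrix i u v ≟ matrix i v u) ×-dec (1 ≤? matrix i u v)))
      ×-dec
      all? (λ u → all? λ v → ¬? (u Fin.≟ v) →-dec ¬? (wsum (matrix i) u ≟ wsum (matrix i) v))

    decode : ∃ Good → HasIrregularWeighting G k
    decode (i , edge , irr) =
      record { w     = matrix i
             ; w-sym = λ u v e → proj₁ (edge u v e)
             ; w-pos = λ u v e → proj₂ (edge u v e)
             ; w-le  = λ u v _ → toℕ≤pred[n] (finToFun {suc k} {n} (finToFun {suc k ^ n} {n} i u) v) } , irr

    encode : HasIrregularWeighting G k → ∃ Good
    encode (f , irr) = i , edge , irr′
      where
      -- Off the edges `w` is unrestricted; truncation at `k` makes it codable and, by `w-le`,
      -- changes nothing on edges.
      clamp : Fin n → Fin n → Fin (suc k)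
      clamp u v = fromℕ< (s≤s (m⊓n≤n (w f u v) k))
      i : Code
      i = funToFin (λ u → funToFin (clamp u))
      matrix≡w : ∀ u v → adj G u v ≡ true → matrix i u v ≡ w f u v
      matrix≡w u v e = begin
        toℕ (finToFun {suc k} {n} (finToFun {suc k ^ n} {n} i u) v)
          ≡⟨ cong (λ j → toℕ (finToFun {suc k} {n} j v)) (finToFun-funToFin (λ u → funToFin (clamp u)) u) ⟩
        toℕ (finToFun {suc k} {n} (funToFin (clamp u)) v)
          ≡⟨ cong toℕ (finToFun-funToFin (clamp u) v) ⟩
        toℕ (clamp u v)   ≡⟨ toℕ-fromℕ< _ ⟩
        w f u v ⊓ k       ≡⟨ m≤n⇒m⊓n≡m (w-le f u v e) ⟩
        w f u v           ∎
        where open ≡-Reasoning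
      edge : ∀ u v → adj G u v ≡ true → matrix i u v ≡ matrix i v u × 1 ≤ matrix i u v
      edge u v e =
        trans (matrix≡w u v e) (trans (w-sym f u v e) (sym (matrix≡w v u (trans (adj-sym G v u) e)))) ,
        subst (1 ≤_) (sym (matrix≡w u v e)) (w-pos f u v e)
      wsum≡ : ∀ v → wsum (matrix i) v ≡ wdeg f v
      wsum≡ v = ∑-cong n pointwise
        where
        pointwise : ∀ u → (if adj G v u then matrix i v u else 0) ≡ (if adj G v u then w f v u else 0)
        pointwise u with adj G v u in e
        ... | true  = matrix≡w v u e
        ... | false = refl
      irr′ : ∀ u v → u ≢ v → wsum (matrix i) u ≢ wsum (matrix i) v
      irr′ u v u≢v eq = irr u v u≢v (trans (sym (wsum≡ u)) (trans eq (wsum≡ v)))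

  hasIrregularWeighting? : Dec (HasIrregularWeighting G k)
  hasIrregularWeighting? = map′ decode encode (any? good?)

-- Upward search: `b` is the current candidate, everything below it is refuted, and `m` is the
-- number of steps left until the known solution `m + b`.
least : ∀ {P : ℕ → Set} → (∀ j → Dec (P j)) → ∀ m b → (∀ j → 1 ≤ j → j < b → ¬ P j) → 1 ≤ b → P (m + b) →
        ∃ λ s → 1 ≤ s × s ≤ m + b × P s × (∀ j → 1 ≤ j → j < s → ¬ P j)
least P? zero    b below 1≤b Pk = b , 1≤b , ≤-refl , Pk , below
least {P} P? (suc m) b below 1≤b Pk with P? b
... | yes Pb = b , 1≤b , m≤n+m b (suc m) , Pb , below
... | no ¬Pb with least P? m (suc b) below′ (s≤s z≤n) (subst P (sym (+-suc m b)) Pk)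
  where
  below′ : ∀ j → 1 ≤ j → j < suc b → ¬ P j
  below′ j 1≤j j<1+b with m≤n⇒m<n∨m≡n (s≤s⁻¹ j<1+b)
  ... | inj₁ j<b  = below j 1≤j j<b
  ... | inj₂ refl = ¬Pb
...   | s , 1≤s , s≤ , Ps , min = s , 1≤s , ≤-trans s≤ (≤-reflexive (+-suc m b)) , Ps , min

irregularityStrength≤ : ∀ {n} (G : Graph n) k → HasIrregularWeighting G (suc k) →
                        ∃ λ s → IrregularityStrength G s × s ≤ suc k
irregularityStrength≤ G k has
  with least (hasIrregularWeighting? G) k 1 (λ j 1≤j j<1 → contradiction 1≤j (<⇒≱ j<1)) ≤-refl
             (subst (HasIrregularWeighting G) (+-comm 1 k) has)
... | s , 1≤s , s≤ , hs , min = s , (1≤s , hs , min) , ≤-trans s≤ (≤-reflexive (+-comm k 1))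

BoundRat-mono : ∀ p q d n {j k} → j ≤ k → BoundRat p q d n k → BoundRat p q d n j
BoundRat-mono p q d n j≤k (inj₁ lt) = inj₁ (≤-<-trans (*-monoʳ-≤ d j≤k) lt)
BoundRat-mono p q d n j≤k (inj₂ lt) =
  inj₂ (≤-<-trans (*-monoˡ-≤ (d ^ p) (^-monoˡ-≤ q (∸-monoˡ-≤ (28 * d + n) (*-monoʳ-≤ d j≤k)))) lt)

-- Local lemma

module Local (Q : ℕ) (c₀ : Fin Q) where

  instance
    Q≢0 : NonZero Q
    Q≢0 = nonZeroIndex c₀

  Ω : ℕ → Set
  Ω n = Vec (Fin Q) n

  -- The expectation scaled by `Q ^ n`; applied to an indicator it counts the outcomes of an event.
  ∑Ω : ∀ n → (Ω n → ℕ) → ℕ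
  ∑Ω zero    f = f []
  ∑Ω (suc n) f = ∑ Q (λ c → ∑Ω n (λ ω → f (c ∷ ω)))

  ∑Ω-cong : ∀ n {f g : Ω n → ℕ} → (∀ ω → f ω ≡ g ω) → ∑Ω n f ≡ ∑Ω n g
  ∑Ω-cong zero    f≗g = f≗g []
  ∑Ω-cong (suc n) f≗g = ∑-cong Q (λ c → ∑Ω-cong n (λ ω → f≗g (c ∷ ω)))

  ∑Ω-mono : ∀ n {f g : Ω n → ℕ} → (∀ ω → f ω ≤ g ω) → ∑Ω n f ≤ ∑Ω n g
  ∑Ω-mono zero    f≤g = f≤g []
  ∑Ω-mono (suc n) f≤g = ∑-mono Q (λ c → ∑Ω-mono n (λ ω → f≤g (c ∷ ω)))

  ∑Ω-+ : ∀ n (f g : Ω n → ℕ) → ∑Ω n (λ ω → f ω + g ω) ≡ ∑Ω n f + ∑Ω n g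
  ∑Ω-+ zero    f g = refl
  ∑Ω-+ (suc n) f g =
    trans (∑-cong Q (λ c → ∑Ω-+ n (λ ω → f (c ∷ ω)) (λ ω → g (c ∷ ω)))) (∑-distrib-+ Q _ _)

  ∑Ω-*ˡ : ∀ n k (f : Ω n → ℕ) → ∑Ω n (λ ω → k * f ω) ≡ k * ∑Ω n f
  ∑Ω-*ˡ zero    k f = refl
  ∑Ω-*ˡ (suc n) k f = trans (∑-cong Q (λ c → ∑Ω-*ˡ n k (λ ω → f (c ∷ ω)))) (∑-*ˡ Q k _)

  ∑Ω-∑ : ∀ n m (f : Fin m → Ω n → ℕ) → ∑Ω n (λ ω → ∑ m (λ i → f i ω)) ≡ ∑ m (λ i → ∑Ω n (f i))
  ∑Ω-∑ n zero    f = trans (∑Ω-cong n (λ ω → sym (*-zeroˡ 0))) (∑Ω-*ˡ n 0 (λ _ → 0))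
  ∑Ω-∑ n (suc m) f =
    trans (∑Ω-+ n (f zero) (λ ω → ∑ m (λ i → f (suc i) ω))) (cong (∑Ω n (f zero) +_) (∑Ω-∑ n m (f ∘ suc)))

  ∑Ω-1 : ∀ n → ∑Ω n (λ _ → 1) ≡ Q ^ n
  ∑Ω-1 zero    = refl
  ∑Ω-1 (suc n) = trans (∑-cong Q (λ c → ∑Ω-1 n)) (∑-const Q _)

  ∑Ω-pos⇒∃ : ∀ n (f : Ω n → ℕ) → 1 ≤ ∑Ω n f → ∃ λ ω → 1 ≤ f ω
  ∑Ω-pos⇒∃ zero    f 1≤ = [] , 1≤
  ∑Ω-pos⇒∃ (suc n) f 1≤ with ∑-pos⇒∃ Q _ 1≤
  ... | c , 1≤c with ∑Ω-pos⇒∃ n _ 1≤c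
  ...   | ω , p = c ∷ ω , p

  DependsOn : ∀ {n} {A : Set} → (Fin n → Bool) → (Ω n → A) → Set
  DependsOn {n} s f = ∀ (ω ω′ : Ω n) → (∀ i → s i ≡ true → lookup ω i ≡ lookup ω′ i) → f ω ≡ f ω′

  private
    step : ∀ {n} {A : Set} {s : Fin (suc n) → Bool} {f : Ω (suc n) → A} → DependsOn s f →
           ∀ c → DependsOn (s ∘ suc) (λ ω → f (c ∷ ω))
    step dep c ω ω′ agree = dep (c ∷ ω) (c ∷ ω′) λ where
      zero    _  → refl
      (suc i) si → agree i si

    headless : ∀ {n} {A : Set} {s : Fin (suc n) → Bool} {f : Ω (suc n) → A} → DependsOn s f →
               s zero ≡ false → ∀ c ω → f (c ∷ ω) ≡ f (c₀ ∷ ω)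
    headless dep s0 c ω = dep (c ∷ ω) (c₀ ∷ ω) λ where
      zero    s0′ → contradiction (trans (sym s0) s0′) λ ()
      (suc i) _   → refl

  -- Independence of functions with disjoint supports, as E(f g) = E(f) E(g) cleared of
  -- denominators. The head coordinate lies in at most one support, so in the other factor it may be
  -- replaced by the default `c₀`, and that factor leaves the sum over the head.
  indep : ∀ n (s r : Fin n → Bool) (f g : Ω n → ℕ) → (∀ i → s i ≡ true → r i ≡ false) →
          DependsOn s f → DependsOn r g →
          ∑Ω n (λ ω → f ω * g ω) * Q ^ n ≡ ∑Ω n f * ∑Ω n g
  indep zero    s r f g disj df dg = *-identityʳ _
  indep (suc n) s r f g disj df dg = body (s zero) refl
    where
    open ≡-Reasoning
    F G FG : Fin Q → ℕ
    F c  = ∑Ω n (λ ω → f (c ∷ ω))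
    G c  = ∑Ω n (λ ω → g (c ∷ ω))
    FG c = ∑Ω n (λ ω → f (c ∷ ω) * g (c ∷ ω))
    IH : ∀ c → FG c * Q ^ n ≡ F c * G c
    IH c = indep n (s ∘ suc) (r ∘ suc) _ _ (λ i → disj (suc i)) (step df c) (step dg c)
    rearr : ∀ a q Q → a * (Q * q) ≡ Q * (a * q)
    rearr = solve-∀
    common : ∑ Q FG * (Q * Q ^ n) ≡ Q * ∑ Q (λ c → F c * G c)
    common = trans (rearr (∑ Q FG) (Q ^ n) Q)
               (cong (Q *_) (trans (sym (∑-*ʳ Q (Q ^ n) FG)) (∑-cong Q IH)))
    rearr₂ : ∀ q a b → q * (a * b) ≡ a * (q * b)
    rearr₂ = solve-∀
    body : ∀ b → s zero ≡ b → ∑ Q FG * (Q * Q ^ n) ≡ ∑ Q F * ∑ Q G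
    body true s0 = begin
      ∑ Q FG * (Q * Q ^ n)             ≡⟨ common ⟩
      Q * ∑ Q (λ c → F c * G c)        ≡⟨ cong (Q *_) (∑-cong Q (λ c → cong (F c *_) (Gc c))) ⟩
      Q * ∑ Q (λ c → F c * G c₀)     ≡⟨ cong (Q *_) (∑-*ʳ Q (G c₀) F) ⟩
      Q * (∑ Q F * G c₀)             ≡⟨ rearr₂ Q (∑ Q F) (G c₀) ⟩
      ∑ Q F * (Q * G c₀)             ≡⟨ cong (∑ Q F *_) (sym (trans (∑-cong Q Gc) (∑-const Q (G c₀)))) ⟩
      ∑ Q F * ∑ Q G                    ∎
      where
      Gc : ∀ c → G c ≡ G c₀
      Gc c = ∑Ω-cong n (headless dg (disj zero s0) c)
    body false s0 = begin
      ∑ Q FG * (Q * Q ^ n)             ≡⟨ common ⟩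
      Q * ∑ Q (λ c → F c * G c)        ≡⟨ cong (Q *_) (∑-cong Q (λ c → cong (_* G c) (Fc c))) ⟩
      Q * ∑ Q (λ c → F c₀ * G c)     ≡⟨ cong (Q *_) (∑-*ˡ Q (F c₀) G) ⟩
      Q * (F c₀ * ∑ Q G)             ≡⟨ sym (*-assoc Q (F c₀) (∑ Q G)) ⟩
      Q * F c₀ * ∑ Q G               ≡⟨ cong (_* ∑ Q G) (sym (trans (∑-cong Q Fc) (∑-const Q (F c₀)))) ⟩
      ∑ Q F * ∑ Q G                    ∎
      where
      Fc : ∀ c → F c ≡ F c₀
      Fc c = ∑Ω-cong n (headless df s0 c)

  -- Symmetric form, with probabilities cleared of denominators: P stands for 1/p.
  module LocalLemma {n m : ℕ} (bad : Fin m → Ω n → Bool) (supp : Fin m → Fin n → Bool)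
    (bad-supp : ∀ i → DependsOn (supp i) (bad i))
    (dep : Fin m → Fin m → Bool)
    (dep-disjoint : ∀ i j → dep i j ≡ false → ∀ x → supp i x ≡ true → supp j x ≡ false)
    (D P : ℕ) (dep-count : ∀ i → ∑ m (𝟙 ∘ dep i) ≤ D)
    (rare : ∀ i → P * ∑Ω n (𝟙 ∘ bad i) ≤ Q ^ n)
    (4D≤P : 4 * D ≤ P) (3≤P : 3 ≤ P) where

    ok : List (Fin m) → Ω n → ℕ
    ok []      ω = 1
    ok (j ∷ Γ) ω = 𝟙 (not (bad j ω)) * ok Γ ω

    near far : Fin m → List (Fin m) → List (Fin m)
    near i [] = []
    near i (j ∷ Γ) = if dep i j then j ∷ near i Γ else near i Γ
    far i [] = []
    far i (j ∷ Γ) = if dep i j then far i Γ else j ∷ far i Γ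

    ok-split : ∀ i Γ ω → ok Γ ω ≡ ok (near i Γ) ω * ok (far i Γ) ω
    ok-split i []      ω = refl
    ok-split i (j ∷ Γ) ω with dep i j
    ... | true  = trans (cong (𝟙 (not (bad j ω)) *_) (ok-split i Γ ω)) (sym (*-assoc (𝟙 (not (bad j ω))) _ _))
    ... | false = trans (cong (𝟙 (not (bad j ω)) *_) (ok-split i Γ ω))
                        (swap (𝟙 (not (bad j ω))) (ok (near i Γ) ω) (ok (far i Γ) ω))
      where
      swap : ∀ a b c → a * (b * c) ≡ b * (a * c)
      swap = solve-∀

    ok≤1 : ∀ Γ ω → ok Γ ω ≤ 1
    ok≤1 []      ω = ≤-refl
    ok≤1 (j ∷ Γ) ω = *-mono-≤ (𝟙≤1 (not (bad j ω))) (ok≤1 Γ ω)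

    length-split : ∀ i Γ → length (near i Γ) + length (far i Γ) ≡ length Γ
    length-split i []      = refl
    length-split i (j ∷ Γ) with dep i j
    ... | true  = cong suc (length-split i Γ)
    ... | false = trans (+-suc _ _) (cong suc (length-split i Γ))

    -- A list does not record that its events are distinct, so the bound on dependencies is carried
    -- as a property of the list itself; it passes to tails and to `far` parts.
    Sparse : List (Fin m) → Set
    Sparse Γ = ∀ i → length (near i Γ) ≤ D

    near-far : ∀ i j Γ → length (near j (far i Γ)) ≤ length (near j Γ)
    near-far i j []      = z≤n
    near-far i j (k ∷ Γ) with dep i k
    near-far i j (k ∷ Γ) | true with dep j k
    ... | true  = m≤n⇒m≤1+n (near-far i j Γ)
    ... | false = near-far i j Γ
    near-far i j (k ∷ Γ) | false with dep j k
    ... | true  = s≤s (near-far i j Γ)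
    ... | false = near-far i j Γ

    sparse-tail : ∀ j Γ → Sparse (j ∷ Γ) → Sparse Γ
    sparse-tail j Γ sp i with dep i j | sp i
    ... | true  | le = <⇒≤ le
    ... | false | le = le

    ok-far-supp : ∀ i Γ → DependsOn (λ x → not (supp i x)) (ok (far i Γ))
    ok-far-supp i []      ω ω′ agree = refl
    ok-far-supp i (j ∷ Γ) ω ω′ agree with dep i j in eq
    ... | true  = ok-far-supp i Γ ω ω′ agree
    ... | false = cong₂ _*_
      (cong (𝟙 ∘ not) (bad-supp j ω ω′ (λ x sx → agree x (cong not (outside x sx)))))
      (ok-far-supp i Γ ω ω′ agree)
      where
      outside : ∀ x → supp j x ≡ true → supp i x ≡ false
      outside x sx with supp i x in six
      ... | false = refl
      ... | true  = contradiction (trans (sym sx) (dep-disjoint i j eq x six)) λ ()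

    N : List (Fin m) → ℕ
    N Γ = ∑Ω n (ok Γ)

    B : Fin m → List (Fin m) → ℕ
    B i Γ = ∑Ω n (λ ω → 𝟙 (bad i ω) * ok Γ ω)

    Q^n≢0 : NonZero (Q ^ n)
    Q^n≢0 = m^n≢0 Q n

    -- The events in `far i Γ` are independent of `bad i`, so conditioning on avoiding them leaves
    -- its probability at most 1 / P.
    far-bound : ∀ i Γ → P * B i (far i Γ) ≤ N (far i Γ)
    far-bound i Γ = *-cancelʳ-≤ (P * B i (far i Γ)) (N (far i Γ)) (Q ^ n) {{Q^n≢0}} (begin
      P * B i (far i Γ) * Q ^ n              ≡⟨ *-assoc P _ _ ⟩
      P * (B i (far i Γ) * Q ^ n)
        ≡⟨ cong (P *_) (indep n (supp i) (not ∘ supp i) (𝟙 ∘ bad i) (ok (far i Γ)) (λ x → cong not)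
             (λ ω ω′ a → cong 𝟙 (bad-supp i ω ω′ a)) (ok-far-supp i Γ)) ⟩
      P * (∑Ω n (𝟙 ∘ bad i) * N (far i Γ))   ≡⟨ sym (*-assoc P _ _) ⟩
      P * ∑Ω n (𝟙 ∘ bad i) * N (far i Γ)     ≤⟨ *-monoˡ-≤ (N (far i Γ)) (rare i) ⟩
      Q ^ n * N (far i Γ)                    ≡⟨ *-comm (Q ^ n) _ ⟩
      N (far i Γ) * Q ^ n                    ∎)
      where open ≤-Reasoning

    sumB : List (Fin m) → List (Fin m) → ℕ
    sumB []      Γ = 0
    sumB (j ∷ Δ) Γ = B j Γ + sumB Δ Γ

    union : ∀ Δ Γ → N Γ ≤ ∑Ω n (λ ω → ok Δ ω * ok Γ ω) + sumB Δ Γ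
    union []      Γ = ≤-reflexive (sym (trans (+-identityʳ _) (∑Ω-cong n (λ ω → *-identityˡ _))))
    union (j ∷ Δ) Γ = begin
      N Γ                                                  ≤⟨ union Δ Γ ⟩
      ∑Ω n (λ ω → ok Δ ω * ok Γ ω) + sumB Δ Γ              ≤⟨ +-monoˡ-≤ (sumB Δ Γ) (∑Ω-mono n pointwise) ⟩
      ∑Ω n (λ ω → ok (j ∷ Δ) ω * ok Γ ω + 𝟙 (bad j ω) * ok Γ ω) + sumB Δ Γ
        ≡⟨ cong (_+ sumB Δ Γ) (∑Ω-+ n _ _) ⟩
      ∑Ω n (λ ω → ok (j ∷ Δ) ω * ok Γ ω) + B j Γ + sumB Δ Γ
        ≡⟨ +-assoc (∑Ω n (λ ω → ok (j ∷ Δ) ω * ok Γ ω)) (B j Γ) (sumB Δ Γ) ⟩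
      ∑Ω n (λ ω → ok (j ∷ Δ) ω * ok Γ ω) + (B j Γ + sumB Δ Γ) ∎
      where
      open ≤-Reasoning
      pointwise : ∀ ω → ok Δ ω * ok Γ ω ≤ ok (j ∷ Δ) ω * ok Γ ω + 𝟙 (bad j ω) * ok Γ ω
      pointwise ω with bad j ω
      ... | false = ≤-trans (≤-reflexive (cong (_* ok Γ ω) (sym (*-identityˡ (ok Δ ω))))) (m≤m+n _ 0)
      ... | true  = ≤-trans (*-monoˡ-≤ (ok Γ ω) (ok≤1 Δ ω)) ≤-refl

    -- The conditional bound 2 / P, given that all of Γ is avoided. Conditioning only on the far
    -- events would give 1 / P. Avoiding the near ones too costs at most a factor 2: there are at
    -- most D of them, each of conditional probability at most 2 / P, and 2 D / P is at most 1 / 2.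
    -- The bound `k` on the length makes the recursion structural.
    local : ∀ k Γ → length Γ ≤ k → Sparse Γ → ∀ i → P * B i Γ ≤ 2 * N Γ
    local k Γ len sp i = begin
      P * B i Γ           ≤⟨ *-monoʳ-≤ P (∑Ω-mono n B≤) ⟩
      P * B i (far i Γ)   ≤⟨ far-bound i Γ ⟩
      N (far i Γ)         ≤⟨ half k len ⟩
      2 * N Γ             ∎
      where
      open ≤-Reasoning
      B≤ : ∀ ω → 𝟙 (bad i ω) * ok Γ ω ≤ 𝟙 (bad i ω) * ok (far i Γ) ω
      B≤ ω = *-monoʳ-≤ (𝟙 (bad i ω)) (≤-trans (≤-reflexive (ok-split i Γ ω))
               (≤-trans (*-monoˡ-≤ (ok (far i Γ) ω) (ok≤1 (near i Γ) ω)) (≤-reflexive (*-identityˡ _))))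
      N≡ : N Γ ≡ ∑Ω n (λ ω → ok (near i Γ) ω * ok (far i Γ) ω)
      N≡ = ∑Ω-cong n (ok-split i Γ)
      each : ∀ k′ → length (far i Γ) ≤ k′ → ∀ Δ → P * sumB Δ (far i Γ) ≤ length Δ * (2 * N (far i Γ))
      each k′ le []      = ≤-reflexive (*-zeroʳ P)
      each k′ le (j ∷ Δ) = ≤-trans (≤-reflexive (*-distribˡ-+ P (B j (far i Γ)) _))
        (+-mono-≤ (local k′ (far i Γ) le (λ j′ → ≤-trans (near-far i j′ Γ) (sp j′)) j) (each k′ le Δ))
      nearEmpty : length (near i Γ) ≡ 0 → near i Γ ≡ []
      nearEmpty eq with near i Γ
      ... | [] = refl
      final : ∀ x y s D P → 4 * D ≤ P → 1 ≤ P → x ≤ y + s → P * s ≤ D * (2 * x) → x ≤ 2 * y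
      final x y s D P 4D≤P 1≤P x≤ Ps≤ = *-cancelˡ-≤ P {{>-nonZero 1≤P}} (+-cancelʳ-≤ (P * x) (P * x) (P * (2 * y)) (begin
        P * x + P * x                 ≡⟨ e₁ P x ⟩
        2 * (P * x)                   ≤⟨ *-monoʳ-≤ 2 (*-monoʳ-≤ P x≤) ⟩
        2 * (P * (y + s))             ≡⟨ e₂ P y s ⟩
        P * (2 * y) + 2 * (P * s)     ≤⟨ +-monoʳ-≤ (P * (2 * y)) (*-monoʳ-≤ 2 Ps≤) ⟩
        P * (2 * y) + 2 * (D * (2 * x)) ≡⟨ cong (P * (2 * y) +_) (e₃ D x) ⟩
        P * (2 * y) + 4 * D * x       ≤⟨ +-monoʳ-≤ (P * (2 * y)) (*-monoˡ-≤ x 4D≤P) ⟩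
        P * (2 * y) + P * x           ∎))
        where
        e₁ : ∀ P x → P * x + P * x ≡ 2 * (P * x)
        e₁ = solve-∀
        e₂ : ∀ P y s → 2 * (P * (y + s)) ≡ P * (2 * y) + 2 * (P * s)
        e₂ = solve-∀
        e₃ : ∀ D x → 2 * (D * (2 * x)) ≡ 4 * D * x
        e₃ = solve-∀
      -- Without near events both counts agree and nothing is left to prove; otherwise `far i Γ` is
      -- strictly shorter than Γ, so the recursive call has fuel.
      half : ∀ k → length Γ ≤ k → N (far i Γ) ≤ 2 * N Γ
      half k len with length (near i Γ) in eq
      ... | zero  = ≤-trans (≤-reflexive (sym (trans N≡ (∑Ω-cong n (λ ω →
                      trans (cong (λ Δ → ok Δ ω * ok (far i Γ) ω) (nearEmpty eq)) (*-identityˡ _))))))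
                      (m≤m+n (N Γ) _)
      half zero    len | suc l = contradiction (trans (sym (length-split i Γ)) (cong (_+ length (far i Γ)) eq))
                                   λ e → contradiction (subst (_≤ 0) e len) λ ()
      half (suc k) len | suc l = final (N (far i Γ)) (N Γ) (sumB (near i Γ) (far i Γ)) D P 4D≤P (≤-trans (s≤s z≤n) 3≤P)
        (subst (λ z → N (far i Γ) ≤ z + sumB (near i Γ) (far i Γ)) (sym N≡) (union (near i Γ) (far i Γ)))
        (≤-trans (each k shorter (near i Γ)) (*-monoˡ-≤ (2 * N (far i Γ)) (sp i)))
        where
        shorter : length (far i Γ) ≤ k
        shorter = s≤s⁻¹ (≤-trans (s≤s (m≤n+m (length (far i Γ)) l))
                    (≤-trans (≤-reflexive (trans (cong (_+ length (far i Γ)) (sym eq)) (length-split i Γ))) len))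

    -- If avoiding `j` as well left no outcome, `j` would have conditional probability 1, against
    -- the bound 2 / P with P at least 3.
    N-pos : ∀ Γ → Sparse Γ → 1 ≤ N Γ
    N-pos []      sp = subst (1 ≤_) (sym (∑Ω-1 n)) (m^n>0 Q n)
    N-pos (j ∷ Γ) sp with N (j ∷ Γ) in eq
    ... | suc _ = s≤s z≤n
    ... | zero  = contradiction (N-pos Γ (sparse-tail j Γ sp)) (<⇒≱ (n≢0⇒n>0′ N≡0))
      where
      n≢0⇒n>0′ : ∀ {x} → x ≡ 0 → x < 1
      n≢0⇒n>0′ refl = s≤s z≤n
      NB : N Γ ≤ B j Γ
      NB = ≤-trans (∑Ω-mono n pointwise) (≤-trans (≤-reflexive (∑Ω-+ n (ok (j ∷ Γ)) _))
             (≤-reflexive (cong (_+ B j Γ) eq)))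
        where
        pointwise : ∀ ω → ok Γ ω ≤ ok (j ∷ Γ) ω + 𝟙 (bad j ω) * ok Γ ω
        pointwise ω with bad j ω
        ... | false = ≤-trans (≤-reflexive (sym (*-identityˡ (ok Γ ω)))) (m≤m+n _ 0)
        ... | true  = ≤-reflexive (sym (*-identityˡ (ok Γ ω)))
      N≡0 : N Γ ≡ 0
      N≡0 = case N Γ ≟ 0 of λ where
        (yes p) → p
        (no ¬p) → contradiction
          (≤-trans (*-monoʳ-≤ P NB) (local (length Γ) Γ ≤-refl (sparse-tail j Γ sp) j))
          (<⇒≱ (*-monoˡ-< (N Γ) {{≢-nonZero ¬p}} 3≤P))

    near-all : ∀ {m′} (f : Fin m′ → Fin m) i → length (near i (tabulate f)) ≡ ∑ m′ (λ j → 𝟙 (dep i (f j)))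
    near-all {zero}   f i = refl
    near-all {suc m′} f i with dep i (f zero)
    ... | true  = cong suc (near-all (f ∘ suc) i)
    ... | false = near-all (f ∘ suc) i

    ok-all : ∀ {m′} (f : Fin m′ → Fin m) ω → 1 ≤ ok (tabulate f) ω → ∀ j → bad (f j) ω ≡ false
    ok-all {suc m′} f ω 1≤ j with bad (f zero) ω in eq
    ok-all {suc m′} f ω 1≤ zero    | false = eq
    ok-all {suc m′} f ω 1≤ (suc j) | false =
      ok-all (f ∘ suc) ω (subst (1 ≤_) (*-identityˡ (ok (tabulate (f ∘ suc)) ω)) 1≤) j

    lovász : ∃ λ ω → ∀ i → bad i ω ≡ false
    lovász with ∑Ω-pos⇒∃ n (ok (tabulate (λ i → i))) (N-pos (tabulate (λ i → i)) (λ i → ≤-trans (≤-reflexive (near-all (λ j → j) i)) (dep-count i)))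
    ... | ω , 1≤ = ω , ok-all (λ i → i) ω 1≤

-- Large deviations

-- Bernoulli's inequality 1 + a / B ≤ (1 + 1 / B)^a, cleared of denominators.
bernoulli : ∀ B a → (B + a) * B ^ a ≤ (B + 1) ^ a * B
bernoulli B zero    = ≤-reflexive (e B)
  where
  e : ∀ B → (B + 0) * 1 ≡ 1 * B
  e = solve-∀
bernoulli B (suc a) = begin
  (B + suc a) * (B * B ^ a)               ≤⟨ m≤m+n _ (a * B ^ a) ⟩
  (B + suc a) * (B * B ^ a) + a * B ^ a   ≡⟨ e₁ B a (B ^ a) ⟩
  (B + 1) * ((B + a) * B ^ a)             ≤⟨ *-monoʳ-≤ (B + 1) (bernoulli B a) ⟩
  (B + 1) * ((B + 1) ^ a * B)             ≡⟨ sym (*-assoc (B + 1) _ B) ⟩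
  (B + 1) * (B + 1) ^ a * B               ∎
  where
  open ≤-Reasoning
  e₁ : ∀ B a p → (B + (1 + a)) * (B * p) + a * p ≡ (B + 1) * ((B + a) * p)
  e₁ = solve-∀

-- With B = u + r this is (1 + 1 / B)^u (1 - u / B) ≤ 1. The induction keeps B fixed while u shrinks
-- and r grows.
bernoulli⁻ : ∀ u r → (u + r + 1) ^ u * r ≤ (u + r) ^ u * (u + r)
bernoulli⁻ u r = go u r (u + r) refl
  where
  go : ∀ u r B → u + r ≡ B → (B + 1) ^ u * r ≤ B ^ u * B
  go zero    r B eq = *-monoʳ-≤ 1 (≤-reflexive eq)
  go (suc u) r B eq = begin
    (B + 1) * (B + 1) ^ u * r            ≡⟨ e₁ B ((B + 1) ^ u) r ⟩
    (B + 1) ^ u * (B * r + r)            ≤⟨ *-monoʳ-≤ ((B + 1) ^ u) (+-monoʳ-≤ (B * r) (≤-trans (m≤n+m r (suc u)) (≤-reflexive eq))) ⟩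
    (B + 1) ^ u * (B * r + B)            ≡⟨ e₂ B ((B + 1) ^ u) r ⟩
    B * ((B + 1) ^ u * suc r)            ≤⟨ *-monoʳ-≤ B (go u (suc r) B (trans (+-suc u r) eq)) ⟩
    B * (B ^ u * B)                      ≡⟨ sym (*-assoc B _ B) ⟩
    B * B ^ u * B                        ∎
    where
    open ≤-Reasoning
    e₁ : ∀ B p r → (B + 1) * p * r ≡ p * (B * r + r)
    e₁ = solve-∀
    e₂ : ∀ B p r → p * (B * r + B) ≡ B * (p * (1 + r))
    e₂ = solve-∀

-- With N = ρ + 1 this is (1 - 1 / N)^m ≥ 1 - m / N.
power-drop : ∀ ρ m → (suc ρ) ^ m * suc ρ ≤ ρ ^ m * suc ρ + m * (suc ρ) ^ m
power-drop ρ zero    = ≤-reflexive (sym (+-identityʳ _))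
power-drop ρ (suc m) = begin
  N * N ^ m * N                                ≡⟨ e₁ ρ (N ^ m) ⟩
  ρ * (N ^ m * N) + N * N ^ m                  ≤⟨ +-monoˡ-≤ (N * N ^ m) (*-monoʳ-≤ ρ (power-drop ρ m)) ⟩
  ρ * (ρ ^ m * N + m * N ^ m) + N * N ^ m      ≤⟨ m≤m+n _ (m * N ^ m) ⟩
  ρ * (ρ ^ m * N + m * N ^ m) + N * N ^ m + m * N ^ m ≡⟨ e₂ ρ (N ^ m) (ρ ^ m) m ⟩
  ρ * ρ ^ m * N + suc m * (N * N ^ m)          ∎
  where
  open ≤-Reasoning
  N = suc ρ
  e₁ : ∀ ρ p → (1 + ρ) * p * (1 + ρ) ≡ ρ * (p * (1 + ρ)) + (1 + ρ) * p
  e₁ = solve-∀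
  e₂ : ∀ ρ p q m → ρ * (q * (1 + ρ) + m * p) + (1 + ρ) * p + m * p ≡ ρ * q * (1 + ρ) + (1 + m) * ((1 + ρ) * p)
  e₂ = solve-∀

power-half : ∀ ρ m → 2 * m ≤ suc ρ → (suc ρ) ^ m ≤ 2 * ρ ^ m
power-half ρ m 2m≤ = *-cancelʳ-≤ (N ^ m) (2 * ρ ^ m) N (+-cancelʳ-≤ (N ^ m * N) (N ^ m * N) (2 * ρ ^ m * N) (begin
  N ^ m * N + N ^ m * N                  ≡⟨ e₁ (N ^ m * N) ⟩
  2 * (N ^ m * N)                        ≤⟨ *-monoʳ-≤ 2 (power-drop ρ m) ⟩
  2 * (ρ ^ m * N + m * N ^ m)            ≡⟨ e₂ (ρ ^ m) N m (N ^ m) ⟩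
  2 * ρ ^ m * N + 2 * m * N ^ m          ≤⟨ +-monoʳ-≤ (2 * ρ ^ m * N) (*-monoˡ-≤ (N ^ m) 2m≤) ⟩
  2 * ρ ^ m * N + N * N ^ m              ≡⟨ cong (2 * ρ ^ m * N +_) (*-comm N (N ^ m)) ⟩
  2 * ρ ^ m * N + N ^ m * N              ∎))
  where
  open ≤-Reasoning
  N = suc ρ
  e₁ : ∀ x → x + x ≡ 2 * x
  e₁ = solve-∀
  e₂ : ∀ a n m b → 2 * (a * n + m * b) ≡ 2 * a * n + 2 * m * b
  e₂ = solve-∀

^-distribʳ-* : ∀ h a b → (a * b) ^ h ≡ a ^ h * b ^ h
^-distribʳ-* zero    a b = refl
^-distribʳ-* (suc h) a b = trans (cong (a * b *_) (^-distribʳ-* h a b)) (e a b (a ^ h) (b ^ h))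
  where
  e : ∀ a b p q → a * b * (p * q) ≡ a * p * (b * q)
  e = solve-∀

-- The case a = B of Bernoulli's inequality, (1 + 1 / B)^B ≥ 2, raised to the power h.
power-growth : ∀ B h → 1 ≤ B → 2 ^ h * B ^ (B * h) ≤ (B + 1) ^ (B * h)
power-growth B h 1≤B = begin
  2 ^ h * B ^ (B * h)     ≡⟨ cong (2 ^ h *_) (sym (^-*-assoc B B h)) ⟩
  2 ^ h * (B ^ B) ^ h     ≡⟨ sym (^-distribʳ-* h 2 (B ^ B)) ⟩
  (2 * B ^ B) ^ h         ≤⟨ ^-monoˡ-≤ h (*-cancelʳ-≤ (2 * B ^ B) ((B + 1) ^ B) B {{>-nonZero 1≤B}}
                               (≤-trans (≤-reflexive (e B (B ^ B))) (bernoulli B B))) ⟩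
  ((B + 1) ^ B) ^ h       ≡⟨ ^-*-assoc (B + 1) B h ⟩
  (B + 1) ^ (B * h)       ∎
  where
  open ≤-Reasoning
  e : ∀ B p → 2 * p * B ≡ (B + B) * p
  e = solve-∀

^-pos : ∀ b e → 1 ≤ b → 1 ≤ b ^ e
^-pos b e 1≤b = m^n>0 b {{>-nonZero 1≤b}} e

∏ : (n : ℕ) → (Fin n → ℕ) → ℕ
∏ zero    f = 1
∏ (suc n) f = f zero * ∏ n (f ∘ suc)

-- A label in A multiplies the stake B by 1 + u/B, any other label by 1 - a/B. The game is fair, so the
-- product Π over a neighbourhood has mean exactly B ^ m, while a surplus of R h hits makes it larger
-- than B ^ m by a factor 2 ^ h / 2; Markov's inequality then bounds the probability of the surplus.
module Tail (Q : ℕ) (c₀ : Fin Q) (A : Fin Q → Bool) (R : ℕ) (2≤R : 2 ≤ R) where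

  open Local Q c₀

  a u B : ℕ
  a = ∑ Q (𝟙 ∘ A)
  u = ∑ Q (𝟙 ∘ not ∘ A)
  B = Q * R

  a+u≡Q : a + u ≡ Q
  a+u≡Q = trans (sym (∑-distrib-+ Q (𝟙 ∘ A) (𝟙 ∘ not ∘ A)))
            (trans (∑-cong Q (λ c → flip (A c))) (trans (∑-const Q 1) (*-identityʳ Q)))
    where
    flip : ∀ b → 𝟙 b + 𝟙 (not b) ≡ 1
    flip true  = refl
    flip false = refl

  1≤Q : 1 ≤ Q
  1≤Q = >-nonZero⁻¹ Q
  1≤B : 1 ≤ B
  1≤B = *-mono-≤ 1≤Q (≤-trans (s≤s z≤n) 2≤R)

  Q<B : Q < B
  Q<B = begin-strict
    Q       ≡⟨ sym (*-identityʳ Q) ⟩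
    Q * 1   <⟨ *-monoʳ-< Q 2≤R ⟩
    Q * R   ∎
    where open ≤-Reasoning

  -- ρ / (ρ + 1) = 1 - 1 / R² is the second-order loss granted to each neighbour. As 2 m ≤ R², all m
  -- neighbours together lose at most a factor 2.
  ρ : ℕ
  ρ = pred (R * R)

  N≡ : suc ρ ≡ R * R
  N≡ = suc-pred (R * R) {{m*n≢0 R R {{nz}} {{nz}}}}
    where
    nz : NonZero R
    nz = >-nonZero (≤-trans (s≤s z≤n) 2≤R)

  1≤ρ : 1 ≤ ρ
  1≤ρ = s≤s⁻¹ (subst (2 ≤_) (sym N≡) (≤-trans 2≤R (≤-trans (≤-reflexive (sym (*-identityʳ R))) (*-monoʳ-≤ R (≤-trans (s≤s z≤n) 2≤R)))))

  -- (1 - 1/R²) ≤ 1 - (x/B)² for x ≤ Q, where r = B - x.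
  square-gap : ∀ x r → x + r ≡ B → x ≤ Q → ρ * B * B ≤ suc ρ * ((B + x) * r)
  square-gap x r eq x≤Q = +-cancelʳ-≤ (suc ρ * (x * x)) _ _ (begin
    ρ * B * B + suc ρ * (x * x)           ≡⟨ cong (λ N → ρ * B * B + N * (x * x)) N≡ ⟩
    ρ * B * B + R * R * (x * x)           ≤⟨ +-monoʳ-≤ (ρ * B * B) (*-monoʳ-≤ (R * R) (*-mono-≤ x≤Q x≤Q)) ⟩
    ρ * B * B + R * R * (Q * Q)           ≡⟨ e₁ ρ Q R ⟩
    suc ρ * (B * B)                       ≡⟨ cong (λ b → suc ρ * (b * b)) (sym eq) ⟩
    suc ρ * ((x + r) * (x + r))           ≡⟨ cong (suc ρ *_) (e₂ x r) ⟩
    suc ρ * ((x + r + x) * r + x * x)     ≡⟨ cong (λ b → suc ρ * ((b + x) * r + x * x)) eq ⟩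
    suc ρ * ((B + x) * r + x * x)         ≡⟨ *-distribˡ-+ (suc ρ) ((B + x) * r) (x * x) ⟩
    suc ρ * ((B + x) * r) + suc ρ * (x * x) ∎)
    where
    open ≤-Reasoning
    e₁ : ∀ ρ Q R → ρ * (Q * R) * (Q * R) + R * R * (Q * Q) ≡ (1 + ρ) * (Q * R * (Q * R))
    e₁ = solve-∀
    e₂ : ∀ x r → (x + r) * (x + r) ≡ (x + r + x) * r + x * x
    e₂ = solve-∀

  u≤Q : u ≤ Q
  u≤Q = subst (u ≤_) a+u≡Q (m≤n+m u a)
  a≤Q : a ≤ Q
  a≤Q = subst (a ≤_) a+u≡Q (m≤m+n a u)

  -- Up to the loss, the stake factor 1 + u / B is at least (1 + 1 / B)^u: the latter is at most 1 /
  -- (1 - u / B), and `square-gap` compares (1 + u / B)(1 - u / B) with 1 - 1 / R².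
  hit : ρ * B * (B + 1) ^ u ≤ (B + u) * suc ρ * B ^ u
  hit = *-cancelʳ-≤ _ _ r {{>-nonZero 1≤r}} (begin
    ρ * B * (B + 1) ^ u * r               ≡⟨ *-assoc (ρ * B) ((B + 1) ^ u) r ⟩
    ρ * B * ((B + 1) ^ u * r)             ≤⟨ *-monoʳ-≤ (ρ * B) (subst (λ b → (b + 1) ^ u * r ≤ b ^ u * b) eq (bernoulli⁻ u r)) ⟩
    ρ * B * (B ^ u * B)                   ≡⟨ e₁ ρ B (B ^ u) ⟩
    ρ * B * B * B ^ u                     ≤⟨ *-monoˡ-≤ (B ^ u) (square-gap u r eq u≤Q) ⟩
    suc ρ * ((B + u) * r) * B ^ u         ≡⟨ e₂ ρ (B + u) r (B ^ u) ⟩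
    (B + u) * suc ρ * B ^ u * r           ∎)
    where
    open ≤-Reasoning
    r = B ∸ u
    eq : u + r ≡ B
    eq = m+[n∸m]≡n (≤-trans u≤Q (<⇒≤ Q<B))
    1≤r : 1 ≤ r
    1≤r = m<n⇒0<n∸m (≤-<-trans u≤Q Q<B)
    e₁ : ∀ ρ B p → ρ * B * (p * B) ≡ ρ * B * B * p
    e₁ = solve-∀
    e₂ : ∀ ρ x r p → (1 + ρ) * (x * r) * p ≡ x * (1 + ρ) * p * r
    e₂ = solve-∀

  -- The counterpart for a label outside `A`: up to the same loss, 1 - a / B is at least (1 + 1 /
  -- B)^(-a).
  miss : ρ * B * B ^ a ≤ (B ∸ a) * suc ρ * (B + 1) ^ a
  miss = *-cancelʳ-≤ _ _ B {{>-nonZero 1≤B}} (begin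
    ρ * B * B ^ a * B                     ≡⟨ e₁ ρ B (B ^ a) ⟩
    ρ * B * B * B ^ a                     ≤⟨ *-monoˡ-≤ (B ^ a) (square-gap a r eq a≤Q) ⟩
    suc ρ * ((B + a) * r) * B ^ a         ≡⟨ e₂ ρ (B + a) r (B ^ a) ⟩
    r * suc ρ * ((B + a) * B ^ a)         ≤⟨ *-monoʳ-≤ (r * suc ρ) (bernoulli B a) ⟩
    r * suc ρ * ((B + 1) ^ a * B)         ≡⟨ sym (*-assoc (r * suc ρ) ((B + 1) ^ a) B) ⟩
    r * suc ρ * (B + 1) ^ a * B           ∎)
    where
    open ≤-Reasoning
    r = B ∸ a
    eq : a + r ≡ B
    eq = m+[n∸m]≡n (≤-trans a≤Q (<⇒≤ Q<B))
    e₁ : ∀ ρ B p → ρ * B * p * B ≡ ρ * B * B * p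
    e₁ = solve-∀
    e₂ : ∀ ρ x r p → (1 + ρ) * (x * r) * p ≡ r * (1 + ρ) * (x * p)
    e₂ = solve-∀

  factor : Fin Q → ℕ
  factor c = if A c then B + u else B ∸ a

  ∑-factor : ∑ Q factor ≡ B * Q
  ∑-factor = begin
    ∑ Q factor                                          ≡⟨ ∑-cong Q (λ c → split (A c)) ⟩
    ∑ Q (λ c → 𝟙 (A c) * (B + u) + 𝟙 (not (A c)) * (B ∸ a))
      ≡⟨ ∑-distrib-+ Q (λ c → 𝟙 (A c) * (B + u)) (λ c → 𝟙 (not (A c)) * (B ∸ a)) ⟩
    ∑ Q (λ c → 𝟙 (A c) * (B + u)) + ∑ Q (λ c → 𝟙 (not (A c)) * (B ∸ a))
      ≡⟨ cong₂ _+_ (∑-*ʳ Q (B + u) (𝟙 ∘ A)) (∑-*ʳ Q (B ∸ a) (𝟙 ∘ not ∘ A)) ⟩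
    a * (B + u) + u * (B ∸ a)                           ≡⟨ e a u B (B ∸ a) ⟩
    a * B + u * (a + (B ∸ a))                           ≡⟨ cong (λ b → a * B + u * b) (m+[n∸m]≡n (≤-trans a≤Q (<⇒≤ Q<B))) ⟩
    a * B + u * B                                       ≡⟨ sym (*-distribʳ-+ B a u) ⟩
    (a + u) * B                                         ≡⟨ cong (_* B) a+u≡Q ⟩
    Q * B                                               ≡⟨ *-comm Q B ⟩
    B * Q                                               ∎
    where
    open ≡-Reasoning
    split : ∀ b → (if b then B + u else B ∸ a) ≡ 𝟙 b * (B + u) + 𝟙 (not b) * (B ∸ a)
    split true  = sym (trans (+-identityʳ _) (*-identityˡ _))
    split false = sym (*-identityˡ _)
    e : ∀ a u B r → a * (B + u) + u * r ≡ a * B + u * (a + r)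
    e = solve-∀

  Π : ∀ n → (Fin n → Bool) → Ω n → ℕ
  Π n s ω = ∏ n (λ i → if s i then factor (lookup ω i) else 1)

  ∑Ω-Π : ∀ n s → ∑Ω n (Π n s) ≡ B ^ ∑ n (𝟙 ∘ s) * Q ^ n
  ∑Ω-Π zero    s = refl
  ∑Ω-Π (suc n) s with s zero
  ... | true  = begin
    ∑ Q (λ c → ∑Ω n (λ ω → factor c * Π n (s ∘ suc) ω))  ≡⟨ ∑-cong Q (λ c → ∑Ω-*ˡ n (factor c) (Π n (s ∘ suc))) ⟩
    ∑ Q (λ c → factor c * ∑Ω n (Π n (s ∘ suc)))          ≡⟨ ∑-*ʳ Q _ factor ⟩
    ∑ Q factor * ∑Ω n (Π n (s ∘ suc))                    ≡⟨ cong₂ _*_ ∑-factor (∑Ω-Π n (s ∘ suc)) ⟩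
    B * Q * (B ^ ∑ n (𝟙 ∘ s ∘ suc) * Q ^ n)              ≡⟨ e B Q (B ^ ∑ n (𝟙 ∘ s ∘ suc)) (Q ^ n) ⟩
    B * B ^ ∑ n (𝟙 ∘ s ∘ suc) * (Q * Q ^ n)              ∎
    where
    open ≡-Reasoning
    e : ∀ B Q p q → B * Q * (p * q) ≡ B * p * (Q * q)
    e = solve-∀
  ... | false = begin
    ∑ Q (λ c → ∑Ω n (λ ω → 1 * Π n (s ∘ suc) ω))         ≡⟨ ∑-const Q _ ⟩
    Q * ∑Ω n (λ ω → 1 * Π n (s ∘ suc) ω)                 ≡⟨ cong (Q *_) (∑Ω-cong n (λ ω → *-identityˡ (Π n (s ∘ suc) ω))) ⟩
    Q * ∑Ω n (Π n (s ∘ suc))                             ≡⟨ cong (Q *_) (∑Ω-Π n (s ∘ suc)) ⟩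
    Q * (B ^ ∑ n (𝟙 ∘ s ∘ suc) * Q ^ n)                  ≡⟨ e Q (B ^ ∑ n (𝟙 ∘ s ∘ suc)) (Q ^ n) ⟩
    B ^ ∑ n (𝟙 ∘ s ∘ suc) * (Q * Q ^ n)                  ∎
    where
    open ≡-Reasoning
    e : ∀ Q p q → Q * (p * q) ≡ p * (Q * q)
    e = solve-∀

  hits misses : ∀ n → (Fin n → Bool) → Ω n → ℕ
  hits   n s ω = ∑ n (λ i → 𝟙 (s i ∧ A (lookup ω i)))
  misses n s ω = ∑ n (λ i → 𝟙 (s i ∧ not (A (lookup ω i))))

  hits+misses : ∀ n s ω → hits n s ω + misses n s ω ≡ ∑ n (𝟙 ∘ s)
  hits+misses n s ω = trans (sym (∑-distrib-+ n _ _)) (∑-cong n (λ i → split (s i) (A (lookup ω i))))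
    where
    split : ∀ x y → 𝟙 (x ∧ y) + 𝟙 (x ∧ not y) ≡ 𝟙 x
    split true  true  = refl
    split true  false = refl
    split false _     = refl

  -- `hit` and `miss` multiplied over the neighbourhood: Π / B^m is at least (1 - 1 / R²)^m (1 + 1 /
  -- B)^(u h₁ - a h₀). The exponent may be negative, hence the powers on both sides.
  potential : ∀ n s (ω : Ω n) → let m = ∑ n (𝟙 ∘ s); h₁ = hits n s ω; h₀ = misses n s ω in
    ρ ^ m * B ^ m * ((B + 1) ^ (u * h₁) * B ^ (a * h₀)) ≤
    Π n s ω * suc ρ ^ m * (B ^ (u * h₁) * (B + 1) ^ (a * h₀))
  potential zero s [] = ≤-reflexive (cong₂ (λ x y → 1 * 1 * (x * y)) (both u) (both′ a))
    where
    both : ∀ x → (B + 1) ^ (x * 0) ≡ B ^ (x * 0)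
    both x rewrite *-zeroʳ x = refl
    both′ : ∀ x → B ^ (x * 0) ≡ (B + 1) ^ (x * 0)
    both′ x rewrite *-zeroʳ x = refl
  potential (suc n) s (c ∷ ω) with s zero | A c
  ... | false | _ = subst (ρ ^ m * B ^ m * ((B + 1) ^ (u * h₁) * B ^ (a * h₀)) ≤_)
                      (cong (λ x → x * suc ρ ^ m * (B ^ (u * h₁) * (B + 1) ^ (a * h₀))) (sym (*-identityˡ (Π n (s ∘ suc) ω))))
                      (potential n (s ∘ suc) ω)
    where
    m = ∑ n (𝟙 ∘ s ∘ suc)
    h₁ = hits n (s ∘ suc) ω
    h₀ = misses n (s ∘ suc) ω
  ... | true | true = begin
    ρ * ρ ^ m * (B * B ^ m) * ((B + 1) ^ (u * suc h₁) * Y)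
      ≡⟨ cong (λ z → ρ * ρ ^ m * (B * B ^ m) * (z * Y)) (pow-suc (B + 1) u h₁) ⟩
    ρ * ρ ^ m * (B * B ^ m) * ((B + 1) ^ u * (B + 1) ^ (u * h₁) * Y)
      ≡⟨ e₁ ρ (ρ ^ m) B (B ^ m) ((B + 1) ^ u) ((B + 1) ^ (u * h₁)) Y ⟩
    ρ * B * (B + 1) ^ u * (ρ ^ m * B ^ m * ((B + 1) ^ (u * h₁) * Y))
      ≤⟨ *-mono-≤ hit (potential n (s ∘ suc) ω) ⟩
    (B + u) * suc ρ * B ^ u * (Π n (s ∘ suc) ω * suc ρ ^ m * (B ^ (u * h₁) * Z))
      ≡⟨ e₂ (B + u) (suc ρ) (B ^ u) (Π n (s ∘ suc) ω) (suc ρ ^ m) (B ^ (u * h₁)) Z ⟩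
    (B + u) * Π n (s ∘ suc) ω * (suc ρ * suc ρ ^ m) * (B ^ u * B ^ (u * h₁) * Z)
      ≡⟨ cong (λ z → (B + u) * Π n (s ∘ suc) ω * (suc ρ * suc ρ ^ m) * (z * Z)) (sym (pow-suc B u h₁)) ⟩
    (B + u) * Π n (s ∘ suc) ω * (suc ρ * suc ρ ^ m) * (B ^ (u * suc h₁) * Z) ∎
    where
    open ≤-Reasoning
    m = ∑ n (𝟙 ∘ s ∘ suc)
    h₁ = hits n (s ∘ suc) ω
    h₀ = misses n (s ∘ suc) ω
    Y = B ^ (a * h₀)
    Z = (B + 1) ^ (a * h₀)
    pow-suc : ∀ b x h → b ^ (x * suc h) ≡ b ^ x * b ^ (x * h)
    pow-suc b x h = trans (cong (b ^_) (*-suc x h)) (^-distribˡ-+-* b x (x * h))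
    e₁ : ∀ ρ p B q x y Y → ρ * p * (B * q) * (x * y * Y) ≡ ρ * B * x * (p * q * (y * Y))
    e₁ = solve-∀
    e₂ : ∀ x N y Π p z Z → x * N * y * (Π * p * (z * Z)) ≡ x * Π * (N * p) * (y * z * Z)
    e₂ = solve-∀
  ... | true | false = begin
    ρ * ρ ^ m * (B * B ^ m) * (Y * B ^ (a * suc h₀))
      ≡⟨ cong (λ z → ρ * ρ ^ m * (B * B ^ m) * (Y * z)) (pow-suc B a h₀) ⟩
    ρ * ρ ^ m * (B * B ^ m) * (Y * (B ^ a * B ^ (a * h₀)))
      ≡⟨ e₁ ρ (ρ ^ m) B (B ^ m) (B ^ a) (B ^ (a * h₀)) Y ⟩
    ρ * B * B ^ a * (ρ ^ m * B ^ m * (Y * B ^ (a * h₀)))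
      ≤⟨ *-mono-≤ miss (potential n (s ∘ suc) ω) ⟩
    (B ∸ a) * suc ρ * (B + 1) ^ a * (Π n (s ∘ suc) ω * suc ρ ^ m * (Z * (B + 1) ^ (a * h₀)))
      ≡⟨ e₂ (B ∸ a) (suc ρ) ((B + 1) ^ a) (Π n (s ∘ suc) ω) (suc ρ ^ m) ((B + 1) ^ (a * h₀)) Z ⟩
    (B ∸ a) * Π n (s ∘ suc) ω * (suc ρ * suc ρ ^ m) * (Z * ((B + 1) ^ a * (B + 1) ^ (a * h₀)))
      ≡⟨ cong (λ z → (B ∸ a) * Π n (s ∘ suc) ω * (suc ρ * suc ρ ^ m) * (Z * z)) (sym (pow-suc (B + 1) a h₀)) ⟩
    (B ∸ a) * Π n (s ∘ suc) ω * (suc ρ * suc ρ ^ m) * (Z * (B + 1) ^ (a * suc h₀)) ∎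
    where
    open ≤-Reasoning
    m = ∑ n (𝟙 ∘ s ∘ suc)
    h₁ = hits n (s ∘ suc) ω
    h₀ = misses n (s ∘ suc) ω
    Y = (B + 1) ^ (u * h₁)
    Z = B ^ (u * h₁)
    pow-suc : ∀ b x h → b ^ (x * suc h) ≡ b ^ x * b ^ (x * h)
    pow-suc b x h = trans (cong (b ^_) (*-suc x h)) (^-distribˡ-+-* b x (x * h))
    e₁ : ∀ ρ p B q x y Y → ρ * p * (B * q) * (Y * (x * y)) ≡ ρ * B * x * (p * q * (Y * y))
    e₁ = solve-∀
    e₂ : ∀ x N y Π p z Z → x * N * y * (Π * p * (Z * z)) ≡ x * Π * (N * p) * (Z * (y * z))
    e₂ = solve-∀

  module _ (n : ℕ) (s : Fin n → Bool) (h : ℕ) (2m≤R² : 2 * ∑ n (𝟙 ∘ s) ≤ R * R) where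

    private
      m = ∑ n (𝟙 ∘ s)

    -- Since a + u = Q, the exponent u h₁ - a h₀ equals Q h₁ - m a, which a surplus of R h hits
    -- makes at least B h = Q R h; then `power-growth` yields 2^h. The remainder `x` of the exponent
    -- only helps.
    large : ∀ ω → m * a + R * h * Q ≤ Q * hits n s ω → 2 ^ h * B ^ m ≤ 2 * Π n s ω
    large ω dev = *-cancelʳ-≤ _ _ (ρ ^ m) {{>-nonZero (^-pos ρ m 1≤ρ)}} (begin
      2 ^ h * B ^ m * ρ ^ m                ≡⟨ e₁ (2 ^ h) (B ^ m) (ρ ^ m) ⟩
      ρ ^ m * B ^ m * 2 ^ h                ≤⟨ *-cancelʳ-≤ _ _ C {{>-nonZero 1≤C}} cancelled ⟩
      Π n s ω * suc ρ ^ m                  ≤⟨ *-monoʳ-≤ (Π n s ω) (power-half ρ m (subst (2 * m ≤_) (sym N≡) 2m≤R²)) ⟩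
      Π n s ω * (2 * ρ ^ m)                ≡⟨ e₂ (Π n s ω) (ρ ^ m) ⟩
      2 * Π n s ω * ρ ^ m                  ∎)
      where
      open ≤-Reasoning
      h₁ = hits n s ω
      h₀ = misses n s ω
      gap : a * h₀ + B * h ≤ u * h₁
      gap = +-cancelˡ-≤ (a * h₁) _ _ (begin
        a * h₁ + (a * h₀ + B * h)          ≡⟨ f₁ a h₁ h₀ Q R h ⟩
        (h₁ + h₀) * a + R * h * Q          ≡⟨ cong (λ z → z * a + R * h * Q) (hits+misses n s ω) ⟩
        m * a + R * h * Q                  ≤⟨ dev ⟩
        Q * h₁                             ≡⟨ cong (_* h₁) (sym a+u≡Q) ⟩
        (a + u) * h₁                       ≡⟨ *-distribʳ-+ h₁ a u ⟩
        a * h₁ + u * h₁                    ∎)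
        where
        f₁ : ∀ a h₁ h₀ Q R h → a * h₁ + (a * h₀ + Q * R * h) ≡ (h₁ + h₀) * a + R * h * Q
        f₁ = solve-∀
      x = u * h₁ ∸ (a * h₀ + B * h)
      uh₁≡ : u * h₁ ≡ a * h₀ + (B * h + x)
      uh₁≡ = trans (sym (m+[n∸m]≡n gap)) (+-assoc (a * h₀) (B * h) x)
      C = B ^ (B * h) * B ^ x * (B ^ (a * h₀) * (B + 1) ^ (a * h₀))
      1≤C : 1 ≤ C
      1≤C = *-mono-≤ (*-mono-≤ (^-pos B (B * h) 1≤B) (^-pos B x 1≤B))
              (*-mono-≤ (^-pos B (a * h₀) 1≤B) (^-pos (B + 1) (a * h₀) (m≤n+m 1 B)))
      pow-split : ∀ b → b ^ (u * h₁) ≡ b ^ (a * h₀) * (b ^ (B * h) * b ^ x)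
      pow-split b = trans (cong (b ^_) uh₁≡) (trans (^-distribˡ-+-* b (a * h₀) _) (cong (b ^ (a * h₀) *_) (^-distribˡ-+-* b (B * h) x)))
      cancelled : ρ ^ m * B ^ m * 2 ^ h * C ≤ Π n s ω * suc ρ ^ m * C
      cancelled = begin
        ρ ^ m * B ^ m * 2 ^ h * C
          ≡⟨ f₁ (ρ ^ m * B ^ m) (2 ^ h) (B ^ (B * h)) (B ^ x) (B ^ (a * h₀)) ((B + 1) ^ (a * h₀)) ⟩
        ρ ^ m * B ^ m * ((B + 1) ^ (a * h₀) * (2 ^ h * B ^ (B * h) * B ^ x) * B ^ (a * h₀))
          ≤⟨ *-monoʳ-≤ (ρ ^ m * B ^ m) (*-monoˡ-≤ (B ^ (a * h₀)) (*-monoʳ-≤ ((B + 1) ^ (a * h₀))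
               (*-mono-≤ (power-growth B h 1≤B) (^-monoˡ-≤ x (m≤m+n B 1))))) ⟩
        ρ ^ m * B ^ m * ((B + 1) ^ (a * h₀) * ((B + 1) ^ (B * h) * (B + 1) ^ x) * B ^ (a * h₀))
          ≡⟨ cong (λ z → ρ ^ m * B ^ m * (z * B ^ (a * h₀))) (sym (pow-split (B + 1))) ⟩
        ρ ^ m * B ^ m * ((B + 1) ^ (u * h₁) * B ^ (a * h₀))
          ≤⟨ potential n s ω ⟩
        Π n s ω * suc ρ ^ m * (B ^ (u * h₁) * (B + 1) ^ (a * h₀))
          ≡⟨ cong (λ z → Π n s ω * suc ρ ^ m * (z * (B + 1) ^ (a * h₀))) (pow-split B) ⟩
        Π n s ω * suc ρ ^ m * (B ^ (a * h₀) * (B ^ (B * h) * B ^ x) * (B + 1) ^ (a * h₀))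
          ≡⟨ cong (Π n s ω * suc ρ ^ m *_) (f₂ (B ^ (a * h₀)) (B ^ (B * h) * B ^ x) ((B + 1) ^ (a * h₀))) ⟩
        Π n s ω * suc ρ ^ m * C ∎
        where
        f₁ : ∀ k p b x y z → k * p * (b * x * (y * z)) ≡ k * (z * (p * b * x) * y)
        f₁ = solve-∀
        f₂ : ∀ y b z → y * b * z ≡ b * (y * z)
        f₂ = solve-∀
      e₁ : ∀ x y z → x * y * z ≡ z * y * x
      e₁ = solve-∀
      e₂ : ∀ x y → x * (2 * y) ≡ 2 * x * y
      e₂ = solve-∀

    deviates : Ω n → Bool
    deviates ω = m * a + R * h * Q <ᵇ Q * hits n s ω

    tail : 2 ^ h * ∑Ω n (𝟙 ∘ deviates) ≤ 2 * Q ^ n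
    tail = *-cancelˡ-≤ (B ^ m) {{>-nonZero (^-pos B m 1≤B)}} (begin
      B ^ m * (2 ^ h * ∑Ω n (𝟙 ∘ deviates))      ≡⟨ e₁ (B ^ m) (2 ^ h) _ ⟩
      2 ^ h * B ^ m * ∑Ω n (𝟙 ∘ deviates)        ≡⟨ sym (∑Ω-*ˡ n (2 ^ h * B ^ m) (𝟙 ∘ deviates)) ⟩
      ∑Ω n (λ ω → 2 ^ h * B ^ m * 𝟙 (deviates ω)) ≤⟨ ∑Ω-mono n pointwise ⟩
      ∑Ω n (λ ω → 2 * Π n s ω)                   ≡⟨ ∑Ω-*ˡ n 2 (Π n s) ⟩
      2 * ∑Ω n (Π n s)                           ≡⟨ cong (2 *_) (∑Ω-Π n s) ⟩
      2 * (B ^ m * Q ^ n)                        ≡⟨ e₂ (B ^ m) (Q ^ n) ⟩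
      B ^ m * (2 * Q ^ n)                        ∎)
      where
      open ≤-Reasoning
      pointwise : ∀ ω → 2 ^ h * B ^ m * 𝟙 (deviates ω) ≤ 2 * Π n s ω
      pointwise ω with m * a + R * h * Q <ᵇ Q * hits n s ω in eq
      ... | false = ≤-trans (≤-reflexive (*-zeroʳ (2 ^ h * B ^ m))) z≤n
      ... | true  = ≤-trans (≤-reflexive (*-identityʳ _)) (large ω (<⇒≤ (<ᵇ-true _ _ eq)))
      e₁ : ∀ x y z → x * (y * z) ≡ y * x * z
      e₁ = solve-∀
      e₂ : ∀ x y → 2 * (x * y) ≡ x * (2 * y)
      e₂ = solve-∀

-- Balanced labellings of regular graphs

∑-initial : ∀ n c → c ≤ n → ∑ n (λ i → 𝟙 (toℕ i <ᵇ c)) ≡ c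
∑-initial zero    zero    _ = refl
∑-initial (suc n) zero    _ = ∑-zero n
∑-initial (suc n) (suc c) (s≤s c≤n) = cong suc (∑-initial n c c≤n)

module _ {n : ℕ} (G : Graph n) where

  module _ (d : ℕ) (reg : Regular d G) (1≤d : 1 ≤ d) (Q : ℕ) (c₀ : Fin Q) (R h : ℕ)
    (2≤R : 2 ≤ R) (2d≤R² : 2 * d ≤ R * R) (K : ℕ) (A : Fin K → Fin Q → Bool)
    (rich : 16 * (d * d) * K ≤ 2 ^ h) (1≤K : 1 ≤ K) where

    open Local Q c₀

    count : (Fin Q → Bool) → Fin n → Ω n → ℕ
    count A v ω = ∑ n (λ i → 𝟙 (adj G v i ∧ A (lookup ω i)))

    private
      size : (Fin Q → Bool) → ℕ
      size A = ∑ Q (𝟙 ∘ A)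

      deviates : (Fin Q → Bool) → Fin n → Ω n → Bool
      deviates A v ω = deg G v * size A + R * h * Q <ᵇ Q * count A v ω

      tail′ : ∀ A v → 2 ^ h * ∑Ω n (𝟙 ∘ deviates A v) ≤ 2 * Q ^ n
      tail′ A v = Tail.tail Q c₀ A R 2≤R n (adj G v) h (subst (λ x → 2 * x ≤ R * R) (sym (reg v)) 2d≤R²)

      defects : Fin n → Ω n → ℕ
      defects v ω = ∑ K (λ k → 𝟙 (deviates (A k) v ω) + 𝟙 (deviates (not ∘ A k) v ω))

      bad : Fin n → Ω n → Bool
      bad v ω = 0 <ᵇ defects v ω

      count-local : ∀ A v → DependsOn (adj G v) (count A v)
      count-local A v ω ω′ agree = ∑-cong n pointwise
        where
        pointwise : ∀ i → 𝟙 (adj G v i ∧ A (lookup ω i)) ≡ 𝟙 (adj G v i ∧ A (lookup ω′ i))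
        pointwise i with adj G v i in eq
        ... | true  = cong (𝟙 ∘ A) (agree i eq)
        ... | false = refl

      deviates-local : ∀ A v → DependsOn (adj G v) (deviates A v)
      deviates-local A v ω ω′ agree =
        cong (λ k → deg G v * size A + R * h * Q <ᵇ Q * k) (count-local A v ω ω′ agree)

      bad-local : ∀ v → DependsOn (adj G v) (bad v)
      bad-local v ω ω′ agree = cong (0 <ᵇ_) (∑-cong K (λ k → cong₂ (λ x y → 𝟙 x + 𝟙 y)
        (deviates-local (A k) v ω ω′ agree) (deviates-local (not ∘ A k) v ω ω′ agree)))

      common : Fin n → Fin n → ℕ
      common v w = ∑ n (λ x → 𝟙 (adj G v x) * 𝟙 (adj G w x))

      dep : Fin n → Fin n → Bool
      dep v w = 0 <ᵇ common v w

      dep-disjoint : ∀ v w → dep v w ≡ false → ∀ x → adj G v x ≡ true → adj G w x ≡ false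
      dep-disjoint v w ¬dep x vx = 𝟙≡0⇒false (trans (sym (*-identityˡ _))
        (trans (cong (λ b → 𝟙 b * 𝟙 (adj G w x)) (sym vx)) (∑≡0⇒≡0 n _ (n≤0⇒n≡0 (<ᵇ-false 0 (common v w) ¬dep)) x)))

      -- Two events interact only through a common neighbour, and d · d walks of length two start at
      -- `v`.
      dep-count : ∀ v → ∑ n (𝟙 ∘ dep v) ≤ d * d
      dep-count v = begin
        ∑ n (𝟙 ∘ dep v)                                       ≤⟨ ∑-mono n (λ w → 𝟙-positive≤ (common v w)) ⟩
        ∑ n (λ w → ∑ n (λ x → 𝟙 (adj G v x) * 𝟙 (adj G w x)))  ≡⟨ ∑-swap n n _ ⟩
        ∑ n (λ x → ∑ n (λ w → 𝟙 (adj G v x) * 𝟙 (adj G w x)))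
          ≡⟨ ∑-cong n (λ x → trans (∑-*ˡ n (𝟙 (adj G v x)) _)
               (cong (𝟙 (adj G v x) *_) (trans (∑-cong n (λ w → cong 𝟙 (adj-sym G w x))) (reg x)))) ⟩
        ∑ n (λ x → 𝟙 (adj G v x) * d)                         ≡⟨ ∑-*ʳ n d (𝟙 ∘ adj G v) ⟩
        ∑ n (𝟙 ∘ adj G v) * d                                 ≡⟨ cong (_* d) (reg v) ⟩
        d * d                                                 ∎
        where open ≤-Reasoning

      ∑defects : ∀ v → 2 ^ h * ∑Ω n (defects v) ≤ 4 * K * Q ^ n
      ∑defects v = begin
        2 ^ h * ∑Ω n (defects v)                         ≡⟨ cong (2 ^ h *_) (∑Ω-∑ n K _) ⟩
        2 ^ h * ∑ K (λ k → ∑Ω n (λ ω → 𝟙 (deviates (A k) v ω) + 𝟙 (deviates (not ∘ A k) v ω)))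
          ≡⟨ sym (∑-*ˡ K (2 ^ h) _) ⟩
        ∑ K (λ k → 2 ^ h * ∑Ω n (λ ω → 𝟙 (deviates (A k) v ω) + 𝟙 (deviates (not ∘ A k) v ω)))
          ≤⟨ ∑-mono K (λ k → ≤-trans
               (≤-reflexive (trans (cong (2 ^ h *_) (∑Ω-+ n (𝟙 ∘ deviates (A k) v) (𝟙 ∘ deviates (not ∘ A k) v))) (*-distribˡ-+ (2 ^ h) _ _)))
               (+-mono-≤ (tail′ (A k) v) (tail′ (not ∘ A k) v))) ⟩
        ∑ K (λ k → 2 * Q ^ n + 2 * Q ^ n)                ≡⟨ ∑-const K (2 * Q ^ n + 2 * Q ^ n) ⟩
        K * (2 * Q ^ n + 2 * Q ^ n)                      ≡⟨ e₂ K (Q ^ n) ⟩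
        4 * K * Q ^ n                                    ∎
        where
        open ≤-Reasoning
        e₂ : ∀ q x → q * (2 * x + 2 * x) ≡ 4 * q * x
        e₂ = solve-∀

      -- Each of the K test sets and each of their complements fails with probability at most 2 /
      -- 2^h. The sum 4 K / 2^h is at most 1 / (4 d²) by `rich`, as the local lemma asks with D = d²
      -- and P = 4 d².
      rare : ∀ v → 4 * (d * d) * ∑Ω n (𝟙 ∘ bad v) ≤ Q ^ n
      rare v = *-cancelˡ-≤ (4 * K) {{>-nonZero (≤-trans 1≤K (m≤n*m K 4))}} (begin
        4 * K * (4 * (d * d) * ∑Ω n (𝟙 ∘ bad v))         ≡⟨ e₁ K (d * d) _ ⟩
        16 * (d * d) * K * ∑Ω n (𝟙 ∘ bad v)              ≤⟨ *-monoˡ-≤ (∑Ω n (𝟙 ∘ bad v)) rich ⟩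
        2 ^ h * ∑Ω n (𝟙 ∘ bad v)                         ≤⟨ *-monoʳ-≤ (2 ^ h) (∑Ω-mono n (λ ω → 𝟙-positive≤ (defects v ω))) ⟩
        2 ^ h * ∑Ω n (defects v)                         ≤⟨ ∑defects v ⟩
        4 * K * Q ^ n                                    ∎)
        where
        open ≤-Reasoning
        e₁ : ∀ q x y → 4 * q * (4 * x * y) ≡ 16 * x * q * y
        e₁ = solve-∀

      1≤d² : 1 ≤ d * d
      1≤d² = *-mono-≤ 1≤d 1≤d

      good : ∃ λ ω → ∀ v → bad v ω ≡ false
      good = LocalLemma.lovász bad (adj G) bad-local dep dep-disjoint (d * d) (4 * (d * d))
        dep-count rare ≤-refl (≤-trans (s≤s (s≤s (s≤s z≤n))) (*-monoʳ-≤ 4 1≤d²))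

    uniform : ∃ λ ω → ∀ v k → Q * count (A k) v ω ≤ d * ∑ Q (𝟙 ∘ A k) + R * h * Q
                            × Q * count (not ∘ A k) v ω ≤ d * ∑ Q (𝟙 ∘ not ∘ A k) + R * h * Q
    uniform = from good
      where
      none : ∀ ω → (∀ v → bad v ω ≡ false) → ∀ v k → 𝟙 (deviates (A k) v ω) + 𝟙 (deviates (not ∘ A k) v ω) ≡ 0
      none ω fine v k = ∑≡0⇒≡0 K (λ k → 𝟙 (deviates (A k) v ω) + 𝟙 (deviates (not ∘ A k) v ω))
                   (n≤0⇒n≡0 (<ᵇ-false 0 (defects v ω) (fine v))) k
      one : ∀ ω v A → 𝟙 (deviates A v ω) ≡ 0 → Q * count A v ω ≤ d * ∑ Q (𝟙 ∘ A) + R * h * Q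
      one ω v A eq = subst (λ x → Q * count A v ω ≤ x * ∑ Q (𝟙 ∘ A) + R * h * Q) (reg v)
        (<ᵇ-false (deg G v * size A + R * h * Q) (Q * count A v ω) (𝟙≡0⇒false eq))
      from : (∃ λ ω → ∀ v → bad v ω ≡ false) →
             ∃ λ ω → ∀ v k → Q * count (A k) v ω ≤ d * ∑ Q (𝟙 ∘ A k) + R * h * Q
                           × Q * count (not ∘ A k) v ω ≤ d * ∑ Q (𝟙 ∘ not ∘ A k) + R * h * Q
      from (ω , fine) = ω , λ v k →
        one ω v (A k) (m+n≡0⇒m≡0 (𝟙 (deviates (A k) v ω)) (none ω fine v k)) ,
        one ω v (not ∘ A k) (m+n≡0⇒n≡0 (𝟙 (deviates (A k) v ω)) (none ω fine v k))

  nbrsBelow : (Fin n → ℕ) → Fin n → ℕ → ℕ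
  nbrsBelow lab v c = ∑ n (λ u → 𝟙 (adj G v u ∧ (lab u <ᵇ c)))

  BalancedLabelling : (d Q t : ℕ) → (Fin n → ℕ) → Set
  BalancedLabelling d Q t lab = (∀ v → lab v < Q) ×
    (∀ v c → c ≤ Q → Q * nbrsBelow lab v c ≤ d * c + t * Q × d * c ≤ Q * nbrsBelow lab v c + t * Q)

  balancedLabelling : (d : ℕ) → Regular d G → 1 ≤ d → ∀ Q → 1 ≤ Q → ∀ R h → 2 ≤ R → 2 * d ≤ R * R →
    16 * (d * d) * suc Q ≤ 2 ^ h → ∃ (BalancedLabelling d Q (R * h))
  balancedLabelling d reg 1≤d Q 1≤Q R h 2≤R 2d≤R² rich =
    -- The test sets are the initial segments of labels, one for each threshold 0, ..., Q.
    from (uniform d reg 1≤d Q (fromℕ< 1≤Q) R h 2≤R 2d≤R² (suc Q) (λ c x → toℕ x <ᵇ toℕ c) rich (s≤s z≤n))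
    where
    t = R * h
    complement : ∀ b → 𝟙 b + 𝟙 (not b) ≡ 1
    complement true  = refl
    complement false = refl
    complement′ : ∀ x b → 𝟙 (x ∧ b) + 𝟙 (x ∧ not b) ≡ 𝟙 x
    complement′ true  b = complement b
    complement′ false b = refl
    below above : ℕ → ℕ
    below c = ∑ Q (λ x → 𝟙 (toℕ x <ᵇ c))
    above c = ∑ Q (λ x → 𝟙 (not (toℕ x <ᵇ c)))
    below+above : ∀ c → below c + above c ≡ Q
    below+above c = trans (sym (∑-distrib-+ Q _ _))
      (trans (∑-cong Q (λ x → complement (toℕ x <ᵇ c))) (trans (∑-const Q 1) (*-identityʳ Q)))
    nbrsAbove : (Fin n → ℕ) → Fin n → ℕ → ℕ
    nbrsAbove lab v c = ∑ n (λ u → 𝟙 (adj G v u ∧ not (lab u <ᵇ c)))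
    degree : ∀ lab v c → nbrsBelow lab v c + nbrsAbove lab v c ≡ d
    degree lab v c = trans (sym (∑-distrib-+ n _ _))
      (trans (∑-cong n (λ u → complement′ (adj G v u) (lab u <ᵇ c))) (reg v))
    -- Complements turn the upper bound for the labels from `c` on into a lower bound for those
    -- below `c`, since the two counts add up to d and the two sizes to Q.
    lower : ∀ lab v c → Q * nbrsAbove lab v c ≤ d * above c + t * Q → d * below c ≤ Q * nbrsBelow lab v c + t * Q
    lower lab v c le = +-cancelʳ-≤ (d * above c) _ _ (begin
      d * below c + d * above c                          ≡⟨ sym (*-distribˡ-+ d (below c) (above c)) ⟩
      d * (below c + above c)                            ≡⟨ cong₂ _*_ (sym (degree lab v c)) (below+above c) ⟩
      (nbrsBelow lab v c + nbrsAbove lab v c) * Q        ≡⟨ e₁ (nbrsBelow lab v c) (nbrsAbove lab v c) Q ⟩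
      Q * nbrsBelow lab v c + Q * nbrsAbove lab v c      ≤⟨ +-monoʳ-≤ (Q * nbrsBelow lab v c) le ⟩
      Q * nbrsBelow lab v c + (d * above c + t * Q)      ≡⟨ e₂ (Q * nbrsBelow lab v c) (d * above c) (t * Q) ⟩
      Q * nbrsBelow lab v c + t * Q + d * above c        ∎)
      where
      open ≤-Reasoning
      e₁ : ∀ k m Q → (k + m) * Q ≡ Q * k + Q * m
      e₁ = solve-∀
      e₂ : ∀ x y z → x + (y + z) ≡ x + z + y
      e₂ = solve-∀
    from : (∃ λ (ω : Vec (Fin Q) n) → ∀ v (k : Fin (suc Q)) →
              Q * nbrsBelow (λ u → toℕ (lookup ω u)) v (toℕ k) ≤ d * below (toℕ k) + t * Q
            × Q * nbrsAbove (λ u → toℕ (lookup ω u)) v (toℕ k) ≤ d * above (toℕ k) + t * Q) →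
           ∃ (BalancedLabelling d Q t)
    from (ω , fine) = lab , (λ v → toℕ<n (lookup ω v)) , bounds
      where
      lab : Fin n → ℕ
      lab v = toℕ (lookup ω v)
      bounds : ∀ v c → c ≤ Q → Q * nbrsBelow lab v c ≤ d * c + t * Q × d * c ≤ Q * nbrsBelow lab v c + t * Q
      bounds v c c≤Q =
        subst (λ x → Q * nbrsBelow lab v c ≤ d * x + t * Q) (∑-initial Q c c≤Q)
          (subst (λ c → Q * nbrsBelow lab v c ≤ d * below c + t * Q) eq (proj₁ (fine v k))) ,
        subst (λ x → d * x ≤ Q * nbrsBelow lab v c + t * Q) (∑-initial Q c c≤Q)
          (lower lab v c (subst (λ c → Q * nbrsAbove lab v c ≤ d * above c + t * Q) eq (proj₂ (fine v k))))
        where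
        k = fromℕ< (s≤s c≤Q)
        eq : toℕ k ≡ c
        eq = toℕ-fromℕ< (s≤s c≤Q)

∑-mono-< : ∀ n (f g : Fin n → ℕ) i → (∀ j → f j ≤ g j) → f i < g i → ∑ n f < ∑ n g
∑-mono-< (suc n) f g zero    f≤g lt = +-mono-<-≤ lt (∑-mono n (f≤g ∘ suc))
∑-mono-< (suc n) f g (suc i) f≤g lt = +-mono-≤-< (f≤g zero) (∑-mono-< n (f ∘ suc) (g ∘ suc) i (f≤g ∘ suc) lt)

-- Intervals of labels

inside : ℕ → ℕ → ℕ → ℕ
inside a b x = 𝟙 (not (x <ᵇ a) ∧ (x <ᵇ b))

inside-yes : ∀ {a b x} → a ≤ x → x < b → inside a b x ≡ 1
inside-yes a≤x x<b rewrite ≤⇒<ᵇ-false a≤x | <⇒<ᵇ-true x<b = refl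

inside-below : ∀ {a b x} → x < a → inside a b x ≡ 0
inside-below x<a rewrite <⇒<ᵇ-true x<a = refl

inside-above : ∀ {a b x} → b ≤ x → inside a b x ≡ 0
inside-above {a} {b} {x} b≤x rewrite ≤⇒<ᵇ-false b≤x with x <ᵇ a
... | true  = refl
... | false = refl

inside-split : ∀ {a b} x → a ≤ b → 𝟙 (x <ᵇ a) + inside a b x ≡ 𝟙 (x <ᵇ b)
inside-split {a} {b} x a≤b with x <? a
... | yes x<a = trans (cong₂ _+_ (cong 𝟙 (<⇒<ᵇ-true x<a)) (inside-below {a} {b} x<a)) (sym (cong 𝟙 (<⇒<ᵇ-true (<-≤-trans x<a a≤b))))
... | no  x≮a with x <? b
...   | yes x<b = trans (cong₂ _+_ (cong 𝟙 (≤⇒<ᵇ-false (≮⇒≥ x≮a))) (inside-yes (≮⇒≥ x≮a) x<b)) (sym (cong 𝟙 (<⇒<ᵇ-true x<b)))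
...   | no  x≮b = trans (cong₂ _+_ (cong 𝟙 (≤⇒<ᵇ-false (≮⇒≥ x≮a))) (inside-above {a} (≮⇒≥ x≮b))) (sym (cong 𝟙 (≤⇒<ᵇ-false (≮⇒≥ x≮b))))

module Counting {n : ℕ} (G : Graph n) {d : ℕ} (reg : Regular d G) (1≤d : 1 ≤ d) {Q t : ℕ} (lab : Fin n → ℕ)
  (balanced : BalancedLabelling G d Q t lab) where

  E : ℕ
  E = t * Q

  nbrs : Fin n → (ℕ → ℕ) → ℕ
  nbrs v f = ∑ n (λ u → 𝟙 (adj G v u) * f (lab u))

  nbrsIn : Fin n → ℕ → ℕ → ℕ
  nbrsIn v a b = nbrs v (inside a b)

  totalIn : ℕ → ℕ → ℕ
  totalIn a b = ∑ n (λ u → inside a b (lab u))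

  nbrsIn-split : ∀ v {a b} → a ≤ b → nbrsBelow G lab v a + nbrsIn v a b ≡ nbrsBelow G lab v b
  nbrsIn-split v {a} {b} a≤b = trans (sym (∑-distrib-+ n _ _)) (∑-cong n pointwise)
    where
    pointwise : ∀ u → 𝟙 (adj G v u ∧ (lab u <ᵇ a)) + 𝟙 (adj G v u) * inside a b (lab u) ≡ 𝟙 (adj G v u ∧ (lab u <ᵇ b))
    pointwise u with adj G v u
    ... | true  = trans (cong (𝟙 (lab u <ᵇ a) +_) (+-identityʳ _)) (inside-split (lab u) a≤b)
    ... | false = refl

  -- An interval is the difference of two initial segments, so the discrepancy E enters twice.
  nbrsIn-upper : ∀ v {a b} len → a + len ≡ b → b ≤ Q → Q * nbrsIn v a b ≤ d * len + 2 * E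
  nbrsIn-upper v {a} {b} len eq b≤Q = +-cancelˡ-≤ (Q * nbrsBelow G lab v a + d * a) _ _ (begin
    Q * N a + d * a + Q * I             ≡⟨ e₁ Q (N a) (d * a) I ⟩
    Q * (N a + I) + d * a               ≡⟨ cong (λ x → Q * x + d * a) (nbrsIn-split v a≤b) ⟩
    Q * N b + d * a                     ≤⟨ +-mono-≤ (proj₁ (proj₂ balanced v b b≤Q)) (proj₂ (proj₂ balanced v a (≤-trans a≤b b≤Q))) ⟩
    d * b + E + (Q * N a + E)           ≡⟨ cong (λ b → d * b + E + (Q * N a + E)) (sym eq) ⟩
    d * (a + len) + E + (Q * N a + E)   ≡⟨ e₂ d a len E (Q * N a) ⟩
    Q * N a + d * a + (d * len + 2 * E) ∎)
    where
    open ≤-Reasoning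
    N = nbrsBelow G lab v
    I = nbrsIn v a b
    a≤b : a ≤ b
    a≤b = subst (a ≤_) eq (m≤m+n a len)
    e₁ : ∀ Q x y z → Q * x + y + Q * z ≡ Q * (x + z) + y
    e₁ = solve-∀
    e₂ : ∀ d a l E x → d * (a + l) + E + (x + E) ≡ x + d * a + (d * l + 2 * E)
    e₂ = solve-∀

  nbrsIn-lower : ∀ v {a b} len → a + len ≡ b → b ≤ Q → d * len ≤ Q * nbrsIn v a b + 2 * E
  nbrsIn-lower v {a} {b} len eq b≤Q = +-cancelˡ-≤ (d * a + Q * N a) _ _ (begin
    d * a + Q * N a + d * len           ≡⟨ e₁ d a len (Q * N a) ⟩
    d * (a + len) + Q * N a             ≡⟨ cong (λ b → d * b + Q * N a) eq ⟩
    d * b + Q * N a                     ≤⟨ +-mono-≤ (proj₂ (proj₂ balanced v b b≤Q)) (proj₁ (proj₂ balanced v a (≤-trans a≤b b≤Q))) ⟩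
    Q * N b + E + (d * a + E)           ≡⟨ cong (λ x → Q * x + E + (d * a + E)) (sym (nbrsIn-split v a≤b)) ⟩
    Q * (N a + I) + E + (d * a + E)     ≡⟨ e₂ Q (N a) I E (d * a) ⟩
    d * a + Q * N a + (Q * I + 2 * E)   ∎)
    where
    open ≤-Reasoning
    N = nbrsBelow G lab v
    I = nbrsIn v a b
    a≤b : a ≤ b
    a≤b = subst (a ≤_) eq (m≤m+n a len)
    e₁ : ∀ d a l x → d * a + x + d * l ≡ d * (a + l) + x
    e₁ = solve-∀
    e₂ : ∀ Q x z E y → Q * (x + z) + E + (y + E) ≡ y + Q * x + (Q * z + 2 * E)
    e₂ = solve-∀

  -- Double counting: regularity turns the local counts into global ones.
  ∑-nbrsIn : ∀ a b → ∑ n (λ v → nbrsIn v a b) ≡ d * totalIn a b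
  ∑-nbrsIn a b = begin
    ∑ n (λ v → ∑ n (λ u → 𝟙 (adj G v u) * inside a b (lab u)))  ≡⟨ ∑-swap n n _ ⟩
    ∑ n (λ u → ∑ n (λ v → 𝟙 (adj G v u) * inside a b (lab u)))
      ≡⟨ ∑-cong n (λ u → trans (∑-*ʳ n (inside a b (lab u)) (λ v → 𝟙 (adj G v u)))
           (cong (_* inside a b (lab u)) (trans (∑-cong n (λ v → cong 𝟙 (adj-sym G v u))) (reg u)))) ⟩
    ∑ n (λ u → d * inside a b (lab u))                          ≡⟨ ∑-*ˡ n d _ ⟩
    d * totalIn a b                                             ∎
    where open ≡-Reasoning

  totalIn-upper : ∀ {a b} len → a + len ≡ b → b ≤ Q → Q * (d * totalIn a b) ≤ n * (d * len + 2 * E)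
  totalIn-upper {a} {b} len eq b≤Q = begin
    Q * (d * totalIn a b)             ≡⟨ cong (Q *_) (sym (∑-nbrsIn a b)) ⟩
    Q * ∑ n (λ v → nbrsIn v a b)      ≡⟨ sym (∑-*ˡ n Q _) ⟩
    ∑ n (λ v → Q * nbrsIn v a b)      ≤⟨ ∑-mono n (λ v → nbrsIn-upper v len eq b≤Q) ⟩
    ∑ n (λ v → d * len + 2 * E)       ≡⟨ ∑-const n _ ⟩
    n * (d * len + 2 * E)             ∎
    where open ≤-Reasoning

  totalIn-lower : ∀ {a b} len → a + len ≡ b → b ≤ Q → n * (d * len) ≤ Q * (d * totalIn a b) + n * (2 * E)
  totalIn-lower {a} {b} len eq b≤Q = begin
    n * (d * len)                                ≡⟨ sym (∑-const n _) ⟩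
    ∑ n (λ v → d * len)                          ≤⟨ ∑-mono n (λ v → nbrsIn-lower v len eq b≤Q) ⟩
    ∑ n (λ v → Q * nbrsIn v a b + 2 * E)         ≡⟨ ∑-distrib-+ n _ _ ⟩
    ∑ n (λ v → Q * nbrsIn v a b) + ∑ n (λ v → 2 * E)
      ≡⟨ cong₂ _+_ (trans (∑-*ˡ n Q _) (cong (Q *_) (∑-nbrsIn a b))) (∑-const n (2 * E)) ⟩
    Q * (d * totalIn a b) + n * (2 * E)          ∎
    where open ≤-Reasoning

  -- Label first, ties broken by the vertex number: a linear order that refines the order of labels.
  key : Fin n → ℕ
  key u = lab u * n + toℕ u

  key-injective : ∀ u v → key u ≡ key v → u ≡ v
  key-injective u v eq = toℕ-injective (begin
    toℕ u                        ≡⟨ sym (m<n⇒m%n≡m (toℕ<n u)) ⟩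
    toℕ u % n                    ≡⟨ sym ([m+kn]%n≡m%n (toℕ u) (lab u) n) ⟩
    (toℕ u + lab u * n) % n      ≡⟨ cong (_% n) (trans (+-comm (toℕ u) _) (trans eq (+-comm _ (toℕ v)))) ⟩
    (toℕ v + lab v * n) % n      ≡⟨ [m+kn]%n≡m%n (toℕ v) (lab v) n ⟩
    toℕ v % n                    ≡⟨ m<n⇒m%n≡m (toℕ<n v) ⟩
    toℕ v                        ∎)
    where
    open ≡-Reasoning
    instance
      n≢0 : NonZero n
      n≢0 = nonZeroIndex u

  key-mono : ∀ u v → lab u < lab v → key u < key v
  key-mono u v lt = begin-strict
    lab u * n + toℕ u   <⟨ +-monoʳ-< (lab u * n) (toℕ<n u) ⟩
    lab u * n + n       ≡⟨ +-comm (lab u * n) n ⟩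
    suc (lab u) * n     ≤⟨ *-monoˡ-≤ n lt ⟩
    lab v * n           ≤⟨ m≤m+n _ _ ⟩
    lab v * n + toℕ v   ∎
    where open ≤-Reasoning

  rank : ℕ → Fin n → ℕ
  rank a v = ∑ n (λ u → 𝟙 (not (lab u <ᵇ a) ∧ (key u <ᵇ key v)))

  rank-upper : ∀ {a b} v → lab v < b → rank a v ≤ totalIn a b
  rank-upper {a} {b} v v<b = ∑-mono n pointwise
    where
    pointwise : ∀ u → 𝟙 (not (lab u <ᵇ a) ∧ (key u <ᵇ key v)) ≤ inside a b (lab u)
    pointwise u with lab u <ᵇ a | key u <ᵇ key v in eq
    ... | true  | _     = z≤n
    ... | false | false = z≤n
    ... | false | true  = ≤-reflexive (sym (cong 𝟙 (<⇒<ᵇ-true u<b)))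
      where
      u<b : lab u < b
      u<b with lab u <? b
      ... | yes p = p
      ... | no ¬p = contradiction (<ᵇ-true (key u) (key v) eq) (<⇒≯ (key-mono v u (<-≤-trans v<b (≮⇒≥ ¬p))))

  rank-lower : ∀ {a b} v → b ≤ lab v → totalIn a b ≤ rank a v
  rank-lower {a} {b} v b≤v = ∑-mono n pointwise
    where
    pointwise : ∀ u → inside a b (lab u) ≤ 𝟙 (not (lab u <ᵇ a) ∧ (key u <ᵇ key v))
    pointwise u with lab u <ᵇ a | lab u <ᵇ b in eq
    ... | true  | _     = z≤n
    ... | false | false = z≤n
    ... | false | true  = ≤-reflexive (sym (cong 𝟙 (<⇒<ᵇ-true (key-mono u v (<-≤-trans (<ᵇ-true (lab u) b eq) b≤v)))))

  rank-mono : ∀ {a} u v → a ≤ lab u → key u < key v → rank a u < rank a v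
  rank-mono {a} u v a≤u u<v = ∑-mono-< n f g u pointwise strict
    where
    f g : Fin n → ℕ
    f w = 𝟙 (not (lab w <ᵇ a) ∧ (key w <ᵇ key u))
    g w = 𝟙 (not (lab w <ᵇ a) ∧ (key w <ᵇ key v))
    pointwise : ∀ w → f w ≤ g w
    pointwise w with lab w <ᵇ a | key w <ᵇ key u in eq
    ... | true  | _     = z≤n
    ... | false | false = z≤n
    ... | false | true  = ≤-reflexive (sym (cong 𝟙 (<⇒<ᵇ-true (<-trans (<ᵇ-true (key w) (key u) eq) u<v))))
    strict : f u < g u
    strict rewrite ≤⇒<ᵇ-false a≤u | ≤⇒<ᵇ-false (≤-refl {key u}) | <⇒<ᵇ-true u<v = s≤s z≤n

  rank-injective : ∀ {a} u v → a ≤ lab u → a ≤ lab v → rank a u ≡ rank a v → u ≡ v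
  rank-injective {a} u v a≤u a≤v eq with <-cmp (key u) (key v)
  ... | tri< lt _ _ = contradiction eq (<⇒≢ (rank-mono u v a≤u lt))
  ... | tri≈ _ e _  = key-injective u v e
  ... | tri> _ _ gt = contradiction (sym eq) (<⇒≢ (rank-mono v u a≤v gt))

-- Placement of ranks

-- Here Q times the placed value is compared with the expected weighted degree; E = t Q bounds the
-- discrepancy of a label count.

module _ {n d j X T H Q E κ α rk z₁ z₀ z τ W : ℕ} (1≤n : 1 ≤ n) (1≤X : 1 ≤ X) (1≤T : 1 ≤ T)
  (T≤H : T ≤ H) (H≤2T : H ≤ 2 * T) (2≤X : 2 ≤ X) (3α≤κ : 3 * α ≤ κ) (Q≤E : Q ≤ E) (1≤κ : 1 ≤ κ)
  (z≡ : z ≡ z₁ + z₀) (Qz₀ : Q * z₀ ≡ 12 * (κ * E))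
  (room : (X + 2) * d + 37 * E ≤ d * W)
  (τ-lower : H * z ≤ T * τ) (τ-upper : T * τ ≤ H * z + 3 * (T * α)) where

  private
    positive : NonZero (n * X * T)
    positive = >-nonZero (*-mono-≤ (*-mono-≤ 1≤n 1≤X) 1≤T)

    X+2≤2X : X + 2 ≤ 2 * X
    X+2≤2X = ≤-trans (+-monoʳ-≤ X 2≤X) (≤-reflexive (cong (X +_) (sym (+-identityʳ X))))

  -- A bulk vertex of level j has rank near n j X / Q; the slope κ d (X + 2) / (n X) carries this to
  -- κ d j (X + 2) / Q, the size of its base sum. Errors in units of κ E: 4 from the rank, as X + 2
  -- ≤ 2 X, 6 from the base sum and 1 from rounding. The offset `z₀` provides 12.
  placeB-lower : n * (d * (j * X)) ≤ Q * (d * rk) + n * (2 * E) →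
    rk * (κ * d * (X + 2) * T) ≤ n * X * H * z₁ + n * X * H →
    κ * (d * (j * (X + 2)) + 6 * E) ≤ Q * τ
  placeB-lower rk≥ z₁≥ = *-cancelˡ-≤ (n * X * T) {{positive}} (begin
    n * X * T * (κ * (d * (j * (X + 2)) + 6 * E))
      ≡⟨ e₁ n X T κ d j E ⟩
    κ * (X + 2) * T * (n * (d * (j * X))) + 6 * (n * X * T * κ * E)
      ≤⟨ +-monoˡ-≤ _ (*-monoʳ-≤ (κ * (X + 2) * T) rk≥) ⟩
    κ * (X + 2) * T * (Q * (d * rk) + n * (2 * E)) + 6 * (n * X * T * κ * E)
      ≡⟨ e₂ n X T κ d rk Q E ⟩
    Q * (rk * (κ * d * (X + 2) * T)) + 2 * (n * T * κ * E * (X + 2)) + 6 * (n * X * κ * E * T)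
      ≤⟨ +-mono-≤ (+-mono-≤ (*-monoʳ-≤ Q z₁≥) (*-monoʳ-≤ 2 (≤-trans (*-monoʳ-≤ (n * T * κ * E) X+2≤2X)
            (≤-trans (≤-reflexive (e₃ n T κ E X)) (*-monoʳ-≤ (2 * (n * X * κ * E)) T≤H)))))
          (*-monoʳ-≤ 6 (*-monoʳ-≤ (n * X * κ * E) T≤H)) ⟩
    Q * (n * X * H * z₁ + n * X * H) + 2 * (2 * (n * X * κ * E) * H) + 6 * (n * X * κ * E * H)
      ≡⟨ e₄ Q n X H z₁ κ E ⟩
    n * X * H * (Q * z₁) + n * X * H * Q + 10 * (n * X * H * (κ * E))
      ≤⟨ +-monoˡ-≤ (10 * (n * X * H * (κ * E))) (+-monoʳ-≤ (n * X * H * (Q * z₁)) (*-monoʳ-≤ (n * X * H) (≤-trans Q≤E (m≤n*m E κ {{>-nonZero 1≤κ}})))) ⟩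
    n * X * H * (Q * z₁) + n * X * H * (κ * E) + 10 * (n * X * H * (κ * E))
      ≤⟨ m≤m+n _ (n * X * H * (κ * E)) ⟩
    n * X * H * (Q * z₁) + n * X * H * (κ * E) + 10 * (n * X * H * (κ * E)) + n * X * H * (κ * E)
      ≡⟨ e₅ (n * X * H) (Q * z₁) (κ * E) ⟩
    n * X * H * (Q * z₁ + 12 * (κ * E))
      ≡⟨ cong (λ x → n * X * H * (Q * z₁ + x)) (sym Qz₀) ⟩
    n * X * H * (Q * z₁ + Q * z₀)
      ≡⟨ e₆ n X H Q z₁ z₀ ⟩
    n * X * Q * (H * (z₁ + z₀))
      ≡⟨ cong (λ x → n * X * Q * (H * x)) (sym z≡) ⟩
    n * X * Q * (H * z)
      ≤⟨ *-monoʳ-≤ (n * X * Q) τ-lower ⟩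
    n * X * Q * (T * τ)
      ≡⟨ e₇ n X Q T τ ⟩
    n * X * T * (Q * τ) ∎)
    where
    open ≤-Reasoning
    e₁ : ∀ n X T κ d j E → n * X * T * (κ * (d * (j * (X + 2)) + 6 * E)) ≡ κ * (X + 2) * T * (n * (d * (j * X))) + 6 * (n * X * T * κ * E)
    e₁ = solve-∀
    e₂ : ∀ n X T κ d rk Q E → κ * (X + 2) * T * (Q * (d * rk) + n * (2 * E)) + 6 * (n * X * T * κ * E)
         ≡ Q * (rk * (κ * d * (X + 2) * T)) + 2 * (n * T * κ * E * (X + 2)) + 6 * (n * X * κ * E * T)
    e₂ = solve-∀
    e₃ : ∀ n T κ E X → n * T * κ * E * (2 * X) ≡ 2 * (n * X * κ * E) * T
    e₃ = solve-∀
    e₄ : ∀ Q n X H z₁ κ E → Q * (n * X * H * z₁ + n * X * H) + 2 * (2 * (n * X * κ * E) * H) + 6 * (n * X * κ * E * H)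
         ≡ n * X * H * (Q * z₁) + n * X * H * Q + 10 * (n * X * H * (κ * E))
    e₄ = solve-∀
    e₅ : ∀ p q r → p * q + p * r + 10 * (p * r) + p * r ≡ p * (q + 12 * r)
    e₅ = solve-∀
    e₆ : ∀ n X H Q a b → n * X * H * (Q * a + Q * b) ≡ n * X * Q * (H * (a + b))
    e₆ = solve-∀
    e₇ : ∀ n X Q T τ → n * X * Q * (T * τ) ≡ n * X * T * (Q * τ)
    e₇ = solve-∀

  -- The slots provide d W. Ranks within a level spread the values by (X + 2) d. The remaining 37 E
  -- are 4 from the rank, 24 from the offset stretched by H / T ≤ 2, 1 from the shift 3 α in `posB`,
  -- and 8 for the base and slot counts.
  placeB-upper : Q * (d * rk) ≤ n * (d * (suc j * X) + 2 * E) →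
    n * X * H * z₁ ≤ rk * (κ * d * (X + 2) * T) →
    Q * τ + 8 * (κ * E) ≤ κ * (d * (j * (X + 2)) + d * W)
  placeB-upper rk≤ z₁≤ = *-cancelˡ-≤ (n * X * T) {{positive}} (begin
    n * X * T * (Q * τ + 8 * (κ * E))
      ≡⟨ e₁ n X T Q τ κ E ⟩
    n * X * Q * (T * τ) + 8 * (n * X * T * κ * E)
      ≤⟨ +-monoˡ-≤ _ (*-monoʳ-≤ (n * X * Q) τ-upper) ⟩
    n * X * Q * (H * z + 3 * (T * α)) + 8 * (n * X * T * κ * E)
      ≡⟨ cong (λ x → n * X * Q * (H * x + 3 * (T * α)) + 8 * (n * X * T * κ * E)) z≡ ⟩
    n * X * Q * (H * (z₁ + z₀) + 3 * (T * α)) + 8 * (n * X * T * κ * E)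
      ≡⟨ e₂ n X Q H z₁ z₀ T α κ E ⟩
    Q * (n * X * H * z₁) + n * X * H * (Q * z₀) + n * X * T * (Q * (3 * α)) + 8 * (n * X * T * κ * E)
      ≤⟨ +-monoˡ-≤ _ (+-mono-≤ (+-mono-≤ (*-monoʳ-≤ Q z₁≤) (≤-reflexive (cong (n * X * H *_) Qz₀)))
                                (*-monoʳ-≤ (n * X * T) (*-mono-≤ Q≤E 3α≤κ))) ⟩
    Q * (rk * (κ * d * (X + 2) * T)) + n * X * H * (12 * (κ * E)) + n * X * T * (E * κ) + 8 * (n * X * T * κ * E)
      ≡⟨ e₃ Q rk κ d X T n H E ⟩
    κ * (X + 2) * T * (Q * (d * rk)) + 12 * (n * X * κ * E) * H + 9 * (n * X * T * κ * E)
      ≤⟨ +-monoˡ-≤ _ (+-mono-≤ (*-monoʳ-≤ (κ * (X + 2) * T) rk≤) (*-monoʳ-≤ (12 * (n * X * κ * E)) H≤2T)) ⟩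
    κ * (X + 2) * T * (n * (d * (suc j * X) + 2 * E)) + 12 * (n * X * κ * E) * (2 * T) + 9 * (n * X * T * κ * E)
      ≡⟨ e₄ κ X T n d j E ⟩
    n * X * T * κ * (d * (j * (X + 2)) + (X + 2) * d + 33 * E) + n * T * κ * E * (2 * (X + 2))
      ≤⟨ +-monoʳ-≤ _ (*-monoʳ-≤ (n * T * κ * E) (*-monoʳ-≤ 2 X+2≤2X)) ⟩
    n * X * T * κ * (d * (j * (X + 2)) + (X + 2) * d + 33 * E) + n * T * κ * E * (2 * (2 * X))
      ≡⟨ e₅ n X T κ (d * (j * (X + 2))) ((X + 2) * d) E ⟩
    n * X * T * (κ * (d * (j * (X + 2)) + ((X + 2) * d + 37 * E)))
      ≤⟨ *-monoʳ-≤ (n * X * T) (*-monoʳ-≤ κ (+-monoʳ-≤ (d * (j * (X + 2))) room)) ⟩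
    n * X * T * (κ * (d * (j * (X + 2)) + d * W)) ∎)
    where
    open ≤-Reasoning
    e₁ : ∀ n X T Q τ κ E → n * X * T * (Q * τ + 8 * (κ * E)) ≡ n * X * Q * (T * τ) + 8 * (n * X * T * κ * E)
    e₁ = solve-∀
    e₂ : ∀ n X Q H a b T α κ E → n * X * Q * (H * (a + b) + 3 * (T * α)) + 8 * (n * X * T * κ * E)
         ≡ Q * (n * X * H * a) + n * X * H * (Q * b) + n * X * T * (Q * (3 * α)) + 8 * (n * X * T * κ * E)
    e₂ = solve-∀
    e₃ : ∀ Q rk κ d X T n H E → Q * (rk * (κ * d * (X + 2) * T)) + n * X * H * (12 * (κ * E)) + n * X * T * (E * κ) + 8 * (n * X * T * κ * E)
         ≡ κ * (X + 2) * T * (Q * (d * rk)) + 12 * (n * X * κ * E) * H + 9 * (n * X * T * κ * E)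
    e₃ = solve-∀
    e₄ : ∀ κ X T n d j E → κ * (X + 2) * T * (n * (d * ((1 + j) * X) + 2 * E)) + 12 * (n * X * κ * E) * (2 * T) + 9 * (n * X * T * κ * E)
         ≡ n * X * T * κ * (d * (j * (X + 2)) + (X + 2) * d + 33 * E) + n * T * κ * E * (2 * (X + 2))
    e₄ = solve-∀
    e₅ : ∀ n X T κ a b E → n * X * T * κ * (a + b + 33 * E) + n * T * κ * E * (2 * (2 * X))
         ≡ n * X * T * (κ * (a + (b + 37 * E)))
    e₅ = solve-∀

module _ {n d j X H Q E α rk z₁ z₀ z x S : ℕ} (1≤n : 1 ≤ n) (1≤α : 1 ≤ α) (Q≤E : Q ≤ E) (QH≤E : Q * H ≤ E)
  (z≡ : z ≡ z₁ + z₀)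
  (z₀-lower : 2 * (α * (d * S)) ≤ Q * H * z₀ + Q * H) (z₀-upper : Q * H * z₀ ≤ 2 * (α * (d * S)))
  (room : 4 * ((X + 1) * d) + (8 * ((X + 1) * E) + 23 * E) ≤ d * S)
  (x-lower : H * z ≤ x + H * α) (x-upper : x ≤ H * z + α) where

  -- On its S rest labels a toggle vertex has received about α d S / Q from the initial coarse
  -- weights, and its slots can raise this to three times as much. The offset `z₀` aims at the
  -- middle, 2 α d S / Q, leaving a margin of α d S / Q on either side for the spread of a level and
  -- for all errors.
  placeA-lower : n * (d * j) ≤ Q * (d * rk) + n * (2 * E) →
    rk * (4 * α * d * (X + 1)) ≤ n * H * z₁ + n * H →
    4 * α * (d * (j * (X + 1)) + 4 * E) + α * (d * S + 2 * E) ≤ Q * x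
  placeA-lower rk≥ z₁≥ = *-cancelˡ-≤ n {{>-nonZero 1≤n}} (+-cancelʳ-≤ (n * (Q * H * α + Q * H)) _ _ (begin
    n * (4 * α * (d * (j * (X + 1)) + 4 * E) + α * (d * S + 2 * E)) + n * (Q * H * α + Q * H)
      ≡⟨ e₁ n α d j X E (d * S) (Q * H) ⟩
    4 * α * (X + 1) * (n * (d * j)) + n * (18 * (α * E) + α * (d * S) + (Q * H * α + Q * H))
      ≤⟨ +-monoˡ-≤ _ (*-monoʳ-≤ (4 * α * (X + 1)) rk≥) ⟩
    4 * α * (X + 1) * (Q * (d * rk) + n * (2 * E)) + n * (18 * (α * E) + α * (d * S) + (Q * H * α + Q * H))
      ≡⟨ e₂ α X Q d rk n E (d * S) H ⟩
    Q * (rk * (4 * α * d * (X + 1))) + n * (α * (8 * ((X + 1) * E)) + 18 * (α * E) + α * (d * S) + (Q * H * α + Q * H))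
      ≤⟨ +-monoˡ-≤ _ (*-monoʳ-≤ Q z₁≥) ⟩
    Q * (n * H * z₁ + n * H) + n * (α * (8 * ((X + 1) * E)) + 18 * (α * E) + α * (d * S) + (Q * H * α + Q * H))
      ≡⟨ e₃ Q n H z₁ (α * (8 * ((X + 1) * E)) + 18 * (α * E) + α * (d * S)) α ⟩
    n * (Q * H * z₁) + n * (α * (8 * ((X + 1) * E)) + 18 * (α * E) + α * (d * S) + (Q * H * α + 2 * (Q * H)))
      ≤⟨ +-monoʳ-≤ (n * (Q * H * z₁)) (*-monoʳ-≤ n (+-monoʳ-≤ (α * (8 * ((X + 1) * E)) + 18 * (α * E) + α * (d * S)) (+-mono-≤ (*-monoˡ-≤ α QH≤E) (*-monoʳ-≤ 2 (≤-trans QH≤E (m≤n*m E α {{>-nonZero 1≤α}})))))) ⟩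
    n * (Q * H * z₁) + n * (α * (8 * ((X + 1) * E)) + 18 * (α * E) + α * (d * S) + (E * α + 2 * (α * E)))
      ≤⟨ +-monoʳ-≤ (n * (Q * H * z₁)) (*-monoʳ-≤ n bound) ⟩
    n * (Q * H * z₁) + n * (2 * (α * (d * S)))
      ≤⟨ +-monoʳ-≤ (n * (Q * H * z₁)) (*-monoʳ-≤ n z₀-lower) ⟩
    n * (Q * H * z₁) + n * (Q * H * z₀ + Q * H)
      ≡⟨ e₅ n Q H z₁ z₀ ⟩
    n * (Q * (H * (z₁ + z₀)) + Q * H)
      ≡⟨ cong (λ z → n * (Q * (H * z) + Q * H)) (sym z≡) ⟩
    n * (Q * (H * z) + Q * H)
      ≤⟨ *-monoʳ-≤ n (+-monoˡ-≤ (Q * H) (*-monoʳ-≤ Q x-lower)) ⟩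
    n * (Q * (x + H * α) + Q * H)
      ≡⟨ e₆ n Q x H α ⟩
    n * (Q * x) + n * (Q * H * α + Q * H) ∎))
    where
    open ≤-Reasoning
    e₁ : ∀ n α d j X E s q → n * (4 * α * (d * (j * (X + 1)) + 4 * E) + α * (s + 2 * E)) + n * (q * α + q)
         ≡ 4 * α * (X + 1) * (n * (d * j)) + n * (18 * (α * E) + α * s + (q * α + q))
    e₁ = solve-∀
    e₂ : ∀ α X Q d rk n E s H → 4 * α * (X + 1) * (Q * (d * rk) + n * (2 * E)) + n * (18 * (α * E) + α * s + (Q * H * α + Q * H))
         ≡ Q * (rk * (4 * α * d * (X + 1))) + n * (α * (8 * ((X + 1) * E)) + 18 * (α * E) + α * s + (Q * H * α + Q * H))
    e₂ = solve-∀
    e₃ : ∀ Q n H z y α → Q * (n * H * z + n * H) + n * (y + (Q * H * α + Q * H)) ≡ n * (Q * H * z) + n * (y + (Q * H * α + 2 * (Q * H)))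
    e₃ = solve-∀
    bound : α * (8 * ((X + 1) * E)) + 18 * (α * E) + α * (d * S) + (E * α + 2 * (α * E)) ≤ 2 * (α * (d * S))
    bound = begin
      α * (8 * ((X + 1) * E)) + 18 * (α * E) + α * (d * S) + (E * α + 2 * (α * E))
        ≤⟨ m≤m+n _ (α * (4 * ((X + 1) * d) + 2 * E)) ⟩
      α * (8 * ((X + 1) * E)) + 18 * (α * E) + α * (d * S) + (E * α + 2 * (α * E)) + α * (4 * ((X + 1) * d) + 2 * E)
        ≡⟨ f α (8 * ((X + 1) * E)) E (d * S) (4 * ((X + 1) * d)) ⟩
      α * (4 * ((X + 1) * d) + (8 * ((X + 1) * E) + 23 * E)) + α * (d * S)
        ≤⟨ +-monoˡ-≤ (α * (d * S)) (*-monoʳ-≤ α room) ⟩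
      α * (d * S) + α * (d * S)
        ≡⟨ cong (α * (d * S) +_) (sym (+-identityʳ _)) ⟩
      2 * (α * (d * S)) ∎
      where
      f : ∀ α y E s w → α * y + 18 * (α * E) + α * s + (E * α + 2 * (α * E)) + α * (w + 2 * E) ≡ α * (w + (y + 23 * E)) + α * s
      f = solve-∀
    e₅ : ∀ n Q H a b → n * (Q * H * a) + n * (Q * H * b + Q * H) ≡ n * (Q * (H * (a + b)) + Q * H)
    e₅ = solve-∀
    e₆ : ∀ n Q x H α → n * (Q * (x + H * α) + Q * H) ≡ n * (Q * x) + n * (Q * H * α + Q * H)
    e₆ = solve-∀

  placeA-upper : Q * (d * rk) ≤ n * (d * suc j + 2 * E) →
    n * H * z₁ ≤ rk * (4 * α * d * (X + 1)) →
    Q * x + (16 * (α * E) + 6 * (α * E)) ≤ 4 * α * (d * (j * (X + 1))) + 3 * (α * (d * S))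
  placeA-upper rk≤ z₁≤ = *-cancelˡ-≤ n {{>-nonZero 1≤n}} (begin
    n * (Q * x + (16 * (α * E) + 6 * (α * E)))
      ≤⟨ *-monoʳ-≤ n (+-monoˡ-≤ _ (*-monoʳ-≤ Q x-upper)) ⟩
    n * (Q * (H * z + α) + (16 * (α * E) + 6 * (α * E)))
      ≡⟨ cong (λ z → n * (Q * (H * z + α) + (16 * (α * E) + 6 * (α * E)))) z≡ ⟩
    n * (Q * (H * (z₁ + z₀) + α) + (16 * (α * E) + 6 * (α * E)))
      ≡⟨ e₁ n Q H z₁ z₀ α E ⟩
    Q * (n * H * z₁) + n * (Q * H * z₀) + n * (α * Q + 22 * (α * E))
      ≤⟨ +-mono-≤ (+-mono-≤ (*-monoʳ-≤ Q z₁≤) (*-monoʳ-≤ n z₀-upper)) (*-monoʳ-≤ n (+-monoˡ-≤ _ (*-monoʳ-≤ α Q≤E))) ⟩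
    Q * (rk * (4 * α * d * (X + 1))) + n * (2 * (α * (d * S))) + n * (α * E + 22 * (α * E))
      ≡⟨ e₂ Q rk α d X n S E ⟩
    4 * α * (X + 1) * (Q * (d * rk)) + n * (2 * (α * (d * S)) + 23 * (α * E))
      ≤⟨ +-monoˡ-≤ _ (*-monoʳ-≤ (4 * α * (X + 1)) rk≤) ⟩
    4 * α * (X + 1) * (n * (d * suc j + 2 * E)) + n * (2 * (α * (d * S)) + 23 * (α * E))
      ≡⟨ e₃ α X n d j E (d * S) ⟩
    n * (4 * α * (d * (j * (X + 1))) + α * (4 * ((X + 1) * d) + (8 * ((X + 1) * E) + 23 * E)) + 2 * (α * (d * S)))
      ≤⟨ *-monoʳ-≤ n (+-monoˡ-≤ _ (+-monoʳ-≤ (4 * α * (d * (j * (X + 1)))) (*-monoʳ-≤ α room))) ⟩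
    n * (4 * α * (d * (j * (X + 1))) + α * (d * S) + 2 * (α * (d * S)))
      ≡⟨ cong (n *_) (e₄ (4 * α * (d * (j * (X + 1)))) (α * (d * S))) ⟩
    n * (4 * α * (d * (j * (X + 1))) + 3 * (α * (d * S))) ∎)
    where
    open ≤-Reasoning
    e₁ : ∀ n Q H a b α E → n * (Q * (H * (a + b) + α) + (16 * (α * E) + 6 * (α * E)))
         ≡ Q * (n * H * a) + n * (Q * H * b) + n * (α * Q + 22 * (α * E))
    e₁ = solve-∀
    e₂ : ∀ Q rk α d X n S E → Q * (rk * (4 * α * d * (X + 1))) + n * (2 * (α * (d * S))) + n * (α * E + 22 * (α * E))
         ≡ 4 * α * (X + 1) * (Q * (d * rk)) + n * (2 * (α * (d * S)) + 23 * (α * E))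
    e₂ = solve-∀
    e₃ : ∀ α X n d j E s → 4 * α * (X + 1) * (n * (d * (1 + j) + 2 * E)) + n * (2 * (α * s) + 23 * (α * E))
         ≡ n * (4 * α * (d * (j * (X + 1))) + α * (4 * ((X + 1) * d) + (8 * ((X + 1) * E) + 23 * E)) + 2 * (α * s))
    e₃ = solve-∀
    e₄ : ∀ x y → x + y + 2 * y ≡ x + 3 * y
    e₄ = solve-∀

-- Digits separating the kinds of vertices

divMod-unique : ∀ a q r q′ r′ → r < a → r′ < a → a * q + r ≡ a * q′ + r′ → q ≡ q′ × r ≡ r′
divMod-unique a q r q′ r′ r<a r′<a eq = q≡ , r≡
  where
  instance
    a≢0 : NonZero a
    a≢0 = >-nonZero (≤-trans (s≤s z≤n) r<a)
  rem : ∀ q r → r < a → (a * q + r) % a ≡ r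
  rem q r r<a = trans (cong (_% a) (trans (+-comm (a * q) r) (cong (r +_) (*-comm a q))))
                  (trans ([m+kn]%n≡m%n r q a) (m<n⇒m%n≡m r<a))
  r≡ : r ≡ r′
  r≡ = trans (sym (rem q r r<a)) (trans (cong (_% a) eq) (rem q′ r′ r′<a))
  q≡ : q ≡ q′
  q≡ = *-cancelˡ-≡ q q′ a (+-cancelʳ-≡ r (a * q) (a * q′) (trans eq (cong (a * q′ +_) (sym r≡))))

-- Write a number as H α q + α s + r with s < H and r < α. Weighted degrees of bulk vertices have digit
-- s ≥ 3, those of toggle vertices s = 1 or s = 2, those of rest vertices s = 0.
module Blocks (T α : ℕ) {{T≢0 : NonZero T}} {{α≢0 : NonZero α}} where

  H : ℕ
  H = suc (suc (suc T))

  instance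
    Tα≢0 : NonZero (T * α)
    Tα≢0 = m*n≢0 T α

  index : ℕ → ℕ
  index x = (x / α) % H

  index-digits : ∀ q s r → s < H → r < α → index (H * α * q + (α * s + r)) ≡ s
  index-digits q s r s<H r<α = trans (cong (_% H) quotient) (trans ([m+kn]%n≡m%n s q H) (m<n⇒m%n≡m s<H))
    where
    e : ∀ H α q s r → H * α * q + (α * s + r) ≡ r + (s + q * H) * α
    e = solve-∀
    quotient : (H * α * q + (α * s + r)) / α ≡ s + q * H
    quotient = trans (cong (_/ α) (e H α q s r)) (trans (+-distrib-/ r ((s + q * H) * α) small)
      (cong₂ _+_ (m<n⇒m/n≡0 r<α) (m*n/n≡m (s + q * H) α)))
      where
      small : r % α + (s + q * H) * α % α < α
      small = subst (_< α) (sym (trans (cong₂ _+_ (m<n⇒m%n≡m r<α) (m*n%n≡0 (s + q * H) α)) (+-identityʳ r))) r<α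

  -- Increasing enumerations: `posB` of the numbers with digit s ≥ 3, T α of them in each block of
  -- length H α, and `posA` of those with s = 1, α in each block. Up to bounded errors they stretch
  -- by H / T and by H.
  posB posA : ℕ → ℕ
  posB z = H * α * (z / (T * α)) + (3 * α + z % (T * α))
  posA z = H * α * (z / α) + (α + z % α)

  private
    tail<B : ∀ z → 3 * α + z % (T * α) < H * α
    tail<B z = ≤-trans (+-monoʳ-< (3 * α) (m%n<n z (T * α))) (≤-reflexive (e α T))
      where
      e : ∀ α T → 3 * α + T * α ≡ (3 + T) * α
      e = solve-∀

  posB-injective : ∀ z z′ → posB z ≡ posB z′ → z ≡ z′
  posB-injective z z′ eq with divMod-unique (H * α) _ _ _ _ (tail<B z) (tail<B z′) eq
  ... | q≡ , r≡ = trans (m≡m%n+[m/n]*n z (T * α)) (trans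
    (cong₂ (λ r q → r + q * (T * α)) (+-cancelˡ-≡ (3 * α) _ _ r≡) q≡) (sym (m≡m%n+[m/n]*n z′ (T * α))))

  posB-index : ∀ z → 3 ≤ index (posB z)
  posB-index z = subst (3 ≤_) (sym eq) 3≤s
    where
    y = 3 * α + z % (T * α)
    s = y / α
    y≡ : y ≡ α * s + y % α
    y≡ = trans (m≡m%n+[m/n]*n y α) (trans (+-comm (y % α) _) (cong (_+ y % α) (*-comm s α)))
    3≤s : 3 ≤ s
    3≤s = subst (_≤ s) (m*n/n≡m 3 α) (/-monoˡ-≤ α (m≤m+n (3 * α) _))
    s<H : s < H
    s<H = m<n*o⇒m/o<n (tail<B z)
    eq : index (posB z) ≡ s
    eq = trans (cong (λ y → index (H * α * (z / (T * α)) + y)) y≡) (index-digits (z / (T * α)) s (y % α) s<H (m%n<n y α))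

  posB-lower : ∀ z → H * z ≤ T * posB z
  posB-lower z = begin
    H * z                                              ≡⟨ cong (H *_) (m≡m%n+[m/n]*n z (T * α)) ⟩
    H * (r + q * (T * α))                              ≡⟨ e₁ T α q r ⟩
    T * (H * α * q + r) + 3 * r                        ≤⟨ +-monoʳ-≤ (T * (H * α * q + r)) (*-monoʳ-≤ 3 (<⇒≤ (m%n<n z (T * α)))) ⟩
    T * (H * α * q + r) + 3 * (T * α)                  ≡⟨ e₂ T (H * α * q) r α ⟩
    T * (H * α * q + (3 * α + r))                      ∎
    where
    open ≤-Reasoning
    q = z / (T * α)
    r = z % (T * α)
    e₁ : ∀ T α q r → (3 + T) * (r + q * (T * α)) ≡ T * ((3 + T) * α * q + r) + 3 * r
    e₁ = solve-∀
    e₂ : ∀ T x r α → T * (x + r) + 3 * (T * α) ≡ T * (x + (3 * α + r))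
    e₂ = solve-∀

  posB-upper : ∀ z → T * posB z ≤ H * z + 3 * (T * α)
  posB-upper z = begin
    T * (H * α * q + (3 * α + r))                      ≤⟨ m≤m+n _ (3 * r) ⟩
    T * (H * α * q + (3 * α + r)) + 3 * r              ≡⟨ e₁ T α q r ⟩
    H * (r + q * (T * α)) + 3 * (T * α)                ≡⟨ cong (λ z → H * z + 3 * (T * α)) (sym (m≡m%n+[m/n]*n z (T * α))) ⟩
    H * z + 3 * (T * α)                                ∎
    where
    open ≤-Reasoning
    q = z / (T * α)
    r = z % (T * α)
    e₁ : ∀ T α q r → T * ((3 + T) * α * q + (3 * α + r)) + 3 * r ≡ (3 + T) * (r + q * (T * α)) + 3 * (T * α)
    e₁ = solve-∀

  posA-toggle : ∀ z s → posA z + α * s ≡ H * α * (z / α) + (α * suc s + z % α)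
  posA-toggle z s = e (H * α * (z / α)) α (z % α) s
    where
    e : ∀ x α r s → x + (α + r) + α * s ≡ x + (α * (1 + s) + r)
    e = solve-∀

  posA-index : ∀ z s → s ≤ 1 → index (posA z + α * s) ≡ suc s
  posA-index z s s≤1 = trans (cong index (posA-toggle z s))
    (index-digits (z / α) (suc s) (z % α) (s≤s (s≤s (≤-trans s≤1 (s≤s z≤n)))) (m%n<n z α))

  -- A later toggle only moves the digit from 1 to 2; the block and the residue modulo α still
  -- determine z.
  posA-injective : ∀ z s z′ s′ → s ≤ 1 → s′ ≤ 1 → posA z + α * s ≡ posA z′ + α * s′ → z ≡ z′
  posA-injective z s z′ s′ s≤1 s′≤1 eq = trans (m≡m%n+[m/n]*n z α) (trans
      (cong₂ (λ r q → r + q * α) r≡ (proj₁ outer)) (sym (m≡m%n+[m/n]*n z′ α)))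
    where
    tail< : ∀ z s → s ≤ 1 → α * suc s + z % α < H * α
    tail< z s s≤1 = begin-strict
      α * suc s + z % α    <⟨ +-monoʳ-< (α * suc s) (m%n<n z α) ⟩
      α * suc s + α        ≤⟨ +-monoˡ-≤ α (*-monoʳ-≤ α (s≤s s≤1)) ⟩
      α * 2 + α            ≤⟨ m≤m+n _ (T * α) ⟩
      α * 2 + α + T * α    ≡⟨ e α T ⟩
      H * α                ∎
      where
      open ≤-Reasoning
      e : ∀ α T → α * 2 + α + T * α ≡ (3 + T) * α
      e = solve-∀
    outer = divMod-unique (H * α) (z / α) (α * suc s + z % α) (z′ / α) (α * suc s′ + z′ % α) (tail< z s s≤1) (tail< z′ s′ s′≤1)
      (trans (sym (posA-toggle z s)) (trans eq (posA-toggle z′ s′)))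
    r≡ : z % α ≡ z′ % α
    r≡ = proj₂ (divMod-unique α (suc s) (z % α) (suc s′) (z′ % α) (m%n<n z α) (m%n<n z′ α) (proj₂ outer))

  posA-upper : ∀ z → posA z ≤ H * z + α
  posA-upper z = begin
    H * α * q + (α + r)                     ≤⟨ m≤m+n _ ((2 + T) * r) ⟩
    H * α * q + (α + r) + (2 + T) * r       ≡⟨ e T α q r ⟩
    H * (r + q * α) + α                     ≡⟨ cong (λ z → H * z + α) (sym (m≡m%n+[m/n]*n z α)) ⟩
    H * z + α                               ∎
    where
    open ≤-Reasoning
    q = z / α
    r = z % α
    e : ∀ T α q r → (3 + T) * α * q + (α + r) + (2 + T) * r ≡ (3 + T) * (r + q * α) + α
    e = solve-∀

  posA-lower : ∀ z → H * z ≤ posA z + H * α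
  posA-lower z = begin
    H * z                                   ≡⟨ cong (H *_) (m≡m%n+[m/n]*n z α) ⟩
    H * (r + q * α)                         ≡⟨ e T α q r ⟩
    H * α * q + H * r                       ≤⟨ +-mono-≤ (m≤m+n (H * α * q) (α + r)) (*-monoʳ-≤ H (<⇒≤ (m%n<n z α))) ⟩
    H * α * q + (α + r) + H * α             ∎
    where
    open ≤-Reasoning
    q = z / α
    r = z % α
    e : ∀ T α q r → (3 + T) * (r + q * α) ≡ (3 + T) * α * q + (3 + T) * r
    e = solve-∀

-- Kinds of vertices

data Kind : Set where
  bulk toggle rest : ℕ → Kind

ge : ℕ → ℕ → Bool
ge x y = not (x <ᵇ y)

ge-true : ∀ {x y} → y ≤ x → ge x y ≡ true
ge-true y≤x = cong not (≤⇒<ᵇ-false y≤x)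

ge-false : ∀ {x y} → x < y → ge x y ≡ false
ge-false x<y = cong not (<⇒<ᵇ-true x<y)

isToggle isRest : Kind → Bool
isToggle (toggle _) = true
isToggle _          = false
isRest (rest _) = true
isRest _        = false

-- With F = W X: X labels for each of F bulk levels, then one label for each of F toggle levels and
-- of F + W rest levels. Altogether W (X + 1)².
labelCount : ℕ → ℕ → ℕ
labelCount W X = W * X * X + W * X + (W * X + W)

module Kinds (W X : ℕ) {{X≢0 : NonZero X}} where

  F Q FX FXF : ℕ
  F = W * X
  Q = labelCount W X
  FX = F * X
  FXF = F * X + F

  kind : ℕ → Kind
  kind ℓ with ℓ <? FX | ℓ <? FXF
  ... | yes _ | _     = bulk (ℓ / X)
  ... | no _  | yes _ = toggle (ℓ ∸ FX)
  ... | no _  | no _  = rest (ℓ ∸ FXF)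

  data View (ℓ : ℕ) : Kind → Set where
    bulk   : ∀ j → j < F → j * X ≤ ℓ → ℓ < suc j * X → ℓ < FX → View ℓ (bulk j)
    toggle : ∀ j → j < F → ℓ ≡ FX + j → View ℓ (toggle j)
    rest   : ∀ m → m < F + W → ℓ ≡ FXF + m → View ℓ (rest m)

  view : ∀ ℓ → ℓ < Q → View ℓ (kind ℓ)
  view ℓ ℓ<Q with ℓ <? FX | ℓ <? FXF
  ... | yes p | _     = bulk (ℓ / X) (m<n*o⇒m/o<n p) (m/n*n≤m ℓ X)
                          (subst (_< suc (ℓ / X) * X) (sym (m≡m%n+[m/n]*n ℓ X)) (+-monoˡ-< (ℓ / X * X) (m%n<n ℓ X))) p
  ... | no ¬p | yes p = toggle (ℓ ∸ FX) (+-cancelˡ-< FX _ _ (subst (_< FXF) (sym (m+[n∸m]≡n (≮⇒≥ ¬p))) p))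
                          (sym (m+[n∸m]≡n (≮⇒≥ ¬p)))
  ... | no _  | no ¬p = rest (ℓ ∸ FXF) (+-cancelˡ-< FXF _ _ (subst (_< Q) (sym (m+[n∸m]≡n (≮⇒≥ ¬p))) ℓ<Q))
                          (sym (m+[n∸m]≡n (≮⇒≥ ¬p)))

  -- The weight of an edge is 4α times base, plus the amounts chosen in its slots.
  base : Kind → Kind → ℕ
  base (bulk i)   (bulk j)   = 𝟙 (ge (i + j) F)
  base (bulk i)   (toggle j) = 𝟙 (ge (i + j) F)
  base (bulk i)   (rest m)   = 𝟙 (ge (i + m) (F + W))
  base (toggle i) (bulk j)   = 𝟙 (ge (i + j) F)
  base (toggle i) (toggle j) = 𝟙 (ge (i + j) F)
  base (toggle i) (rest m)   = 0
  base (rest m)   (bulk i)   = 𝟙 (ge (i + m) (F + W))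
  base (rest m)   (toggle i) = 0
  base (rest m)   (rest i)   = 0

  base-sym : ∀ k l → base k l ≡ base l k
  base-sym (bulk i)   (bulk j)   = cong (λ x → 𝟙 (ge x F)) (+-comm i j)
  base-sym (bulk i)   (toggle j) = cong (λ x → 𝟙 (ge x F)) (+-comm i j)
  base-sym (bulk i)   (rest m)   = refl
  base-sym (toggle i) (bulk j)   = cong (λ x → 𝟙 (ge x F)) (+-comm i j)
  base-sym (toggle i) (toggle j) = cong (λ x → 𝟙 (ge x F)) (+-comm i j)
  base-sym (toggle i) (rest m)   = refl
  base-sym (rest m)   (bulk j)   = refl
  base-sym (rest m)   (toggle j) = refl
  base-sym (rest m)   (rest _)   = refl

  -- Not symmetric: the first argument is the vertex being adjusted. For `bulk i` the slots are the
  -- W rest levels from F - i up to F + W - i; there are F + W rest levels so that this window fits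
  -- for every i.
  slot : Kind → Kind → Bool
  slot (bulk i)   (rest m)   = ge (i + m) F ∧ (i + m <ᵇ F + W)
  slot (toggle i) (rest m)   = true
  slot (bulk i)   (bulk j)   = false
  slot (bulk i)   (toggle j) = false
  slot (toggle i) (bulk j)   = false
  slot (toggle i) (toggle j) = false
  slot (rest m)   l          = false

  bulkSlot : Kind → ℕ → ℕ
  bulkSlot (bulk i)   m = 𝟙 (slot (bulk i) (rest m))
  bulkSlot (toggle i) m = 0
  bulkSlot (rest i)   m = 0

  private
    FX≤FXF : FX ≤ FXF
    FX≤FXF = m≤m+n FX F

    threshold-bulk : ∀ {ℓ} i ī j → i + ī ≡ F → j * X ≤ ℓ → ℓ < suc j * X → ℓ < FX →
                     𝟙 (ge (i + j) F) ≡ inside (ī * X) FX ℓ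
    threshold-bulk {ℓ} i ī j eq jX≤ ℓ<jX ℓ<FX with ī ≤? j
    ... | yes ī≤j = trans (cong 𝟙 (ge-true (subst (_≤ i + j) eq (+-monoʳ-≤ i ī≤j))))
                      (sym (inside-yes (≤-trans (*-monoˡ-≤ X ī≤j) jX≤) ℓ<FX))
    ... | no  ī≰j = trans (cong 𝟙 (ge-false (subst (i + j <_) eq (+-monoʳ-< i (≰⇒> ī≰j)))))
                      (sym (inside-below {b = FX} (<-≤-trans ℓ<jX (*-monoˡ-≤ X (≰⇒> ī≰j)))))

    threshold-shift : ∀ {ℓ} c i ī j b → i + ī ≡ b → ℓ ≡ c + j → ∀ {top} → ℓ < top →
                      𝟙 (ge (i + j) b) ≡ inside (c + ī) top ℓ
    threshold-shift {ℓ} c i ī j b eq ℓ≡ {top} ℓ<top with ī ≤? j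
    ... | yes ī≤j = trans (cong 𝟙 (ge-true (subst (_≤ i + j) eq (+-monoʳ-≤ i ī≤j))))
                      (sym (inside-yes (subst (c + ī ≤_) (sym ℓ≡) (+-monoʳ-≤ c ī≤j)) ℓ<top))
    ... | no  ī≰j = trans (cong 𝟙 (ge-false (subst (i + j <_) eq (+-monoʳ-< i (≰⇒> ī≰j)))))
                      (sym (inside-below {b = top} (subst (_< c + ī) (sym ℓ≡) (+-monoʳ-< c (≰⇒> ī≰j)))))

    sum₃ : ∀ {x a b c} → x ≡ a → b ≡ 0 → c ≡ 0 → x ≡ a + b + c
    sum₃ {a = a} refl refl refl = sym (trans (+-identityʳ (a + 0)) (+-identityʳ a))

    <FXF : ∀ {ℓ j} → j < F → ℓ ≡ FX + j → ℓ < FXF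
    <FXF j<F refl = +-monoʳ-< FX j<F

    FX≤ : ∀ {ℓ j} → ℓ ≡ FX + j → FX ≤ ℓ
    FX≤ refl = m≤m+n FX _

    FXF≤ : ∀ {ℓ m} → ℓ ≡ FXF + m → FXF ≤ ℓ
    FXF≤ refl = m≤m+n FXF _

    <Q : ∀ {ℓ m} → m < F + W → ℓ ≡ FXF + m → ℓ < Q
    <Q m< refl = +-monoʳ-< FXF m<

  -- With ī = F - i the condition on level sums selects a final interval of each class, of i X, i
  -- and i labels: the degree is thus nearly proportional to i (X + 2).
  base-bulk : ∀ {ℓ k} i ī → i + ī ≡ F → View ℓ k →
    base (bulk i) k ≡ inside (ī * X) FX ℓ + inside (FX + ī) FXF ℓ + inside (FXF + (ī + W)) Q ℓ
  base-bulk {ℓ} i ī eq (bulk j j<F lo hi ℓ<FX) =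
    sum₃ (threshold-bulk i ī j eq lo hi ℓ<FX)
      (inside-below {b = FXF} (<-≤-trans ℓ<FX (m≤m+n FX ī)))
      (inside-below {b = Q} (<-≤-trans ℓ<FX (≤-trans FX≤FXF (m≤m+n FXF (ī + W)))))
  base-bulk {ℓ} i ī eq (toggle j j<F ℓ≡) =
    trans (sum₃ (threshold-shift FX i ī j F eq ℓ≡ (<FXF j<F ℓ≡)) (inside-above {ī * X} (FX≤ ℓ≡))
            (inside-below {b = Q} (<-≤-trans (<FXF j<F ℓ≡) (m≤m+n FXF (ī + W)))))
      (cong (_+ inside (FXF + (ī + W)) Q ℓ) (+-comm (inside (FX + ī) FXF ℓ) (inside (ī * X) FX ℓ)))
  base-bulk {ℓ} i ī eq (rest m m<F+W ℓ≡) =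
    trans (threshold-shift FXF i (ī + W) m (F + W) (trans (sym (+-assoc i ī W)) (cong (_+ W) eq)) ℓ≡ (<Q m<F+W ℓ≡))
      (sym (cong₂ (λ a b → a + b + inside (FXF + (ī + W)) Q ℓ)
        (inside-above {ī * X} (≤-trans FX≤FXF (FXF≤ ℓ≡))) (inside-above {FX + ī} (FXF≤ ℓ≡))))

  base-toggle : ∀ {ℓ k} i ī → i + ī ≡ F → View ℓ k →
    base (toggle i) k ≡ inside (ī * X) FX ℓ + inside (FX + ī) FXF ℓ
  base-toggle {ℓ} i ī eq (bulk j j<F lo hi ℓ<FX) =
    trans (threshold-bulk i ī j eq lo hi ℓ<FX) (trans (sym (+-identityʳ _))
      (cong (inside (ī * X) FX ℓ +_) (sym (inside-below {b = FXF} (<-≤-trans ℓ<FX (m≤m+n FX ī))))))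
  base-toggle {ℓ} i ī eq (toggle j j<F ℓ≡) =
    trans (threshold-shift FX i ī j F eq ℓ≡ (<FXF j<F ℓ≡))
      (cong (_+ inside (FX + ī) FXF ℓ) (sym (inside-above {ī * X} (FX≤ ℓ≡))))
  base-toggle {ℓ} i ī eq (rest m m<F+W ℓ≡) =
    sym (cong₂ _+_ (inside-above {ī * X} (≤-trans FX≤FXF (FXF≤ ℓ≡))) (inside-above {FX + ī} (FXF≤ ℓ≡)))

  slot-bulk : ∀ {ℓ k} i ī → i + ī ≡ F → View ℓ k →
    𝟙 (slot (bulk i) k) ≡ inside (FXF + ī) (FXF + ī + W) ℓ
  slot-bulk i ī eq (bulk j j<F lo hi ℓ<FX) =
    sym (inside-below {b = FXF + ī + W} (<-≤-trans ℓ<FX (≤-trans FX≤FXF (m≤m+n FXF ī))))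
  slot-bulk i ī eq (toggle j j<F ℓ≡) =
    sym (inside-below {b = FXF + ī + W} (<-≤-trans (<FXF j<F ℓ≡) (m≤m+n FXF ī)))
  slot-bulk {ℓ} i ī eq (rest m m<F+W ℓ≡) with ī ≤? m
  ... | no ī≰m = trans (cong (λ b → 𝟙 (b ∧ (i + m <ᵇ F + W))) (ge-false (subst (i + m <_) eq (+-monoʳ-< i (≰⇒> ī≰m)))))
                   (sym (inside-below {b = FXF + ī + W} (subst (_< FXF + ī) (sym ℓ≡) (+-monoʳ-< FXF (≰⇒> ī≰m)))))
  ... | yes ī≤m with m <? ī + W
  ...   | yes m< = trans (cong₂ (λ a b → 𝟙 (a ∧ b)) (ge-true (subst (_≤ i + m) eq (+-monoʳ-≤ i ī≤m)))
                       (<⇒<ᵇ-true (subst (i + m <_) (trans (sym (+-assoc i ī W)) (cong (_+ W) eq)) (+-monoʳ-< i m<))))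
                     (sym (inside-yes (subst (FXF + ī ≤_) (sym ℓ≡) (+-monoʳ-≤ FXF ī≤m))
                       (subst₂ _<_ (sym ℓ≡) (sym (+-assoc FXF ī W)) (+-monoʳ-< FXF m<))))
  ...   | no m≮  = trans (cong₂ (λ a b → 𝟙 (a ∧ b)) (ge-true (subst (_≤ i + m) eq (+-monoʳ-≤ i ī≤m)))
                       (≤⇒<ᵇ-false (subst (_≤ i + m) (trans (sym (+-assoc i ī W)) (cong (_+ W) eq)) (+-monoʳ-≤ i (≮⇒≥ m≮)))))
                     (sym (inside-above {FXF + ī} (subst₂ _≤_ (sym (+-assoc FXF ī W)) (sym ℓ≡) (+-monoʳ-≤ FXF (≮⇒≥ m≮)))))

  isRest-inside : ∀ {ℓ k} → View ℓ k → 𝟙 (isRest k) ≡ inside FXF Q ℓ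
  isRest-inside (bulk j j<F lo hi ℓ<FX) = sym (inside-below {b = Q} (<-≤-trans ℓ<FX FX≤FXF))
  isRest-inside (toggle j j<F ℓ≡)       = sym (inside-below {b = Q} (<FXF j<F ℓ≡))
  isRest-inside (rest m m<F+W ℓ≡)       = sym (inside-yes (FXF≤ ℓ≡) (<Q m<F+W ℓ≡))

  isToggle-inside : ∀ {ℓ k} → View ℓ k → 𝟙 (isToggle k) ≡ inside FX FXF ℓ
  isToggle-inside (bulk j j<F lo hi ℓ<FX) = sym (inside-below {b = FXF} ℓ<FX)
  isToggle-inside (toggle j j<F ℓ≡)       = sym (inside-yes (FX≤ ℓ≡) (<FXF j<F ℓ≡))
  isToggle-inside (rest m m<F+W ℓ≡)       = sym (inside-above {FX} (FXF≤ ℓ≡))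

  slot-toggle : ∀ {ℓ k} i → View ℓ k → 𝟙 (slot (toggle i) k) ≡ inside FXF Q ℓ
  slot-toggle i v@(bulk _ _ _ _ _) = isRest-inside v
  slot-toggle i v@(toggle _ _ _)   = isRest-inside v
  slot-toggle i v@(rest _ _ _)     = isRest-inside v

  rest-lower : ∀ {ℓ k} m m̄ → m + m̄ ≡ F → View ℓ k → inside (m̄ * X) FX ℓ ≤ base (rest (W + m)) k
  rest-lower {ℓ} m m̄ eq (bulk j j<F lo hi ℓ<FX) = ≤-reflexive (trans
    (sym (threshold-bulk m m̄ j eq lo hi ℓ<FX)) (cong 𝟙 shift))
    where
    shift : ge (m + j) F ≡ ge (j + (W + m)) (F + W)
    shift with F ≤? m + j
    ... | yes p = trans (ge-true p) (sym (ge-true (subst (F + W ≤_) (e j W m) (+-monoˡ-≤ W p))))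
      where
      e : ∀ j W m → m + j + W ≡ j + (W + m)
      e = solve-∀
    ... | no ¬p = trans (ge-false (≰⇒> ¬p)) (sym (ge-false (subst (_< F + W) (e j W m) (+-monoˡ-< W (≰⇒> ¬p)))))
      where
      e : ∀ j W m → m + j + W ≡ j + (W + m)
      e = solve-∀
  rest-lower m m̄ eq (toggle j j<F ℓ≡) = ≤-reflexive (inside-above {m̄ * X} (FX≤ ℓ≡))
  rest-lower m m̄ eq (rest _ _ ℓ≡)     = ≤-reflexive (inside-above {m̄ * X} (≤-trans FX≤FXF (FXF≤ ℓ≡)))

  -- Charging every slot in full lowers the threshold from F + W to F. The subtraction `F ∸ m` is
  -- truncated because rest levels go beyond F.
  rest-upper : ∀ {ℓ k} m → View ℓ k → base (rest m) k + bulkSlot k m ≤ inside ((F ∸ m) * X) FX ℓ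
  rest-upper {ℓ} m (bulk j j<F lo hi ℓ<FX) with F ≤? j + m
  ... | yes p = subst (_ ≤_) (sym (inside-yes (≤-trans (*-monoˡ-≤ X (m≤n+o⇒m∸n≤o F m (subst (F ≤_) (+-comm j m) p))) lo) ℓ<FX)) one
    where
    one : 𝟙 (not (j + m <ᵇ F + W)) + 𝟙 (ge (j + m) F ∧ (j + m <ᵇ F + W)) ≤ 1
    one with j + m <ᵇ F + W | ge (j + m) F
    ... | true  | true  = ≤-refl
    ... | true  | false = z≤n
    ... | false | true  = ≤-refl
    ... | false | false = ≤-refl
  ... | no ¬p = ≤-trans (≤-reflexive (cong₂ _+_ (cong 𝟙 (ge-false (<-≤-trans (≰⇒> ¬p) (m≤m+n F W))))
                  (cong (λ b → 𝟙 (b ∧ (j + m <ᵇ F + W))) (ge-false (≰⇒> ¬p))))) z≤n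
  rest-upper m (toggle _ _ _) = z≤n
  rest-upper m (rest _ _ _)   = z≤n

-- Updates of functions and averaging

module _ {n : ℕ} {A : Set} where

  _[_↦_] : (Fin n → A) → Fin n → A → Fin n → A
  (f [ u ↦ x ]) w with w Fin.≟ u
  ... | yes _ = x
  ... | no  _ = f w

  ↦-same : ∀ f u x → (f [ u ↦ x ]) u ≡ x
  ↦-same f u x with u Fin.≟ u
  ... | yes _ = refl
  ... | no ¬p = contradiction refl ¬p

  ↦-other : ∀ f u x w → w ≢ u → (f [ u ↦ x ]) w ≡ f w
  ↦-other f u x w w≢u with w Fin.≟ u
  ... | yes p = contradiction p w≢u
  ... | no _  = refl

∑<⇒∃< : ∀ n (f : Fin n → ℕ) m → ∑ n f < n * m → ∃ λ i → f i < m
∑<⇒∃< (suc n) f m lt with f zero <? m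
... | yes p = zero , p
... | no ¬p with ∑<⇒∃< n (f ∘ suc) m (+-cancelˡ-< m _ _ (≤-<-trans (+-monoˡ-≤ _ (≮⇒≥ ¬p)) lt))
...   | i , p = suc i , p

∑-indicator : ∀ n (s : Fin n → Bool) (f : Fin n → ℕ) → (∀ i → s i ≡ false → f i ≡ 0) → ∑ n (λ i → 𝟙 (s i) * f i) ≡ ∑ n f
∑-indicator n s f off = ∑-cong n pointwise
  where
  pointwise : ∀ i → 𝟙 (s i) * f i ≡ f i
  pointwise i with s i in eq
  ... | true  = *-identityˡ (f i)
  ... | false = sym (off i eq)

pred-< : ∀ α k {m} → m < α * pred k → pred k < k
pred-< α zero    {m} lt = contradiction (subst (m <_) (*-zeroʳ α) lt) λ ()
pred-< α (suc k) lt = ≤-refl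

%-absorb : ∀ a b α {{_ : NonZero α}} → (a + α * b) % α ≡ a % α
%-absorb a b α = trans (cong (λ x → (a + x) % α) (*-comm α b)) ([m+kn]%n≡m%n a b α)

-- Completing the rest vertices

module Process {n : ℕ} (G : Graph n) (isA isR : Fin n → Bool) (α H lk θ : ℕ)
  {{α≢0 : NonZero α}} {{H≢0 : NonZero H}} (ext : Fin n → ℕ) (par : Fin n → Fin n) (cmp : Fin n → Fin n → Bool) where

  aDeg rDeg : Fin n → ℕ
  aDeg u = ∑ n (λ a → 𝟙 (adj G u a ∧ isA a))
  rDeg a = ∑ n (λ u → 𝟙 (adj G a u ∧ isR u))

  coarse : (Fin n → Fin n → ℕ) → Fin n → ℕ
  coarse c u = ∑ n (λ a → 𝟙 (adj G u a ∧ isA a) * c a u)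

  -- The fine weight `e u` lies on the edge from `u` to its partner. The edge of a matched pair is
  -- linked from both ends, which is why `fine` adds two terms.
  link : Fin n → Fin n → Bool
  link u v with par u Fin.≟ v
  ... | yes _ = isR u ∧ isR v
  ... | no  _ = false

  link-off : ∀ u v → par u ≢ v → link u v ≡ false
  link-off u v ¬p with par u Fin.≟ v
  ... | yes p = contradiction p ¬p
  ... | no _  = refl

  link-on : ∀ u → isR u ≡ true → isR (par u) ≡ true → link u (par u) ≡ true
  link-on u ru rp with par u Fin.≟ par u
  ... | yes _ = cong₂ _∧_ ru rp
  ... | no ¬p = contradiction refl ¬p

  fine : (Fin n → ℕ) → Fin n → Fin n → ℕ
  fine e u v = 𝟙 (link u v) * e u + 𝟙 (link v u) * e v

  fineSum : (Fin n → ℕ) → Fin n → ℕ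
  fineSum e u = ∑ n (λ v → 𝟙 (adj G u v) * fine e u v)

  start : (Fin n → ℕ) → Fin n → ℕ
  start e u = ext u + fineSum e u

  value : (Fin n → Fin n → ℕ) → (Fin n → ℕ) → Fin n → ℕ
  value c e u = start e u + α * coarse c u

  index : ℕ → ℕ
  index x = (x / α) % H

  -- In units of α, `c a u` is the coarse weight of the edge between a toggle vertex `a` and a rest
  -- vertex `u`. By `bal` the sum at `a` exceeds that of the all-ones start by `s a` alone, so a
  -- toggle vertex never moves by more than α in total, however many rest neighbours have been
  -- treated.
  record State : Set where
    field
      c   : Fin n → Fin n → ℕ
      e   : Fin n → ℕ
      s   : Fin n → ℕ
      c≤2 : ∀ a u → c a u ≤ 2
      e<α : ∀ u → e u < α
      s≤1 : ∀ a → s a ≤ 1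
      bal : ∀ a → isA a ≡ true → ∑ n (λ u → 𝟙 (adj G a u ∧ isR u) * c a u) ≡ rDeg a + s a

    val : Fin n → ℕ
    val = value c e

  open State

  initial : State
  initial = record
    { c = λ _ _ → 1 ; e = λ _ → 0 ; s = λ _ → 0
    ; c≤2 = λ _ _ → s≤s z≤n ; e<α = λ _ → >-nonZero⁻¹ α ; s≤1 = λ _ → z≤n
    ; bal = λ a _ → trans (∑-cong n (λ u → *-identityʳ _)) (sym (+-identityʳ _)) }

  -- The edge from a to u changes by [a ∈ Z] - s a, where Z is the set of raised neighbours, and the new
  -- state of a is [a ∈ Z]: so the sums at toggle vertices telescope and stay within one step.
  module _ (st : State) (u : Fin n) (ru : isR u ≡ true) (fresh : ∀ a → c st a u ≡ 1) (i : ℕ) (i≤ : i ≤ aDeg u) where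
    private
      m : Fin n → Bool
      m a = adj G u a ∧ isA a
      Z∃ = fill n m 1 i (subst (i ≤_) (sym (*-identityˡ (aDeg u))) i≤)
      Z = proj₁ Z∃
      Z≤1 = proj₁ (proj₂ Z∃)
      Z-off = proj₁ (proj₂ (proj₂ Z∃))
      Z-sum = proj₂ (proj₂ (proj₂ Z∃))

      new : Fin n → ℕ
      new a = if m a then (1 ∸ s st a) + Z a else 1

      new≤2 : ∀ a → new a ≤ 2
      new≤2 a with m a
      ... | true  = +-mono-≤ (m∸n≤m 1 (s st a)) (Z≤1 a)
      ... | false = s≤s z≤n

      c′ : Fin n → Fin n → ℕ
      c′ a = c st a [ u ↦ new a ]

      s′ : Fin n → ℕ
      s′ a = if m a then Z a else s st a

      c′≤2 : ∀ a w → c′ a w ≤ 2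
      c′≤2 a w with w Fin.≟ u
      ... | yes _ = new≤2 a
      ... | no _  = c≤2 st a w

      s′≤1 : ∀ a → s′ a ≤ 1
      s′≤1 a with m a
      ... | true  = Z≤1 a
      ... | false = s≤1 st a

      f f′ : Fin n → Fin n → ℕ
      f  a w = 𝟙 (adj G a w ∧ isR w) * c st a w
      f′ a w = 𝟙 (adj G a w ∧ isR w) * c′ a w

      f′-off : ∀ a w → w ≢ u → f′ a w ≡ f a w
      f′-off a w w≢u = cong (𝟙 (adj G a w ∧ isR w) *_) (↦-other (c st a) u (new a) w w≢u)

      bal′ : ∀ a → isA a ≡ true → ∑ n (f′ a) ≡ rDeg a + s′ a
      bal′ a aa = cases (adj G u a) refl
        where
        open ≡-Reasoning
        same : adj G u a ≡ false → ∀ w → f′ a w ≡ f a w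
        same ua w with w Fin.≟ u
        ... | no _     = refl
        ... | yes refl = cong (𝟙 (adj G a u ∧ isR u) *_)
                (trans (cong (λ b → if b ∧ isA a then (1 ∸ s st a) + Z a else 1) ua) (sym (fresh a)))
        module _ (ua : adj G u a ≡ true) where
          au : (adj G a u ∧ isR u) ≡ true
          au = cong₂ _∧_ (trans (adj-sym G a u) ua) ru
          fu : f a u ≡ 1
          fu = cong₂ (λ b x → 𝟙 b * x) au (fresh a)
          f′u : f′ a u ≡ (1 ∸ s st a) + Z a
          f′u = trans (cong₂ (λ b x → 𝟙 b * x) au (trans (↦-same (c st a) u (new a))
                  (cong (λ b → if b then (1 ∸ s st a) + Z a else 1) (cong₂ _∧_ ua aa)))) (*-identityˡ _)
        e₁ : ∀ r s t z → r + s + (t + z) ≡ r + z + (s + t)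
        e₁ = solve-∀
        cases : ∀ b → adj G u a ≡ b → ∑ n (f′ a) ≡ rDeg a + s′ a
        cases false ua = trans (∑-cong n (same ua)) (trans (bal st a aa)
          (cong (λ b → rDeg a + (if b ∧ isA a then Z a else s st a)) (sym ua)))
        cases true  ua = +-cancelʳ-≡ 1 _ _ (begin
          ∑ n (f′ a) + 1            ≡⟨ cong (∑ n (f′ a) +_) (sym (fu ua)) ⟩
          ∑ n (f′ a) + f a u        ≡⟨ ∑-update n (f′ a) (f a) u (f′-off a) ⟩
          ∑ n (f a) + f′ a u        ≡⟨ cong₂ _+_ (bal st a aa) (f′u ua) ⟩
          rDeg a + s st a + ((1 ∸ s st a) + Z a) ≡⟨ e₁ (rDeg a) (s st a) (1 ∸ s st a) (Z a) ⟩
          rDeg a + Z a + (s st a + (1 ∸ s st a)) ≡⟨ cong (rDeg a + Z a +_) (m+[n∸m]≡n (s≤1 st a)) ⟩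
          rDeg a + Z a + 1          ≡⟨ cong (λ b → rDeg a + (if b then Z a else s st a) + 1) (sym (cong₂ _∧_ ua aa)) ⟩
          rDeg a + s′ a + 1         ∎)

    toggled : State
    toggled = record { c = c′ ; e = e st ; s = s′ ; c≤2 = c′≤2 ; e<α = e<α st ; s≤1 = s′≤1 ; bal = bal′ }

    -- The coarse sum when no neighbour is raised. With i raised it is `low + i`, so every value
    -- from `low` to `low + aDeg u` is available.
    low : ℕ
    low = ∑ n (λ a → 𝟙 (m a) * (1 ∸ s st a))

    toggled-coarse : coarse (c toggled) u ≡ low + i
    toggled-coarse = begin
      ∑ n (λ a → 𝟙 (m a) * c′ a u)                                ≡⟨ ∑-cong n pointwise ⟩
      ∑ n (λ a → 𝟙 (m a) * (1 ∸ s st a) + 𝟙 (m a) * Z a)          ≡⟨ ∑-distrib-+ n _ _ ⟩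
      low + ∑ n (λ a → 𝟙 (m a) * Z a)                             ≡⟨ cong (low +_) (trans (∑-indicator n m Z Z-off) Z-sum) ⟩
      low + i                                                     ∎
      where
      open ≡-Reasoning
      pointwise : ∀ a → 𝟙 (m a) * c′ a u ≡ 𝟙 (m a) * (1 ∸ s st a) + 𝟙 (m a) * Z a
      pointwise a = trans (cong (𝟙 (m a) *_) (↦-same (c st a) u (new a))) split
        where
        split : 𝟙 (m a) * new a ≡ 𝟙 (m a) * (1 ∸ s st a) + 𝟙 (m a) * Z a
        split with m a
        ... | true  = *-distribˡ-+ 1 (1 ∸ s st a) (Z a)
        ... | false = refl

    toggled-other : ∀ a w → w ≢ u → c toggled a w ≡ c st a w
    toggled-other a w w≢u = ↦-other (c st a) u (new a) w w≢u

  module _ (e : Fin n → ℕ) (u : Fin n) (x : ℕ) where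
    private
      p = par u
      e′ = e [ u ↦ x ]
      e′-off : ∀ v → v ≢ u → e′ v ≡ e v
      e′-off v = ↦-other e u x v

    fineSum-other : ∀ w → w ≢ u → w ≢ p → fineSum e′ w ≡ fineSum e w
    fineSum-other w w≢u w≢p = ∑-cong n (λ v → cong (𝟙 (adj G w v) *_) (cong₂ _+_ (cong (𝟙 (link w v) *_) (e′-off w w≢u)) (second v)))
      where
      second : ∀ v → 𝟙 (link v w) * e′ v ≡ 𝟙 (link v w) * e v
      second v with v Fin.≟ u
      ... | no _     = refl
      ... | yes refl = trans (cong (λ b → 𝟙 b * x) (link-off u w (w≢p ∘ sym)))
                             (sym (cong (λ b → 𝟙 b * e u) (link-off u w (w≢p ∘ sym))))

    module _ (ru : isR u ≡ true) (rp : isR p ≡ true) (up : adj G u p ≡ true) (eu : e u ≡ 0) where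
      private
        p≢u : p ≢ u
        p≢u eq = contradiction (trans (sym up) (trans (cong (adj G u) eq) (adj-irr G u))) λ ()

      fineSum-self : fineSum e′ u ≡ fineSum e u + x
      fineSum-self = +-cancelʳ-≡ (f p) _ _ (begin
        ∑ n f′ + f p          ≡⟨ ∑-update n f′ f p off ⟩
        ∑ n f + f′ p          ≡⟨ cong (∑ n f +_) at ⟩
        ∑ n f + (x + f p)     ≡⟨ sym (+-assoc (∑ n f) x (f p)) ⟩
        ∑ n f + x + f p       ∎)
        where
        open ≡-Reasoning
        f f′ : Fin n → ℕ
        f  v = 𝟙 (adj G u v) * fine e u v
        f′ v = 𝟙 (adj G u v) * fine e′ u v
        off : ∀ v → v ≢ p → f′ v ≡ f v
        off v v≢p = cases (v Fin.≟ u)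
          where
          zeroˡ : ∀ (g : Fin n → ℕ) → 𝟙 (link u v) * g u ≡ 0
          zeroˡ g = cong (λ b → 𝟙 b * g u) (link-off u v (v≢p ∘ sym))
          cases : Dec (v ≡ u) → f′ v ≡ f v
          cases (no v≢u) = cong (𝟙 (adj G u v) *_) (cong₂ _+_ (trans (zeroˡ e′) (sym (zeroˡ e))) (cong (𝟙 (link v u) *_) (e′-off v v≢u)))
          cases (yes refl) = trans (cong (λ b → 𝟙 b * fine e′ u u) (adj-irr G u)) (sym (cong (λ b → 𝟙 b * fine e u u) (adj-irr G u)))
        at : f′ p ≡ x + f p
        at = begin
          𝟙 (adj G u p) * (𝟙 (link u p) * e′ u + 𝟙 (link p u) * e′ p)
            ≡⟨ cong₂ (λ b y → 𝟙 b * y) up (cong₂ _+_ (cong₂ (λ b y → 𝟙 b * y) (link-on u ru rp) (↦-same e u x)) (cong (𝟙 (link p u) *_) (e′-off p p≢u))) ⟩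
          1 * (1 * x + 𝟙 (link p u) * e p)
            ≡⟨ e₁ x (𝟙 (link p u) * e p) ⟩
          x + 1 * (1 * 0 + 𝟙 (link p u) * e p)
            ≡⟨ cong (x +_) (sym (cong₂ (λ b y → 𝟙 b * y) up (cong (_+ 𝟙 (link p u) * e p) (cong₂ (λ b y → 𝟙 b * y) (link-on u ru rp) eu)))) ⟩
          x + 𝟙 (adj G u p) * (𝟙 (link u p) * e u + 𝟙 (link p u) * e p) ∎
          where
          e₁ : ∀ x y → 1 * (1 * x + y) ≡ x + 1 * (1 * 0 + y)
          e₁ = solve-∀

      fineSum-partner : fineSum e′ p ≡ fineSum e p + x
      fineSum-partner = +-cancelʳ-≡ (f u) _ _ (begin
        ∑ n f′ + f u          ≡⟨ ∑-update n f′ f u off ⟩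
        ∑ n f + f′ u          ≡⟨ cong (∑ n f +_) at ⟩
        ∑ n f + (x + f u)     ≡⟨ sym (+-assoc (∑ n f) x (f u)) ⟩
        ∑ n f + x + f u       ∎)
        where
        open ≡-Reasoning
        f f′ : Fin n → ℕ
        f  v = 𝟙 (adj G p v) * fine e p v
        f′ v = 𝟙 (adj G p v) * fine e′ p v
        off : ∀ v → v ≢ u → f′ v ≡ f v
        off v v≢u = cong (𝟙 (adj G p v) *_) (cong₂ _+_ (cong (𝟙 (link p v) *_) (e′-off p p≢u)) (cong (𝟙 (link v p) *_) (e′-off v v≢u)))
        pu : adj G p u ≡ true
        pu = trans (adj-sym G p u) up
        at : f′ u ≡ x + f u
        at = begin
          𝟙 (adj G p u) * (𝟙 (link p u) * e′ p + 𝟙 (link u p) * e′ u)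
            ≡⟨ cong₂ (λ b y → 𝟙 b * y) pu (cong₂ _+_ (cong (𝟙 (link p u) *_) (e′-off p p≢u)) (cong₂ (λ b y → 𝟙 b * y) (link-on u ru rp) (↦-same e u x))) ⟩
          1 * (𝟙 (link p u) * e p + 1 * x)
            ≡⟨ e₁ x (𝟙 (link p u) * e p) ⟩
          x + 1 * (𝟙 (link p u) * e p + 1 * 0)
            ≡⟨ cong (x +_) (sym (cong₂ (λ b y → 𝟙 b * y) pu (cong (𝟙 (link p u) * e p +_) (cong₂ (λ b y → 𝟙 b * y) (link-on u ru rp) eu)))) ⟩
          x + 𝟙 (adj G p u) * (𝟙 (link p u) * e p + 𝟙 (link u p) * e u) ∎
          where
          e₁ : ∀ x y → 1 * (y + 1 * x) ≡ x + 1 * (y + 1 * 0)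
          e₁ = solve-∀

  setFine : (st : State) (u : Fin n) (x : ℕ) → x < α → State
  setFine st u x x<α = record { c = c st ; e = e st [ u ↦ x ] ; s = s st ; c≤2 = c≤2 st ; e<α = bound ; s≤1 = s≤1 st ; bal = bal st }
    where
    bound : ∀ w → (e st [ u ↦ x ]) w < α
    bound w with w Fin.≟ u
    ... | yes _ = x<α
    ... | no _  = e<α st w

  -- Coarse steps change the value of `u` by multiples of α, so only finished competitors in the
  -- residue class of `z` modulo α can collide with it.
  taken : (Fin n → Bool) → (Fin n → ℕ) → Fin n → ℕ → ℕ
  taken D vl u z = ∑ n (λ w → 𝟙 (D w ∧ cmp u w) * 𝟙 (vl w % α ≡ᵇ z % α))

  residue-injective : ∀ z (i j : Fin α) → (z + toℕ i) % α ≡ (z + toℕ j) % α → i ≡ j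
  residue-injective z i j eq = toℕ-injective (sym (proj₂ (divMod-unique α qᵢ (toℕ j) qⱼ (toℕ i) (toℕ<n j) (toℕ<n i)
      (+-cancelˡ-≡ z _ _ (begin
        z + (α * qᵢ + toℕ j)         ≡⟨ e₁ z (α * qᵢ) (toℕ j) ⟩
        z + toℕ j + α * qᵢ           ≡⟨ cong (_+ α * qᵢ) (decomp (z + toℕ j)) ⟩
        (z + toℕ j) % α + α * qⱼ + α * qᵢ ≡⟨ cong (λ r → r + α * qⱼ + α * qᵢ) (sym eq) ⟩
        (z + toℕ i) % α + α * qⱼ + α * qᵢ ≡⟨ e₂ ((z + toℕ i) % α) (α * qⱼ) (α * qᵢ) ⟩
        (z + toℕ i) % α + α * qᵢ + α * qⱼ ≡⟨ cong (_+ α * qⱼ) (sym (decomp (z + toℕ i))) ⟩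
        z + toℕ i + α * qⱼ           ≡⟨ sym (e₁ z (α * qⱼ) (toℕ i)) ⟩
        z + (α * qⱼ + toℕ i)         ∎)))))
    where
    open ≡-Reasoning
    qᵢ = (z + toℕ i) / α
    qⱼ = (z + toℕ j) / α
    decomp : ∀ m → m ≡ m % α + α * (m / α)
    decomp m = trans (m≡m%n+[m/n]*n m α) (cong (m % α +_) (*-comm (m / α) α))
    e₁ : ∀ z a j → z + (a + j) ≡ z + j + a
    e₁ = solve-∀
    e₂ : ∀ r a b → r + a + b ≡ r + b + a
    e₂ = solve-∀

  -- α consecutive starting values lie in distinct residue classes, so a competitor is counted at
  -- most once. Averaging over the fine weight then finds a sparse class.
  ∑-taken : ∀ D vl u z → ∑ α (λ i → taken D vl u (z + toℕ i)) ≤ ∑ n (λ w → 𝟙 (D w ∧ cmp u w))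
  ∑-taken D vl u z = begin
    ∑ α (λ i → ∑ n (λ w → 𝟙 (D w ∧ cmp u w) * hit w i))   ≡⟨ ∑-swap α n _ ⟩
    ∑ n (λ w → ∑ α (λ i → 𝟙 (D w ∧ cmp u w) * hit w i))
      ≤⟨ ∑-mono n (λ w → ≤-trans (≤-reflexive (∑-*ˡ α (𝟙 (D w ∧ cmp u w)) (hit w)))
           (≤-trans (*-monoʳ-≤ (𝟙 (D w ∧ cmp u w)) (once w)) (≤-reflexive (*-identityʳ _)))) ⟩
    ∑ n (λ w → 𝟙 (D w ∧ cmp u w)) ∎
    where
    open ≤-Reasoning
    hit : Fin n → Fin α → ℕ
    hit w i = 𝟙 (vl w % α ≡ᵇ (z + toℕ i) % α)
    hit-true : ∀ w i → 1 ≤ hit w i → vl w % α ≡ (z + toℕ i) % α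
    hit-true w i h = ≡ᵇ-true (vl w % α) _ (𝟙-true h)
    once : ∀ w → ∑ α (hit w) ≤ 1
    once w = ∑-atMostOne α (hit w) (λ i → 𝟙≤1 (vl w % α ≡ᵇ (z + toℕ i) % α))
      (λ i j hi hj → residue-injective z i j (trans (sym (hit-true w i hi)) (hit-true w j hj)))

  -- The lk candidates with digit 0 are H coarse steps apart and all lie in one residue class; as
  -- fewer than lk values of this class are in use, one candidate is free.
  pick : ∀ D vl u z → taken D vl u z < lk →
         ∃ λ i → i ≤ H * lk × index (z + α * i) ≡ 0 × (∀ w → D w ≡ true → cmp u w ≡ true → vl w ≢ z + α * i)
  pick D vl u z few with ∑<⇒∃≡0 lk (λ j → ∑ n (λ w → 𝟙 (D w ∧ cmp u w) * 𝟙 (vl w ≡ᵇ cand j))) (≤-<-trans bound few)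
    where
    -- Steps up to the next number of digit 0. As this is at most H, all candidates lie within H lk
    -- steps.
    i₀ = H ∸ (z / α) % H
    cand : Fin lk → ℕ
    cand j = z + α * (i₀ + H * toℕ j)
    cand-injective : ∀ i j → cand i ≡ cand j → i ≡ j
    cand-injective i j eq = toℕ-injective (*-cancelˡ-≡ (toℕ i) (toℕ j) H
      (+-cancelˡ-≡ i₀ _ _ (*-cancelˡ-≡ (i₀ + H * toℕ i) (i₀ + H * toℕ j) α (+-cancelˡ-≡ z _ _ eq))))
    once : ∀ w → ∑ lk (λ j → 𝟙 (vl w ≡ᵇ cand j)) ≤ 𝟙 (vl w % α ≡ᵇ z % α)
    once w with vl w % α ≡ᵇ z % α in eq
    ... | true  = ∑-atMostOne lk _ (λ j → 𝟙≤1 (vl w ≡ᵇ cand j))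
                    (λ i j hi hj → cand-injective i j (trans (sym (≡ᵇ-true (vl w) _ (𝟙-true hi))) (≡ᵇ-true (vl w) _ (𝟙-true hj))))
    ... | false = ≤-reflexive (≡0⇒∑≡0 lk none)
      where
      none : ∀ j → 𝟙 (vl w ≡ᵇ cand j) ≡ 0
      none j with vl w ≡ᵇ cand j in h
      ... | false = refl
      ... | true  = contradiction (trans (sym eq) (trans (cong (_≡ᵇ z % α) (trans (cong (_% α) (≡ᵇ-true (vl w) _ h)) (%-absorb z (i₀ + H * toℕ j) α))) (≡ᵇ-refl (z % α)))) λ ()
    bound : ∑ lk (λ j → ∑ n (λ w → 𝟙 (D w ∧ cmp u w) * 𝟙 (vl w ≡ᵇ cand j))) ≤ taken D vl u z
    bound = ≤-trans (≤-reflexive (∑-swap lk n _)) (∑-mono n (λ w →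
      ≤-trans (≤-reflexive (∑-*ˡ lk (𝟙 (D w ∧ cmp u w)) _)) (*-monoʳ-≤ (𝟙 (D w ∧ cmp u w)) (once w))))
  ... | j , none = i₀ + H * toℕ j , i≤ , index≡0 , free
    where
    i₀ = H ∸ (z / α) % H
    i = i₀ + H * toℕ j
    i≤ : i ≤ H * lk
    i≤ = begin
      i₀ + H * toℕ j       ≤⟨ +-monoˡ-≤ (H * toℕ j) (m∸n≤m H ((z / α) % H)) ⟩
      H + H * toℕ j        ≡⟨ sym (*-suc H (toℕ j)) ⟩
      H * suc (toℕ j)      ≤⟨ *-monoʳ-≤ H (toℕ<n j) ⟩
      H * lk               ∎
      where open ≤-Reasoning
    index≡0 : index (z + α * i) ≡ 0
    index≡0 = begin
      (z + α * i) / α % H                     ≡⟨ cong (_% H) (+-distrib-/-∣ʳ z (m∣m*n i)) ⟩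
      (z / α + α * i / α) % H                 ≡⟨ cong (λ x → (z / α + x) % H) (trans (cong (_/ α) (*-comm α i)) (m*n/n≡m i α)) ⟩
      (z / α + i) % H                         ≡⟨ cong (λ x → (x + i) % H) (m≡m%n+[m/n]*n (z / α) H) ⟩
      (r + q * H + (i₀ + H * toℕ j)) % H      ≡⟨ cong (_% H) (e₁ r q H i₀ (toℕ j)) ⟩
      (r + i₀ + (q + toℕ j) * H) % H          ≡⟨ cong (λ x → (x + (q + toℕ j) * H) % H) (m+[n∸m]≡n (<⇒≤ (m%n<n (z / α) H))) ⟩
      (H + (q + toℕ j) * H) % H               ≡⟨ m*n%n≡0 (suc (q + toℕ j)) H ⟩
      0                                       ∎
      where
      open ≡-Reasoning
      r = (z / α) % H
      q = (z / α) / H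
      e₁ : ∀ r q H i j → r + q * H + (i + H * j) ≡ r + i + (q + j) * H
      e₁ = solve-∀
    free : ∀ w → D w ≡ true → cmp u w ≡ true → vl w ≢ z + α * i
    free w dw cw eq = contradiction (trans (sym (cong₂ (λ b b′ → 𝟙 b * 𝟙 b′) (cong₂ _∧_ dw cw)
      (trans (cong (_≡ᵇ z + α * i) eq) (≡ᵇ-refl (z + α * i))))) (∑≡0⇒≡0 n _ none w)) λ ()

  module Run
    (deg-ok : ∀ u → isR u ≡ true → H * lk ≤ aDeg u)
    (window : ∀ st u w → isR u ≡ true → isR w ≡ true → val st u ≡ val st w → cmp u w ≡ true)
    (few : ∀ u → isR u ≡ true → ∑ n (λ w → 𝟙 (isR w ∧ cmp u w)) ≤ θ)
    where

    -- `D` is the set of finished vertices. Nothing is claimed about the values of the others except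
    -- that their coarse weights are still 1, which `toggled` needs.
    record Inv (st : State) (D : Fin n → Bool) : Set where
      field
        inR   : ∀ u → D u ≡ true → isR u ≡ true
        fresh : ∀ u → isR u ≡ true → D u ≡ false → ∀ a → c st a u ≡ 1
        hole  : ∀ u → D u ≡ true → index (val st u) ≡ 0
        dist  : ∀ u w → D u ≡ true → D w ≡ true → val st u ≡ val st w → u ≡ w
    open Inv

    insert : (Fin n → Bool) → Fin n → Fin n → Bool
    insert D u = D [ u ↦ true ]

    insert-cases : ∀ D u w → insert D u w ≡ true → w ≡ u ⊎ (w ≢ u × D w ≡ true)
    insert-cases D u w eq with w Fin.≟ u
    ... | yes p = inj₁ p
    ... | no ¬p = inj₂ (¬p , eq)

    insert-false : ∀ D u w → insert D u w ≡ false → w ≢ u × D w ≡ false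
    insert-false D u w eq with w Fin.≟ u
    ... | no ¬p = ¬p , eq

    insert-grow : ∀ D u w → D w ≡ true → insert D u w ≡ true
    insert-grow D u w eq with w Fin.≟ u
    ... | yes _ = refl
    ... | no _  = eq

    extend : ∀ st st′ D u → Inv st D → isR u ≡ true → index (val st′ u) ≡ 0 →
             (∀ w → w ≢ u → val st′ w ≡ val st w) → (∀ a w → w ≢ u → c st′ a w ≡ c st a w) →
             (∀ w → w ≢ u → D w ≡ true → val st′ u ≢ val st′ w) → Inv st′ (insert D u)
    extend st st′ D u inv ru hole-u val-other c-other clash =
      record { inR = inR′ ; fresh = fresh′ ; hole = hole′ ; dist = dist′ }
      where
      inR′ : ∀ w → insert D u w ≡ true → isR w ≡ true
      inR′ w h with insert-cases D u w h
      ... | inj₁ refl     = ru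
      ... | inj₂ (_ , dw) = inR inv w dw
      fresh′ : ∀ w → isR w ≡ true → insert D u w ≡ false → ∀ a → c st′ a w ≡ 1
      fresh′ w rw h a with insert-false D u w h
      ... | w≢u , ¬dw = trans (c-other a w w≢u) (fresh inv w rw ¬dw a)
      hole′ : ∀ w → insert D u w ≡ true → index (val st′ w) ≡ 0
      hole′ w h with insert-cases D u w h
      ... | inj₁ refl       = hole-u
      ... | inj₂ (w≢u , dw) = trans (cong index (val-other w w≢u)) (hole inv w dw)
      dist′ : ∀ w w′ → insert D u w ≡ true → insert D u w′ ≡ true → val st′ w ≡ val st′ w′ → w ≡ w′
      dist′ w w′ h h′ eq with insert-cases D u w h | insert-cases D u w′ h′
      ... | inj₁ refl       | inj₁ refl         = refl
      ... | inj₁ refl       | inj₂ (w′≢u , dw′) = contradiction eq (clash w′ w′≢u dw′)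
      ... | inj₂ (w≢u , dw) | inj₁ refl         = contradiction (sym eq) (clash w w≢u dw)
      ... | inj₂ (w≢u , dw) | inj₂ (w′≢u , dw′) = dist inv w w′ dw dw′ (trans (sym (val-other w w≢u)) (trans eq (val-other w′ w′≢u)))

    clean-insert : ∀ D u (e e′ : Fin n → ℕ) → (∀ w → D w ≡ false → w ≢ u → e w ≡ 0) → (∀ w → e′ w ≡ e w) →
                   ∀ w → insert D u w ≡ false → e′ w ≡ 0
    clean-insert D u e e′ clean same w h = trans (same w) (clean w (proj₂ (insert-false D u w h)) (proj₁ (insert-false D u w h)))

    -- The coarse weights rewritten here are those on edges from toggle vertices to `u`, so no other
    -- rest vertex changes its value. Adding α times the low sum keeps the residue, hence the bound
    -- on `taken` at the start value is enough.
    settle : ∀ st D u → Inv st D → isR u ≡ true → D u ≡ false → taken D (val st) u (start (e st) u) < lk →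
             ∃ λ st′ → Inv st′ (insert D u) × (∀ w → e st′ w ≡ e st w) × (∀ w → w ≢ u → val st′ w ≡ val st w)
                       × (∀ w → start (e st′) w ≡ start (e st) w)
    settle st D u inv ru ¬Du lt = st′ , inv′ , (λ _ → refl) , val-other , (λ _ → refl)
      where
      fr = fresh inv u ru ¬Du
      low₀ = ∑ n (λ a → 𝟙 (adj G u a ∧ isA a) * (1 ∸ s st a))
      z = start (e st) u + α * low₀
      lt′ : taken D (val st) u z < lk
      lt′ = subst (_< lk) (∑-cong n (λ w → cong (λ x → 𝟙 (D w ∧ cmp u w) * 𝟙 (val st w % α ≡ᵇ x)) (sym (%-absorb (start (e st) u) low₀ α)))) lt
      P = pick D (val st) u z lt′
      i = proj₁ P
      i≤ : i ≤ aDeg u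
      i≤ = ≤-trans (proj₁ (proj₂ P)) (deg-ok u ru)
      st′ : State
      st′ = toggled st u ru fr i i≤
      val-other : ∀ w → w ≢ u → val st′ w ≡ val st w
      val-other w w≢u = cong (λ x → start (e st) w + α * x)
        (∑-cong n (λ a → cong (𝟙 (adj G w a ∧ isA a) *_) (toggled-other st u ru fr i i≤ a w w≢u)))
      val-u : val st′ u ≡ z + α * i
      val-u = trans (cong (λ x → start (e st) u + α * x) (toggled-coarse st u ru fr i i≤)) (e₁ (start (e st) u) α low₀ i)
        where
        e₁ : ∀ x α l i → x + α * (l + i) ≡ x + α * l + α * i
        e₁ = solve-∀
      clash : ∀ w → w ≢ u → D w ≡ true → val st′ u ≢ val st′ w
      clash w w≢u dw eq = proj₂ (proj₂ (proj₂ P)) w dw (window st′ u w ru (inR inv w dw) eq)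
        (trans (sym (val-other w w≢u)) (trans (sym eq) val-u))
      inv′ : Inv st′ (insert D u)
      inv′ = extend st st′ D u inv ru (trans (cong index val-u) (proj₁ (proj₂ (proj₂ P)))) val-other
               (toggled-other st u ru fr i i≤) clash

    module _ (st : State) (D : Fin n → Bool) (u : Fin n) (x : ℕ) (x<α : x < α)
      (inv : Inv st D) (¬Du : D u ≡ false) (¬Dp : D (par u) ≡ false) where

      private
        st′ = setFine st u x x<α

        D-other : ∀ w → D w ≡ true → w ≢ u × w ≢ par u
        D-other w dw = (λ { refl → contradiction (trans (sym dw) ¬Du) λ () }) , (λ { refl → contradiction (trans (sym dw) ¬Dp) λ () })

      setFine-val : ∀ w → D w ≡ true → val st′ w ≡ val st w
      setFine-val w dw = cong (λ y → ext w + y + α * coarse (c st) w)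
        (fineSum-other (e st) u x w (proj₁ (D-other w dw)) (proj₂ (D-other w dw)))

      -- A fine weight disturbs both ends of its edge, and both are still unfinished.
      setFine-inv : Inv st′ D
      setFine-inv = record
        { inR   = inR inv
        ; fresh = fresh inv
        ; hole  = λ w dw → trans (cong index (setFine-val w dw)) (hole inv w dw)
        ; dist  = λ w w′ dw dw′ eq → dist inv w w′ dw dw′ (trans (sym (setFine-val w dw)) (trans eq (setFine-val w′ dw′))) }

    taken-cong : ∀ D vl vl′ u z → (∀ w → D w ≡ true → vl′ w ≡ vl w) → taken D vl′ u z ≡ taken D vl u z
    taken-cong D vl vl′ u z same = ∑-cong n pointwise
      where
      pointwise : ∀ w → 𝟙 (D w ∧ cmp u w) * 𝟙 (vl′ w % α ≡ᵇ z % α) ≡ 𝟙 (D w ∧ cmp u w) * 𝟙 (vl w % α ≡ᵇ z % α)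
      pointwise w with D w in dw
      ... | false = refl
      ... | true  = cong (λ y → 𝟙 (cmp u w) * 𝟙 (y % α ≡ᵇ z % α)) (same w dw)

    taken-insert : ∀ D vl u v z → taken (insert D v) vl u z ≤ taken D vl u z + 1
    taken-insert D vl u v z = begin
      taken (insert D v) vl u z              ≤⟨ ∑-mono n pointwise ⟩
      ∑ n (λ w → 𝟙 (D w ∧ cmp u w) * 𝟙 (vl w % α ≡ᵇ z % α) + ((λ _ → 0) [ v ↦ 1 ]) w)  ≡⟨ ∑-distrib-+ n _ _ ⟩
      taken D vl u z + ∑ n ((λ _ → 0) [ v ↦ 1 ])
        ≡⟨ cong (taken D vl u z +_) (trans (∑-single n _ v (λ w w≢v → ↦-other (λ _ → 0) v 1 w w≢v)) (↦-same (λ _ → 0) v 1)) ⟩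
      taken D vl u z + 1                     ∎
      where
      open ≤-Reasoning
      pointwise : ∀ w → 𝟙 (insert D v w ∧ cmp u w) * 𝟙 (vl w % α ≡ᵇ z % α)
                ≤ 𝟙 (D w ∧ cmp u w) * 𝟙 (vl w % α ≡ᵇ z % α) + ((λ _ → 0) [ v ↦ 1 ]) w
      pointwise w with w Fin.≟ v
      ... | yes _ = ≤-trans (*-mono-≤ (𝟙≤1 (true ∧ cmp u w)) (𝟙≤1 (vl w % α ≡ᵇ z % α))) (m≤n+m 1 _)
      ... | no _  = m≤m+n _ 0

    few′ : ∀ st D u → Inv st D → isR u ≡ true → ∑ n (λ w → 𝟙 (D w ∧ cmp u w)) ≤ θ
    few′ st D u inv ru = ≤-trans (∑-mono n pointwise) (few u ru)
      where
      pointwise : ∀ w → 𝟙 (D w ∧ cmp u w) ≤ 𝟙 (isR w ∧ cmp u w)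
      pointwise w with D w in dw
      ... | false = z≤n
      ... | true  = ≤-reflexive (cong (λ b → 𝟙 (b ∧ cmp u w)) (sym (inR inv w dw)))

    record Progress (D : Fin n → Bool) : Set where
      field
        state : State
        inv   : Inv state D
        clean : ∀ u → D u ≡ false → e state u ≡ 0
    open Progress

    module _ (2θ< : 2 * θ < α * pred lk) where

      private
        pred<lk : pred lk < lk
        pred<lk = pred-< α lk 2θ<

        θ< : θ < α * pred lk
        θ< = ≤-<-trans (m≤m+n θ _) 2θ<

      settleSingle : ∀ D u → Progress D → isR u ≡ true → isR (par u) ≡ true → adj G u (par u) ≡ true →
               D u ≡ false → D (par u) ≡ false → Progress (insert D u)
      settleSingle D u pr ru rp up ¬Du ¬Dp = record
        { state = proj₁ S ; inv = proj₁ (proj₂ S) ; clean = clean′ }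
        where
        st = state pr
        E∃ = ∑<⇒∃< α (λ i → taken D (val st) u (start (e st) u + toℕ i)) (pred lk)
               (≤-<-trans (≤-trans (∑-taken D (val st) u (start (e st) u)) (few′ st D u (inv pr) ru)) θ<)
        x = toℕ (proj₁ E∃)
        x<α = toℕ<n (proj₁ E∃)
        st₁ = setFine st u x x<α
        inv₁ = setFine-inv st D u x x<α (inv pr) ¬Du ¬Dp
        start₁ : start (e st₁) u ≡ start (e st) u + x
        start₁ = trans (cong (ext u +_) (fineSum-self (e st) u x ru rp up (clean pr u ¬Du))) (sym (+-assoc (ext u) _ x))
        lt : taken D (val st₁) u (start (e st₁) u) < lk
        lt = subst (_< lk) (sym (trans (taken-cong D (val st) (val st₁) u _ (setFine-val st D u x x<α (inv pr) ¬Du ¬Dp))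
               (cong (taken D (val st) u) start₁))) (<-trans (proj₂ E∃) pred<lk)
        S = settle st₁ D u inv₁ ru ¬Du lt
        clean′ : ∀ w → insert D u w ≡ false → e (proj₁ S) w ≡ 0
        clean′ = clean-insert D u (e st₁) (e (proj₁ S))
          (λ w ¬dw w≢u → trans (↦-other (e st) u x w w≢u) (clean pr w ¬dw)) (proj₁ (proj₂ (proj₂ S)))

      -- The fine weight on the edge between u and its partner shifts both residues modulo α at once; on
      -- average over that weight the two residue classes contain few values already in use.
      settlePair : ∀ D u → Progress D → isR u ≡ true → isR (par u) ≡ true → adj G u (par u) ≡ true →
               D u ≡ false → D (par u) ≡ false → Progress (insert (insert D u) (par u))
      settlePair D u pr ru rp up ¬Du ¬Dp = record
        { state = proj₁ S₂ ; inv = proj₁ (proj₂ S₂) ; clean = clean′ }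
        where
        st = state pr
        p = par u
        p≢u : p ≢ u
        p≢u eq = contradiction (trans (sym up) (trans (cong (adj G u) eq) (adj-irr G u))) λ ()
        sum≤ : ∑ α (λ i → taken D (val st) u (start (e st) u + toℕ i) + taken D (val st) p (start (e st) p + toℕ i)) ≤ 2 * θ
        sum≤ = ≤-trans (≤-reflexive (∑-distrib-+ α _ _)) (≤-trans (+-mono-≤
          (≤-trans (∑-taken D (val st) u (start (e st) u)) (few′ st D u (inv pr) ru))
          (≤-trans (∑-taken D (val st) p (start (e st) p)) (few′ st D p (inv pr) rp)))
          (≤-reflexive (cong (θ +_) (sym (+-identityʳ θ)))))
        -- Staying below `pred lk` keeps one candidate in reserve: once settled, `u` is itself a
        -- possible competitor of `p`.
        E∃ = ∑<⇒∃< α (λ i → taken D (val st) u (start (e st) u + toℕ i) + taken D (val st) p (start (e st) p + toℕ i)) (pred lk)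
               (≤-<-trans sum≤ 2θ<)
        x = toℕ (proj₁ E∃)
        x<α = toℕ<n (proj₁ E∃)
        st₁ = setFine st u x x<α
        inv₁ = setFine-inv st D u x x<α (inv pr) ¬Du ¬Dp
        same₁ = setFine-val st D u x x<α (inv pr) ¬Du ¬Dp
        start₁ : start (e st₁) u ≡ start (e st) u + x
        start₁ = trans (cong (ext u +_) (fineSum-self (e st) u x ru rp up (clean pr u ¬Du))) (sym (+-assoc (ext u) _ x))
        start₁p : start (e st₁) p ≡ start (e st) p + x
        start₁p = trans (cong (ext p +_) (fineSum-partner (e st) u x ru rp up (clean pr u ¬Du))) (sym (+-assoc (ext p) _ x))
        lt : taken D (val st₁) u (start (e st₁) u) < lk
        lt = subst (_< lk) (sym (trans (taken-cong D (val st) (val st₁) u _ same₁) (cong (taken D (val st) u) start₁)))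
               (<-trans (≤-<-trans (m≤m+n _ _) (proj₂ E∃)) pred<lk)
        S₁ = settle st₁ D u inv₁ ru ¬Du lt
        st₂ = proj₁ S₁
        ¬Dp₁ : insert D u p ≡ false
        ¬Dp₁ = trans (↦-other D u true p p≢u) ¬Dp
        same₂ : ∀ w → D w ≡ true → val st₂ w ≡ val st w
        same₂ w dw = trans (proj₁ (proj₂ (proj₂ (proj₂ S₁))) w (λ { refl → contradiction (trans (sym dw) ¬Du) λ () })) (same₁ w dw)
        lt₂ : taken (insert D u) (val st₂) p (start (e st₂) p) < lk
        lt₂ = ≤-<-trans (taken-insert D (val st₂) p u (start (e st₂) p)) (≤-<-trans (≤-reflexive (+-comm _ 1))
          (≤-<-trans (subst (λ y → suc y ≤ pred lk) (sym (trans (taken-cong D (val st) (val st₂) p _ same₂)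
            (cong (taken D (val st) p) (trans (proj₂ (proj₂ (proj₂ (proj₂ S₁))) p) start₁p))))
            (≤-<-trans (m≤n+m _ _) (proj₂ E∃))) pred<lk))
        S₂ = settle st₂ (insert D u) p (proj₁ (proj₂ S₁)) rp ¬Dp₁ lt₂
        clean₁ : ∀ w → insert D u w ≡ false → e st₂ w ≡ 0
        clean₁ = clean-insert D u (e st₁) (e st₂)
          (λ w ¬dw w≢u → trans (↦-other (e st) u x w w≢u) (clean pr w ¬dw)) (proj₁ (proj₂ (proj₂ S₁)))
        clean′ : ∀ w → insert (insert D u) p w ≡ false → e (proj₁ S₂) w ≡ 0
        clean′ = clean-insert (insert D u) p (e st₂) (e (proj₁ S₂)) (λ w ¬dw _ → clean₁ w ¬dw) (proj₁ (proj₂ (proj₂ S₂)))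

      module _ (mt : Fin n → Bool)
        (par-ok : ∀ u → isR u ≡ true → isR (par u) ≡ true × adj G u (par u) ≡ true × mt (par u) ≡ true)
        (par-par : ∀ u → mt u ≡ true → par (par u) ≡ u) where

        -- The partner of an unmatched vertex is matched, hence unfinished throughout this phase,
        -- and may absorb the fine weights of several unmatched vertices.
        phase₁ : (us : List (Fin n)) → ∃ λ D → Progress D × (∀ w → D w ≡ true → mt w ≡ false)
                 × (∀ u → u ∈ us → isR u ≡ true → mt u ≡ false → D u ≡ true)
        phase₁ [] = (λ _ → false) ,
          record { state = initial
                 ; inv = record { inR = λ _ () ; fresh = λ _ _ _ _ → refl ; hole = λ _ () ; dist = λ _ _ () }
                 ; clean = λ _ _ → refl } , (λ _ ()) , (λ _ ())
        phase₁ (u ∷ us) with phase₁ us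
        ... | D , pr , D⊂ , done with isR u in ru | mt u in mu | D u in du
        ...   | false | _     | _     = D , pr , D⊂ , λ { w (here refl) rw _ → contradiction (trans (sym ru) rw) λ () ; w (there w∈) → done w w∈ }
        ...   | true  | true  | _     = D , pr , D⊂ , λ { w (here refl) _ mw → contradiction (trans (sym mu) mw) λ () ; w (there w∈) → done w w∈ }
        ...   | true  | false | true  = D , pr , D⊂ , λ { w (here refl) _ _ → du ; w (there w∈) → done w w∈ }
        ...   | true  | false | false = insert D u ,
                settleSingle D u pr ru (proj₁ ok) (proj₁ (proj₂ ok)) du ¬Dp , D⊂′ ,
                λ { w (here refl) _ _ → ↦-same D u true ; w (there w∈) rw mw → insert-grow D u w (done w w∈ rw mw) }
          where
          ok = par-ok u ru
          ¬Dp : D (par u) ≡ false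
          ¬Dp with D (par u) in dp
          ... | false = refl
          ... | true  = contradiction (trans (sym (proj₂ (proj₂ ok))) (D⊂ (par u) dp)) λ ()
          D⊂′ : ∀ w → insert D u w ≡ true → mt w ≡ false
          D⊂′ w h with insert-cases D u w h
          ... | inj₁ refl     = mu
          ... | inj₂ (_ , dw) = D⊂ w dw


        -- The two vertices of a pair are finished together. So an unfinished matched vertex has an
        -- unfinished partner, and the edge between them is still at disposal.
        phase₂ : (us : List (Fin n)) (D₀ : Fin n → Bool) → Progress D₀ → (∀ w → D₀ w ≡ true → mt w ≡ false) →
                 ∃ λ D → Progress D × (∀ u → isR u ≡ true → mt u ≡ true → D u ≡ false → D (par u) ≡ false)
                 × (∀ w → D₀ w ≡ true → D w ≡ true)
                 × (∀ u → u ∈ us → isR u ≡ true → mt u ≡ true → D u ≡ true)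
        phase₂ [] D₀ pr₀ D₀⊂ = D₀ , pr₀ , closed , (λ _ h → h) , (λ _ ())
          where
          closed : ∀ u → isR u ≡ true → mt u ≡ true → D₀ u ≡ false → D₀ (par u) ≡ false
          closed u ru mu _ with D₀ (par u) in dp
          ... | false = refl
          ... | true  = contradiction (trans (sym (proj₂ (proj₂ (par-ok u ru)))) (D₀⊂ (par u) dp)) λ ()
        phase₂ (u ∷ us) D₀ pr₀ D₀⊂ with phase₂ us D₀ pr₀ D₀⊂
        ... | D , pr , closed , grow , done with isR u in ru | mt u in mu | D u in du
        ...   | false | _     | _     = D , pr , closed , grow , λ { w (here refl) rw _ → contradiction (trans (sym ru) rw) λ () ; w (there w∈) → done w w∈ }
        ...   | true  | false | _     = D , pr , closed , grow , λ { w (here refl) _ mw → contradiction (trans (sym mu) mw) λ () ; w (there w∈) → done w w∈ }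
        ...   | true  | true  | true  = D , pr , closed , grow , λ { w (here refl) _ _ → du ; w (there w∈) → done w w∈ }
        ...   | true  | true  | false = insert (insert D u) p ,
                settlePair D u pr ru (proj₁ ok) (proj₁ (proj₂ ok)) du (closed u ru mu du) , closed′ ,
                (λ w h → insert-grow (insert D u) p w (insert-grow D u w (grow w h))) ,
                λ { w (here refl) _ _ → insert-grow (insert D u) p u (↦-same D u true)
                  ; w (there w∈) rw mw → insert-grow (insert D u) p w (insert-grow D u w (done w w∈ rw mw)) }
          where
          p = par u
          ok = par-ok u ru
          closed′ : ∀ w → isR w ≡ true → mt w ≡ true → insert (insert D u) p w ≡ false → insert (insert D u) p (par w) ≡ false
          closed′ w rw mw h with insert-false (insert D u) p w h
          ... | w≢p , h₁ with insert-false D u w h₁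
          ...   | w≢u , ¬dw = trans (↦-other (insert D u) p true (par w) (λ eq → w≢u (trans (sym (par-par w mw)) (trans (cong par eq) (par-par u mu)))))
                  (trans (↦-other D u true (par w) (λ eq → w≢p (trans (sym (par-par w mw)) (cong par eq)))) (closed w rw mw ¬dw))

        run : (us : List (Fin n)) → (∀ u → u ∈ us) →
              ∃ λ (st : State) → (∀ u → isR u ≡ true → index (val st u) ≡ 0)
                                × (∀ u w → isR u ≡ true → isR w ≡ true → val st u ≡ val st w → u ≡ w)
        run us all∈ with phase₁ us
        ... | D₁ , pr₁ , D₁⊂ , done₁ with phase₂ us D₁ pr₁ D₁⊂
        ...   | D , pr , _ , grow , done₂ = state pr , (λ u ru → hole (inv pr) u (D-all u ru)) ,
                  (λ u w ru rw → dist (inv pr) u w (D-all u ru) (D-all w rw))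
          where
          D-all : ∀ u → isR u ≡ true → D u ≡ true
          D-all u ru with mt u in mu
          ... | true  = done₂ u (all∈ u) ru mu
          ... | false = grow u (done₁ u (all∈ u) ru mu)

-- Maximal matchings

module Matching {n : ℕ} (G : Graph n) (isR : Fin n → Bool) where

  Matched : (Fin n → Bool) → (Fin n → Fin n) → Set
  Matched mt mate = ∀ u → mt u ≡ true →
    isR (mate u) ≡ true × adj G u (mate u) ≡ true × mt (mate u) ≡ true × mate (mate u) ≡ u

  Covers : (Fin n → Bool) → List (Fin n × Fin n) → Set
  Covers mt ps = ∀ u v → (u , v) ∈ ps → isR u ≡ true → isR v ≡ true → adj G u v ≡ true → mt u ≡ true ⊎ mt v ≡ true

  private
    grow : ∀ (f : Fin n → Bool) u w → f w ≡ true → (f [ u ↦ true ]) w ≡ true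
    grow f u w eq with w Fin.≟ u
    ... | yes _ = refl
    ... | no _  = eq

    module Add (mt : Fin n → Bool) (mate : Fin n → Fin n) (ok : Matched mt mate) (u v : Fin n)
      (ru : isR u ≡ true) (rv : isR v ≡ true) (uv : adj G u v ≡ true) (mu : mt u ≡ false) (mv : mt v ≡ false) where

      mt′ : Fin n → Bool
      mt′ = (mt [ u ↦ true ]) [ v ↦ true ]
      mate′ : Fin n → Fin n
      mate′ = (mate [ u ↦ v ]) [ v ↦ u ]

      u≢v : u ≢ v
      u≢v refl = contradiction (trans (sym uv) (adj-irr G u)) λ ()

      mt′-grow : ∀ w → mt w ≡ true → mt′ w ≡ true
      mt′-grow w h = grow (mt [ u ↦ true ]) v w (grow mt u w h)
      mt′u : mt′ u ≡ true
      mt′u = grow (mt [ u ↦ true ]) v u (↦-same mt u true)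
      mt′v : mt′ v ≡ true
      mt′v = ↦-same (mt [ u ↦ true ]) v true
      mate′u : mate′ u ≡ v
      mate′u = trans (↦-other (mate [ u ↦ v ]) v u u u≢v) (↦-same mate u v)
      mate′v : mate′ v ≡ u
      mate′v = ↦-same (mate [ u ↦ v ]) v u
      mate′-other : ∀ w → w ≢ u → w ≢ v → mate′ w ≡ mate w
      mate′-other w w≢u w≢v = trans (↦-other (mate [ u ↦ v ]) v u w w≢v) (↦-other mate u v w w≢u)

      Link : Fin n → Fin n → Set
      Link w x = isR x ≡ true × adj G w x ≡ true × mt′ x ≡ true × mate′ x ≡ w

      ok′ : Matched mt′ mate′
      ok′ w h = cases (w Fin.≟ u) (w Fin.≟ v)
        where
        cases : Dec (w ≡ u) → Dec (w ≡ v) → Link w (mate′ w)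
        cases (yes refl) _          = subst (Link w) (sym mate′u) (rv , uv , mt′v , mate′v)
        cases (no _)     (yes refl) = subst (Link w) (sym mate′v) (ru , trans (adj-sym G w u) uv , mt′u , mate′u)
        cases (no w≢u)   (no w≢v)   = subst (Link w) (sym (mate′-other w w≢u w≢v))
            (proj₁ old , proj₁ (proj₂ old) , mt′-grow (mate w) (proj₁ (proj₂ (proj₂ old))) ,
             trans (mate′-other (mate w) (apart mu) (apart mv)) (proj₂ (proj₂ (proj₂ old))))
          where
          old = ok w (trans (sym (trans (↦-other (mt [ u ↦ true ]) v true w w≢v) (↦-other mt u true w w≢u))) h)
          apart : ∀ {x} → mt x ≡ false → mate w ≢ x
          apart mx eq = contradiction (trans (sym (proj₁ (proj₂ (proj₂ old)))) (trans (cong mt eq) mx)) λ ()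

  -- A pair is added exactly when it is an edge between two unmatched rest vertices. Matched
  -- vertices remain matched, so every edge once inspected stays covered.
  greedy : (ps : List (Fin n × Fin n)) → ∃₂ λ mt mate → Matched mt mate × Covers mt ps
  greedy [] = (λ _ → false) , (λ u → u) , (λ _ ()) , (λ _ _ ())
  greedy ((u , v) ∷ ps) with greedy ps
  ... | mt , mate , ok , cov with isR u in ru | isR v in rv | adj G u v in uv | mt u in mu | mt v in mv
  ... | false | _     | _     | _     | _     = mt , mate , ok , λ { _ _ (here refl) r _ _ → contradiction (trans (sym ru) r) λ () ; x y (there p) → cov x y p }
  ... | true  | false | _     | _     | _     = mt , mate , ok , λ { _ _ (here refl) _ r _ → contradiction (trans (sym rv) r) λ () ; x y (there p) → cov x y p }
  ... | true  | true  | false | _     | _     = mt , mate , ok , λ { _ _ (here refl) _ _ a → contradiction (trans (sym uv) a) λ () ; x y (there p) → cov x y p }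
  ... | true  | true  | true  | true  | _     = mt , mate , ok , λ { _ _ (here refl) _ _ _ → inj₁ mu ; x y (there p) → cov x y p }
  ... | true  | true  | true  | false | true  = mt , mate , ok , λ { _ _ (here refl) _ _ _ → inj₂ mv ; x y (there p) → cov x y p }
  ... | true  | true  | true  | false | false = mt′ , mate′ , ok′ ,
      λ { _ _ (here refl) _ _ _ → inj₁ mt′u ; x y (there p) rx ry a → Sum.map (mt′-grow x) (mt′-grow y) (cov x y p rx ry a) }
    where open Add mt mate ok u v ru rv uv mu mv

  -- A matched vertex has its mate as partner. An unmatched rest vertex takes any rest neighbour,
  -- which maximality makes a matched one.
  maximalMatching : (∀ u → isR u ≡ true → ∃ λ v → isR v ≡ true × adj G u v ≡ true) →
    ∃₂ λ (mt : Fin n → Bool) (par : Fin n → Fin n) →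
      (∀ u → isR u ≡ true → isR (par u) ≡ true × adj G u (par u) ≡ true × mt (par u) ≡ true) ×
      (∀ u → mt u ≡ true → par (par u) ≡ u)
  maximalMatching nbr with greedy (cartesianProduct (allFin n) (allFin n))
  ... | mt , mate , ok , cov = mt , par , par-ok , par-par
    where
    parBy : ∀ u b b′ → mt u ≡ b → isR u ≡ b′ → Fin n
    parBy u true  _     _ _  = mate u
    parBy u false true  _ ru = proj₁ (nbr u ru)
    parBy u false false _ _  = u
    par : Fin n → Fin n
    par u = parBy u (mt u) (isR u) refl refl
    parBy-ok : ∀ u b (mu : mt u ≡ b) (b′ : Bool) (ru : isR u ≡ b′) → b′ ≡ true →
      let x = parBy u b b′ mu ru in isR x ≡ true × adj G u x ≡ true × mt x ≡ true
    parBy-ok u true  mu b′   ru _ = proj₁ (ok u mu) , proj₁ (proj₂ (ok u mu)) , proj₁ (proj₂ (proj₂ (ok u mu)))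
    parBy-ok u false mu true ru _ = proj₁ (proj₂ (nbr u ru)) , proj₂ (proj₂ (nbr u ru)) , covered
      where
      v = proj₁ (nbr u ru)
      covered : mt v ≡ true
      covered with cov u v (∈-cartesianProduct⁺ (∈-allFin u) (∈-allFin v)) ru (proj₁ (proj₂ (nbr u ru))) (proj₂ (proj₂ (nbr u ru)))
      ... | inj₁ mu′ = contradiction (trans (sym mu) mu′) λ ()
      ... | inj₂ mv  = mv
    par-ok : ∀ u → isR u ≡ true → isR (par u) ≡ true × adj G u (par u) ≡ true × mt (par u) ≡ true
    par-ok u ru = parBy-ok u (mt u) refl (isR u) refl ru
    parBy-mate : ∀ u b (mu : mt u ≡ b) b′ (ru : isR u ≡ b′) → b ≡ true → parBy u b b′ mu ru ≡ mate u
    parBy-mate u true mu b′ ru _ = refl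
    par-mate : ∀ u → mt u ≡ true → par u ≡ mate u
    par-mate u mu = parBy-mate u (mt u) refl (isR u) refl mu
    par-par : ∀ u → mt u ≡ true → par (par u) ≡ u
    par-par u mu = trans (cong par (par-mate u mu)) (trans (par-mate (mate u) (proj₁ (proj₂ (proj₂ (ok u mu))))) (proj₂ (proj₂ (proj₂ (ok u mu)))))

-- Floors and scaled ranks

floor-lower : ∀ a b {{_ : NonZero b}} → b * (a / b) ≤ a
floor-lower a b = ≤-trans (≤-reflexive (*-comm b (a / b))) (m/n*n≤m a b)

floor-upper-< : ∀ a b {{_ : NonZero b}} → a < b * (a / b) + b
floor-upper-< a b = begin-strict
  a                      ≡⟨ m≡m%n+[m/n]*n a b ⟩
  a % b + a / b * b      <⟨ +-monoˡ-< (a / b * b) (m%n<n a b) ⟩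
  b + a / b * b          ≡⟨ trans (+-comm b _) (cong (_+ b) (*-comm (a / b) b)) ⟩
  b * (a / b) + b        ∎
  where open ≤-Reasoning

≤-floor : ∀ x a b {{_ : NonZero b}} → b * x ≤ a → x ≤ a / b
≤-floor x a b le = subst (_≤ a / b) (trans (cong (_/ b) (*-comm b x)) (m*n/n≡m x b)) (/-monoˡ-≤ b le)

floor-upper : ∀ a b {{_ : NonZero b}} → a ≤ b * (a / b) + b
floor-upper a b = <⇒≤ (floor-upper-< a b)

-- A slope of at least 1 survives rounding down.
scale-mono : ∀ a b {{_ : NonZero b}} {r r′} → b ≤ a → r < r′ → (r * a) / b < (r′ * a) / b
scale-mono a b {r} {r′} b≤a r<r′ = *-cancelˡ-< b _ _ (+-cancelʳ-< b _ _ (begin-strict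
  b * (r * a / b) + b      ≤⟨ +-mono-≤ (floor-lower (r * a) b) b≤a ⟩
  r * a + a                ≡⟨ +-comm (r * a) a ⟩
  suc r * a                ≤⟨ *-monoˡ-≤ a r<r′ ⟩
  r′ * a                   ≡⟨ m≡m%n+[m/n]*n (r′ * a) b ⟩
  r′ * a % b + r′ * a / b * b <⟨ +-monoˡ-< _ (m%n<n (r′ * a) b) ⟩
  b + r′ * a / b * b       ≡⟨ trans (+-comm b _) (cong (_+ b) (*-comm (r′ * a / b) b)) ⟩
  b * (r′ * a / b) + b     ∎))
  where open ≤-Reasoning

scale-injective : ∀ a b {{_ : NonZero b}} {r r′} → b ≤ a → (r * a) / b ≡ (r′ * a) / b → r ≡ r′
scale-injective a b {r} {r′} b≤a eq with <-cmp r r′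
... | tri< lt _ _ = contradiction eq (<⇒≢ (scale-mono a b b≤a lt))
... | tri≈ _ e _  = e
... | tri> _ _ gt = contradiction (sym eq) (<⇒≢ (scale-mono a b b≤a gt))

-- The weighting

module Construct {n : ℕ} {{n≢0 : NonZero n}} (G : Graph n) {d : ℕ} (reg : Regular d G) (1≤d : 1 ≤ d)
  (W X T t α : ℕ) {{W≢0 : NonZero W}} {{X≢0 : NonZero X}} {{T≢0 : NonZero T}} {{α≢0 : NonZero α}}
  (lab : Fin n → ℕ) (balanced : BalancedLabelling G d (labelCount W X) t lab)
  (3≤T : 3 ≤ T) (room : (X + 2) * d + 37 * (t * labelCount W X) ≤ d * W)
  (H≤t : 3 + T ≤ t) (96H<X : 96 * (3 + T) < X) (n≤κd : n * (3 + T) ≤ 4 * α * d * T) where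

  open Counting G {d} reg 1≤d {labelCount W X} {t} lab balanced public
  open Kinds W X public
  open Blocks T α public

  -- On an edge between toggle and rest, 2 α are set aside for placing the toggle vertex and 2 α for
  -- the coarse weight in {0, α, 2 α}.
  κ : ℕ
  κ = 4 * α

  instance
    Q≢0 : NonZero Q
    Q≢0 = >-nonZero (≤-trans (>-nonZero⁻¹ W) (≤-trans (m≤n+m W F) (m≤n+m (F + W) FXF)))
    nXH≢0 : NonZero (n * X * H)
    nXH≢0 = m*n≢0 (n * X) H {{m*n≢0 n X}}
    nH≢0 : NonZero (n * H)
    nH≢0 = m*n≢0 n H
    QH≢0 : NonZero (Q * H)
    QH≢0 = m*n≢0 Q H

  k : Fin n → Kind
  k v = kind (lab v)

  viewOf : ∀ v → View (lab v) (k v)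
  viewOf v = view (lab v) (proj₁ balanced v)

  baseCount slotCount : Kind → Fin n → ℕ
  baseCount kd v = ∑ n (λ u → 𝟙 (adj G v u) * base kd (k u))
  slotCount kd v = ∑ n (λ u → 𝟙 (adj G v u ∧ slot kd (k u)))

  restDeg toggleDeg : Fin n → ℕ
  restDeg v   = ∑ n (λ u → 𝟙 (adj G v u ∧ isRest (k u)))
  toggleDeg v = ∑ n (λ u → 𝟙 (adj G v u ∧ isToggle (k u)))

  -- The slopes make the stretched positions grow with the rank as the base sums grow with the
  -- level; the added constants lift them into the range of the slots. Distinct ranks keep the
  -- vertices apart.
  rankB rankA zB zA : Fin n → ℕ
  rankB v = rank 0 v
  rankA v = rank FX v
  zB v = rankB v * (κ * d * (X + 2) * T) / (n * X * H) + 12 * (κ * t)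
  zA v = rankA v * (4 * α * d * (X + 1)) / (n * H) + 2 * (α * (d * (F + W))) / (Q * H)

  -- `fixed` is what a vertex has before its slots are filled. For a toggle vertex this includes α
  -- for each rest neighbour, because coarse weights start at 1.
  target fixed : Kind → Fin n → ℕ
  target (bulk _)   v = posB (zB v)
  target (toggle _) v = posA (zA v)
  target (rest m)   v = κ * baseCount (rest m) v
  fixed (bulk i)   v = κ * baseCount (bulk i) v
  fixed (toggle i) v = κ * baseCount (toggle i) v + α * restDeg v
  fixed (rest m)   v = κ * baseCount (rest m) v

  cap : Kind → ℕ
  cap (bulk _)   = κ
  cap (toggle _) = 2 * α
  cap (rest _)   = 0

  1≤t : 1 ≤ t
  1≤t = ≤-trans (s≤s z≤n) H≤t
  1≤α : 1 ≤ α
  1≤α = >-nonZero⁻¹ α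
  Q≤E : Q ≤ E
  Q≤E = m≤n*m Q t {{>-nonZero 1≤t}}
  QH≤E : Q * H ≤ E
  QH≤E = ≤-trans (≤-reflexive (*-comm Q H)) (*-monoˡ-≤ Q H≤t)
  3≤X : 3 ≤ X
  3≤X = ≤-trans (s≤s (s≤s (s≤s z≤n))) (<⇒≤ 96H<X)

  mask : ∀ v (p : Kind → Bool) f → (∀ {ℓ kd} → View ℓ kd → 𝟙 (p kd) ≡ f ℓ) →
         ∑ n (λ u → 𝟙 (adj G v u ∧ p (k u))) ≡ nbrs v f
  mask v p f eq = ∑-cong n (λ u → trans (𝟙-∧ (adj G v u) (p (k u))) (cong (𝟙 (adj G v u) *_) (eq (viewOf u))))

  restDeg≡ : ∀ v → restDeg v ≡ nbrsIn v FXF Q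
  restDeg≡ v = mask v isRest (inside FXF Q) isRest-inside

  toggleDeg≡ : ∀ v → toggleDeg v ≡ nbrsIn v FX FXF
  toggleDeg≡ v = mask v isToggle (inside FX FXF) isToggle-inside

  FXF≤Q : FXF ≤ Q
  FXF≤Q = m≤m+n FXF (F + W)
  FX≤Q : FX ≤ Q
  FX≤Q = ≤-trans (m≤m+n FX F) FXF≤Q

  restDeg-upper : ∀ v → Q * restDeg v ≤ d * (F + W) + 2 * E
  restDeg-upper v = subst (λ x → Q * x ≤ d * (F + W) + 2 * E) (sym (restDeg≡ v)) (nbrsIn-upper v {FXF} (F + W) refl ≤-refl)
  restDeg-lower : ∀ v → d * (F + W) ≤ Q * restDeg v + 2 * E
  restDeg-lower v = subst (λ x → d * (F + W) ≤ Q * x + 2 * E) (sym (restDeg≡ v)) (nbrsIn-lower v {FXF} (F + W) refl ≤-refl)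
  toggleDeg-upper : ∀ v → Q * toggleDeg v ≤ d * F + 2 * E
  toggleDeg-upper v = subst (λ x → Q * x ≤ d * F + 2 * E) (sym (toggleDeg≡ v)) (nbrsIn-upper v {FX} F refl FXF≤Q)
  toggleDeg-lower : ∀ v → d * F ≤ Q * toggleDeg v + 2 * E
  toggleDeg-lower v = subst (λ x → d * F ≤ Q * x + 2 * E) (sym (toggleDeg≡ v)) (nbrsIn-lower v {FX} F refl FXF≤Q)

  module _ (v : Fin n) {i : ℕ} (i<F : i < F) where
    private
      ī = F ∸ i
      i+ī : i + ī ≡ F
      i+ī = m+[n∸m]≡n (<⇒≤ i<F)
      I₁ = nbrsIn v (ī * X) FX
      I₂ = nbrsIn v (FX + ī) FXF
      I₃ = nbrsIn v (FXF + (ī + W)) Q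
      len₁ : ī * X + i * X ≡ FX
      len₁ = trans (sym (*-distribʳ-+ X ī i)) (cong (_* X) (trans (+-comm ī i) i+ī))
      len₂ : FX + ī + i ≡ FXF
      len₂ = trans (+-assoc FX ī i) (cong (FX +_) (trans (+-comm ī i) i+ī))
      len₃ : FXF + (ī + W) + i ≡ Q
      len₃ = trans (+-assoc FXF (ī + W) i) (cong (FXF +_) (trans (e ī W i) (cong (_+ W) i+ī)))
        where
        e : ∀ a b c → a + b + c ≡ c + a + b
        e = solve-∀
      len₄ : FXF + ī + W ≤ Q
      len₄ = ≤-trans (≤-reflexive (+-assoc FXF ī W)) (+-monoʳ-≤ FXF (+-monoˡ-≤ W (m∸n≤m F i)))

    baseCount-bulk : baseCount (bulk i) v ≡ I₁ + I₂ + I₃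
    baseCount-bulk = begin
      ∑ n (λ u → 𝟙 (adj G v u) * base (bulk i) (k u))
        ≡⟨ ∑-cong n (λ u → trans (cong (𝟙 (adj G v u) *_) (base-bulk i ī i+ī (viewOf u)))
             (e (𝟙 (adj G v u)) (inside (ī * X) FX (lab u)) (inside (FX + ī) FXF (lab u)) (inside (FXF + (ī + W)) Q (lab u)))) ⟩
      ∑ n (λ u → 𝟙 (adj G v u) * inside (ī * X) FX (lab u) + 𝟙 (adj G v u) * inside (FX + ī) FXF (lab u)
               + 𝟙 (adj G v u) * inside (FXF + (ī + W)) Q (lab u))
        ≡⟨ trans (∑-distrib-+ n _ _) (cong (_+ I₃) (∑-distrib-+ n _ _)) ⟩
      I₁ + I₂ + I₃ ∎
      where
      open ≡-Reasoning
      e : ∀ a x y z → a * (x + y + z) ≡ a * x + a * y + a * z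
      e = solve-∀

    baseCount-toggle : baseCount (toggle i) v ≡ I₁ + I₂
    baseCount-toggle = begin
      ∑ n (λ u → 𝟙 (adj G v u) * base (toggle i) (k u))
        ≡⟨ ∑-cong n (λ u → trans (cong (𝟙 (adj G v u) *_) (base-toggle i ī i+ī (viewOf u)))
             (*-distribˡ-+ (𝟙 (adj G v u)) _ _)) ⟩
      ∑ n (λ u → 𝟙 (adj G v u) * inside (ī * X) FX (lab u) + 𝟙 (adj G v u) * inside (FX + ī) FXF (lab u))
        ≡⟨ ∑-distrib-+ n _ _ ⟩
      I₁ + I₂ ∎
      where open ≡-Reasoning

    base-toggle-upper : Q * baseCount (toggle i) v ≤ d * (i * (X + 1)) + 4 * E
    base-toggle-upper = begin
      Q * baseCount (toggle i) v                    ≡⟨ cong (Q *_) baseCount-toggle ⟩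
      Q * (I₁ + I₂)                                 ≡⟨ *-distribˡ-+ Q I₁ I₂ ⟩
      Q * I₁ + Q * I₂                               ≤⟨ +-mono-≤ (nbrsIn-upper v (i * X) len₁ FX≤Q) (nbrsIn-upper v i len₂ FXF≤Q) ⟩
      d * (i * X) + 2 * E + (d * i + 2 * E)         ≡⟨ e d i X E ⟩
      d * (i * (X + 1)) + 4 * E                     ∎
      where
      open ≤-Reasoning
      e : ∀ d i X E → d * (i * X) + 2 * E + (d * i + 2 * E) ≡ d * (i * (X + 1)) + 4 * E
      e = solve-∀

    base-toggle-lower : d * (i * (X + 1)) ≤ Q * baseCount (toggle i) v + 4 * E
    base-toggle-lower = begin
      d * (i * (X + 1))                             ≡⟨ e₁ d i X ⟩
      d * (i * X) + d * i                           ≤⟨ +-mono-≤ (nbrsIn-lower v (i * X) len₁ FX≤Q) (nbrsIn-lower v i len₂ FXF≤Q) ⟩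
      Q * I₁ + 2 * E + (Q * I₂ + 2 * E)             ≡⟨ e₂ Q I₁ I₂ E ⟩
      Q * (I₁ + I₂) + 4 * E                         ≡⟨ cong (λ x → Q * x + 4 * E) (sym baseCount-toggle) ⟩
      Q * baseCount (toggle i) v + 4 * E            ∎
      where
      open ≤-Reasoning
      e₁ : ∀ d i X → d * (i * (X + 1)) ≡ d * (i * X) + d * i
      e₁ = solve-∀
      e₂ : ∀ Q a b E → Q * a + 2 * E + (Q * b + 2 * E) ≡ Q * (a + b) + 4 * E
      e₂ = solve-∀

    base-bulk-upper : Q * baseCount (bulk i) v ≤ d * (i * (X + 2)) + 6 * E
    base-bulk-upper = begin
      Q * baseCount (bulk i) v                      ≡⟨ cong (Q *_) baseCount-bulk ⟩
      Q * (I₁ + I₂ + I₃)                            ≡⟨ e₁ Q I₁ I₂ I₃ ⟩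
      Q * I₁ + Q * I₂ + Q * I₃
        ≤⟨ +-mono-≤ (+-mono-≤ (nbrsIn-upper v (i * X) len₁ FX≤Q) (nbrsIn-upper v i len₂ FXF≤Q)) (nbrsIn-upper v i len₃ ≤-refl) ⟩
      d * (i * X) + 2 * E + (d * i + 2 * E) + (d * i + 2 * E) ≡⟨ e₂ d i X E ⟩
      d * (i * (X + 2)) + 6 * E                     ∎
      where
      open ≤-Reasoning
      e₁ : ∀ Q a b c → Q * (a + b + c) ≡ Q * a + Q * b + Q * c
      e₁ = solve-∀
      e₂ : ∀ d i X E → d * (i * X) + 2 * E + (d * i + 2 * E) + (d * i + 2 * E) ≡ d * (i * (X + 2)) + 6 * E
      e₂ = solve-∀

    base-bulk-lower : d * (i * (X + 2)) ≤ Q * baseCount (bulk i) v + 6 * E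
    base-bulk-lower = begin
      d * (i * (X + 2))                             ≡⟨ e₁ d i X ⟩
      d * (i * X) + d * i + d * i
        ≤⟨ +-mono-≤ (+-mono-≤ (nbrsIn-lower v (i * X) len₁ FX≤Q) (nbrsIn-lower v i len₂ FXF≤Q)) (nbrsIn-lower v i len₃ ≤-refl) ⟩
      Q * I₁ + 2 * E + (Q * I₂ + 2 * E) + (Q * I₃ + 2 * E) ≡⟨ e₂ Q I₁ I₂ I₃ E ⟩
      Q * (I₁ + I₂ + I₃) + 6 * E                    ≡⟨ cong (λ x → Q * x + 6 * E) (sym baseCount-bulk) ⟩
      Q * baseCount (bulk i) v + 6 * E              ∎
      where
      open ≤-Reasoning
      e₁ : ∀ d i X → d * (i * (X + 2)) ≡ d * (i * X) + d * i + d * i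
      e₁ = solve-∀
      e₂ : ∀ Q a b c E → Q * a + 2 * E + (Q * b + 2 * E) + (Q * c + 2 * E) ≡ Q * (a + b + c) + 6 * E
      e₂ = solve-∀

    slot-bulk-lower : d * W ≤ Q * slotCount (bulk i) v + 2 * E
    slot-bulk-lower = subst (λ x → d * W ≤ Q * x + 2 * E)
      (sym (mask v (slot (bulk i)) (inside (FXF + ī) (FXF + ī + W)) (slot-bulk i ī i+ī)))
      (nbrsIn-lower v W refl len₄)

  slotCount-toggle : ∀ v i → slotCount (toggle i) v ≡ restDeg v
  slotCount-toggle v i = trans (mask v (slot (toggle i)) (inside FXF Q) (slot-toggle i)) (sym (restDeg≡ v))

  Fits : Kind → Fin n → Set
  Fits kd v = fixed kd v ≤ target kd v × target kd v ≤ fixed kd v + cap kd * slotCount kd v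

  private
    3α≤κ : 3 * α ≤ κ
    3α≤κ = *-monoˡ-≤ α (n≤1+n 3)
    1≤κ : 1 ≤ κ
    1≤κ = ≤-trans 1≤α (m≤n*m α 4)
    H≤2T : H ≤ 2 * T
    H≤2T = subst₂ _≤_ refl (cong (T +_) (sym (+-identityʳ T))) (subst (_≤ T + T) (+-comm T 3) (+-monoʳ-≤ T 3≤T))
    T≤H : T ≤ H
    T≤H = m≤n+m T 3

  fits-bulk : ∀ v {i} → View (lab v) (bulk i) → Fits (bulk i) v
  fits-bulk v {i} (bulk i i<F lo hi ℓ<FX) = lower , upper
    where
    open ≤-Reasoning
    a = κ * d * (X + 2) * T
    b = n * X * H
    τ = posB (zB v)
    Qz₀ : Q * (12 * (κ * t)) ≡ 12 * (κ * E)
    Qz₀ = e Q κ t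
      where
      e : ∀ Q κ t → Q * (12 * (κ * t)) ≡ 12 * (κ * (t * Q))
      e = solve-∀
    iX≤Q : i * X ≤ Q
    iX≤Q = ≤-trans (*-monoˡ-≤ X (<⇒≤ i<F)) FX≤Q
    siX≤Q : suc i * X ≤ Q
    siX≤Q = ≤-trans (*-monoˡ-≤ X i<F) FX≤Q
    rk≥ : n * (d * (i * X)) ≤ Q * (d * rankB v) + n * (2 * E)
    rk≥ = ≤-trans (totalIn-lower {0} (i * X) refl iX≤Q)
            (+-monoˡ-≤ (n * (2 * E)) (*-monoʳ-≤ Q (*-monoʳ-≤ d (rank-lower {0} v lo))))
    rk≤ : Q * (d * rankB v) ≤ n * (d * (suc i * X) + 2 * E)
    rk≤ = ≤-trans (*-monoʳ-≤ Q (*-monoʳ-≤ d (rank-upper {0} v hi))) (totalIn-upper {0} (suc i * X) refl siX≤Q)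
    lower : κ * baseCount (bulk i) v ≤ τ
    lower = *-cancelˡ-≤ Q (begin
      Q * (κ * baseCount (bulk i) v)         ≡⟨ e Q κ (baseCount (bulk i) v) ⟩
      κ * (Q * baseCount (bulk i) v)         ≤⟨ *-monoʳ-≤ κ (base-bulk-upper v i<F) ⟩
      κ * (d * (i * (X + 2)) + 6 * E)
        ≤⟨ placeB-lower {j = i} {rk = rankB v} (>-nonZero⁻¹ n) (>-nonZero⁻¹ X) (>-nonZero⁻¹ T) T≤H H≤2T (≤-trans (s≤s (s≤s z≤n)) 3≤X) 3α≤κ Q≤E 1≤κ
             refl Qz₀ room (posB-lower (zB v)) (posB-upper (zB v)) rk≥ (floor-upper (rankB v * a) b) ⟩
      Q * τ                                  ∎)
      where
      e : ∀ Q κ x → Q * (κ * x) ≡ κ * (Q * x)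
      e = solve-∀
    upper : τ ≤ κ * baseCount (bulk i) v + κ * slotCount (bulk i) v
    upper = *-cancelˡ-≤ Q (+-cancelʳ-≤ (8 * (κ * E)) _ _ (begin
      Q * τ + 8 * (κ * E)
        ≤⟨ placeB-upper {j = i} {rk = rankB v} (>-nonZero⁻¹ n) (>-nonZero⁻¹ X) (>-nonZero⁻¹ T) T≤H H≤2T (≤-trans (s≤s (s≤s z≤n)) 3≤X) 3α≤κ Q≤E 1≤κ
             refl Qz₀ room (posB-lower (zB v)) (posB-upper (zB v)) rk≤ (floor-lower (rankB v * a) b) ⟩
      κ * (d * (i * (X + 2)) + d * W)        ≤⟨ *-monoʳ-≤ κ (+-mono-≤ (base-bulk-lower v i<F) (slot-bulk-lower v i<F)) ⟩
      κ * (Q * baseCount (bulk i) v + 6 * E + (Q * slotCount (bulk i) v + 2 * E))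
        ≡⟨ e κ Q (baseCount (bulk i) v) (slotCount (bulk i) v) E ⟩
      Q * (κ * baseCount (bulk i) v + κ * slotCount (bulk i) v) + 8 * (κ * E) ∎))
      where
      e : ∀ κ Q x y E → κ * (Q * x + 6 * E + (Q * y + 2 * E)) ≡ Q * (κ * x + κ * y) + 8 * (κ * E)
      e = solve-∀

  -- F + W = W (X + 1), so this is `room` multiplied by X + 1, where 4 ≤ X + 2 and 8 + 23 ≤ 37.
  roomA : 4 * ((X + 1) * d) + (8 * ((X + 1) * E) + 23 * E) ≤ d * (F + W)
  roomA = begin
    4 * ((X + 1) * d) + (8 * ((X + 1) * E) + 23 * E)
      ≤⟨ +-mono-≤ (*-monoˡ-≤ ((X + 1) * d) {4} {X + 2} (≤-trans (s≤s (s≤s (s≤s (s≤s z≤n)))) (+-monoˡ-≤ 2 3≤X)))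
                  (+-monoʳ-≤ (8 * ((X + 1) * E)) (*-monoʳ-≤ 23 (m≤n*m E (X + 1) {{>-nonZero (m≤n+m 1 X)}}))) ⟩
    (X + 2) * ((X + 1) * d) + (8 * ((X + 1) * E) + 23 * ((X + 1) * E))
      ≤⟨ m≤m+n _ (6 * ((X + 1) * E)) ⟩
    (X + 2) * ((X + 1) * d) + (8 * ((X + 1) * E) + 23 * ((X + 1) * E)) + 6 * ((X + 1) * E)
      ≡⟨ e₁ X d E ⟩
    (X + 1) * ((X + 2) * d + 37 * E)
      ≤⟨ *-monoʳ-≤ (X + 1) room ⟩
    (X + 1) * (d * W)
      ≡⟨ e₂ X d W ⟩
    d * (W * X + W) ∎
    where
    open ≤-Reasoning
    e₁ : ∀ X d E → (X + 2) * ((X + 1) * d) + (8 * ((X + 1) * E) + 23 * ((X + 1) * E)) + 6 * ((X + 1) * E) ≡ (X + 1) * ((X + 2) * d + 37 * E)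
    e₁ = solve-∀
    e₂ : ∀ X d W → (X + 1) * (d * W) ≡ d * (W * X + W)
    e₂ = solve-∀

  fits-toggle : ∀ v {i} → View (lab v) (toggle i) → Fits (toggle i) v
  fits-toggle v {i} (toggle i i<F ℓ≡) = lower , upper
    where
    open ≤-Reasoning
    a = 4 * α * d * (X + 1)
    b = n * H
    x = posA (zA v)
    c = 2 * (α * (d * (F + W)))
    bc = baseCount (toggle i) v
    rk≥ : n * (d * i) ≤ Q * (d * rankA v) + n * (2 * E)
    rk≥ = ≤-trans (totalIn-lower {FX} i refl (≤-trans (+-monoʳ-≤ FX (<⇒≤ i<F)) FXF≤Q))
            (+-monoˡ-≤ (n * (2 * E)) (*-monoʳ-≤ Q (*-monoʳ-≤ d (rank-lower {FX} v (≤-reflexive (sym ℓ≡))))))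
    rk≤ : Q * (d * rankA v) ≤ n * (d * suc i + 2 * E)
    rk≤ = ≤-trans (*-monoʳ-≤ Q (*-monoʳ-≤ d (rank-upper {FX} v (≤-reflexive (trans (cong suc ℓ≡) (sym (+-suc FX i)))))))
            (totalIn-upper {FX} (suc i) refl (≤-trans (+-monoʳ-≤ FX i<F) FXF≤Q))
    lower : κ * bc + α * restDeg v ≤ x
    lower = *-cancelˡ-≤ Q (begin
      Q * (κ * bc + α * restDeg v)                   ≡⟨ e Q κ bc α (restDeg v) ⟩
      κ * (Q * bc) + α * (Q * restDeg v)             ≤⟨ +-mono-≤ (*-monoʳ-≤ κ (base-toggle-upper v i<F)) (*-monoʳ-≤ α (restDeg-upper v)) ⟩
      κ * (d * (i * (X + 1)) + 4 * E) + α * (d * (F + W) + 2 * E)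
        ≤⟨ placeA-lower {d = d} {j = i} {X = X} {rk = rankA v} {S = F + W} (>-nonZero⁻¹ n) 1≤α Q≤E QH≤E refl (floor-upper c (Q * H)) (floor-lower c (Q * H)) roomA
             (posA-lower (zA v)) (posA-upper (zA v)) rk≥ (floor-upper (rankA v * a) b) ⟩
      Q * x                                          ∎)
      where
      e : ∀ Q κ x α y → Q * (κ * x + α * y) ≡ κ * (Q * x) + α * (Q * y)
      e = solve-∀
    upper : x ≤ κ * bc + α * restDeg v + 2 * α * slotCount (toggle i) v
    upper = subst (λ s → x ≤ κ * bc + α * restDeg v + 2 * α * s) (sym (slotCount-toggle v i))
      (*-cancelˡ-≤ Q (+-cancelʳ-≤ (16 * (α * E) + 6 * (α * E)) _ _ (begin
      Q * x + (16 * (α * E) + 6 * (α * E))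
        ≤⟨ placeA-upper {d = d} {j = i} {X = X} {rk = rankA v} {S = F + W} (>-nonZero⁻¹ n) 1≤α Q≤E QH≤E refl (floor-upper c (Q * H)) (floor-lower c (Q * H)) roomA
             (posA-lower (zA v)) (posA-upper (zA v)) rk≤ (floor-lower (rankA v * a) b) ⟩
      κ * (d * (i * (X + 1))) + 3 * (α * (d * (F + W)))
        ≤⟨ +-mono-≤ (*-monoʳ-≤ κ (base-toggle-lower v i<F)) (*-monoʳ-≤ 3 (*-monoʳ-≤ α (restDeg-lower v))) ⟩
      κ * (Q * bc + 4 * E) + 3 * (α * (Q * restDeg v + 2 * E))
        ≡⟨ e α Q bc E (restDeg v) ⟩
      Q * (κ * bc + α * restDeg v + 2 * α * restDeg v) + (16 * (α * E) + 6 * (α * E)) ∎)))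
      where
      e : ∀ α Q x E y → 4 * α * (Q * x + 4 * E) + 3 * (α * (Q * y + 2 * E)) ≡ Q * (4 * α * x + α * y + 2 * α * y) + (16 * (α * E) + 6 * (α * E))
      e = solve-∀

  fits : ∀ v {kd} → View (lab v) kd → Fits kd v
  fits v w@(bulk _ _ _ _ _) = fits-bulk v w
  fits v w@(toggle _ _ _)   = fits-toggle v w
  fits v (rest _ _ _)       = ≤-refl , m≤m+n _ _

  private
    filled : ∀ v → ∃ λ (y : Fin n → ℕ) → (∀ u → y u ≤ cap (k v)) ×
             (∀ u → (adj G v u ∧ slot (k v) (k u)) ≡ false → y u ≡ 0) × ∑ n y ≡ target (k v) v ∸ fixed (k v) v
    filled v = fill n (λ u → adj G v u ∧ slot (k v) (k u)) (cap (k v)) (target (k v) v ∸ fixed (k v) v)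
      (m≤n+o⇒m∸n≤o (target (k v) v) (fixed (k v) v) (proj₂ (fits v (viewOf v))))

  y : Fin n → Fin n → ℕ
  y v = proj₁ (filled v)

  y≤cap : ∀ v u → y v u ≤ cap (k v)
  y≤cap v = proj₁ (proj₂ (filled v))

  y-slot : ∀ v u → slot (k v) (k u) ≡ false → y v u ≡ 0
  y-slot v u ¬slot = proj₁ (proj₂ (proj₂ (filled v))) u (trans (cong (adj G v u ∧_) ¬slot) (∧-zeroʳ (adj G v u)))

  y-sum : ∀ v → fixed (k v) v + ∑ n (λ u → 𝟙 (adj G v u) * y v u) ≡ target (k v) v
  y-sum v = trans (cong (fixed (k v) v +_) (trans (∑-cong n pointwise) (proj₂ (proj₂ (proj₂ (filled v))))))
              (m+[n∸m]≡n (proj₁ (fits v (viewOf v))))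
    where
    pointwise : ∀ u → 𝟙 (adj G v u) * y v u ≡ y v u
    pointwise u with adj G v u in eq
    ... | true  = *-identityˡ _
    ... | false = sym (proj₁ (proj₂ (proj₂ (filled v))) u (cong (_∧ slot (k v) (k u)) eq))

  -- Here the size of α matters: n H ≤ κ d T says that n values at density T / H fit into a range of
  -- length κ d, that is, that the slope is at least 1.
  zB-injective : ∀ u v → zB u ≡ zB v → u ≡ v
  zB-injective u v eq = rank-injective {0} u v z≤n z≤n
    (scale-injective (κ * d * (X + 2) * T) (n * X * H) slope (+-cancelʳ-≡ _ _ _ eq))
    where
    open ≤-Reasoning
    slope : n * X * H ≤ κ * d * (X + 2) * T
    slope = begin
      n * X * H                   ≡⟨ e₁ n X H ⟩
      X * (n * H)                 ≤⟨ *-mono-≤ (m≤m+n X 2) n≤κd ⟩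
      (X + 2) * (κ * d * T)       ≡⟨ e₂ X (κ * d) T ⟩
      κ * d * (X + 2) * T         ∎
      where
      e₁ : ∀ n X H → n * X * H ≡ X * (n * H)
      e₁ = solve-∀
      e₂ : ∀ X y T → (X + 2) * (y * T) ≡ y * (X + 2) * T
      e₂ = solve-∀

  n≤κd′ : n ≤ κ * d
  n≤κd′ = *-cancelʳ-≤ n (κ * d) T (≤-trans (*-monoʳ-≤ n T≤H) n≤κd)

  zA-injective : ∀ u v → FX ≤ lab u → FX ≤ lab v → zA u ≡ zA v → u ≡ v
  zA-injective u v FX≤u FX≤v eq = rank-injective {FX} u v FX≤u FX≤v
    (scale-injective (4 * α * d * (X + 1)) (n * H) slope (+-cancelʳ-≡ _ _ _ eq))
    where
    open ≤-Reasoning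
    slope : n * H ≤ 4 * α * d * (X + 1)
    slope = *-mono-≤ n≤κd′ (≤-trans (≤-trans (m≤n*m H 96) (<⇒≤ 96H<X)) (m≤m+n X 1))

  -- Competitors and toggling neighbours of rest vertices

  isA isR : Fin n → Bool
  isA u = isToggle (k u)
  isR u = isRest (k u)

  ext : Fin n → ℕ
  ext u = κ * baseCount (k u) u + ∑ n (λ v → 𝟙 (adj G u v) * y v u)

  near : Fin n → Fin n → Bool
  near u w = not (lab w <ᵇ lab u ∸ 5 * W) ∧ (lab w <ᵇ lab u + 5 * W + 1)

  -- Competitors have labels within 5 W: at most 11 W labels, and W more covers the discrepancy,
  -- whence 12 in θ. Then 96 = 2 · 12 · 4 comes from 2 θ < α `pred lk` with n ≤ 4 α d. Of the added
  -- 2, one makes up for the floor and one is removed by `pred`.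
  lk θ : ℕ
  lk = 96 * (d * W) / Q + 2
  θ = 12 * (n * W) / Q

  37E≤dW : 37 * E ≤ d * W
  37E≤dW = ≤-trans (m≤n+m (37 * E) ((X + 2) * d)) room

  private
    instance
      d≢0 : NonZero d
      d≢0 = >-nonZero 1≤d

    multiple≤ : ∀ i → i ≤ 37 → i * E ≤ d * W
    multiple≤ i i≤ = ≤-trans (*-monoˡ-≤ E i≤) 37E≤dW

  2θ<αlk : 2 * θ < α * pred lk
  2θ<αlk = *-cancelˡ-< Q _ _ (begin-strict
    Q * (2 * θ)                      ≡⟨ e₁ Q θ ⟩
    2 * (Q * θ)                      ≤⟨ *-monoʳ-≤ 2 (floor-lower (12 * (n * W)) Q) ⟩
    2 * (12 * (n * W))               ≤⟨ *-monoʳ-≤ 2 (*-monoʳ-≤ 12 (*-monoˡ-≤ W n≤κd′)) ⟩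
    2 * (12 * (4 * α * d * W))       ≡⟨ e₂ α d W ⟩
    α * (96 * (d * W))               <⟨ *-monoʳ-< α (floor-upper-< (96 * (d * W)) Q) ⟩
    α * (Q * f + Q)                  ≡⟨ e₃ α Q f ⟩
    Q * (α * suc f)                  ≡⟨ cong (λ x → Q * (α * x)) (sym (cong pred (+-comm f 2))) ⟩
    Q * (α * pred lk)                ∎)
    where
    open ≤-Reasoning
    f = 96 * (d * W) / Q
    e₁ : ∀ Q x → Q * (2 * x) ≡ 2 * (Q * x)
    e₁ = solve-∀
    e₂ : ∀ α d W → 2 * (12 * (4 * α * d * W)) ≡ α * (96 * (d * W))
    e₂ = solve-∀
    e₃ : ∀ α Q f → α * (Q * f + Q) ≡ Q * (α * (1 + f))
    e₃ = solve-∀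

  -- There are about d W X / Q toggle neighbours, and about 96 H d W / Q are required: hence the
  -- hypothesis 96 H < X.
  deg-ok : ∀ u → H * lk ≤ toggleDeg u
  deg-ok u = *-cancelˡ-≤ Q (+-cancelʳ-≤ (2 * E) _ _ (begin
    Q * (H * lk) + 2 * E                           ≡⟨ e₁ Q H f E ⟩
    H * (Q * f) + (2 * (Q * H) + 2 * E)            ≤⟨ +-mono-≤ (*-monoʳ-≤ H (floor-lower (96 * (d * W)) Q)) (+-monoˡ-≤ (2 * E) (*-monoʳ-≤ 2 QH≤E)) ⟩
    H * (96 * (d * W)) + (2 * E + 2 * E)           ≡⟨ e₂ H (d * W) E ⟩
    96 * H * (d * W) + 4 * E                       ≤⟨ +-monoʳ-≤ (96 * H * (d * W)) (multiple≤ 4 (s≤s (s≤s (s≤s (s≤s z≤n))))) ⟩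
    96 * H * (d * W) + d * W                       ≡⟨ +-comm _ (d * W) ⟩
    suc (96 * H) * (d * W)                         ≤⟨ *-monoˡ-≤ (d * W) 96H<X ⟩
    X * (d * W)                                    ≡⟨ e₃ X d W ⟩
    d * (W * X)                                    ≤⟨ toggleDeg-lower u ⟩
    Q * toggleDeg u + 2 * E                        ∎))
    where
    open ≤-Reasoning
    f = 96 * (d * W) / Q
    e₁ : ∀ Q H f E → Q * (H * (f + 2)) + 2 * E ≡ H * (Q * f) + (2 * (Q * H) + 2 * E)
    e₁ = solve-∀
    e₂ : ∀ H x E → H * (96 * x) + (2 * E + 2 * E) ≡ 96 * H * x + 4 * E
    e₂ = solve-∀
    e₃ : ∀ X d W → X * (d * W) ≡ d * (W * X)
    e₃ = solve-∀

  few : ∀ u → ∑ n (λ w → 𝟙 (isR w ∧ near u w)) ≤ θ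
  few u = ≤-floor _ (12 * (n * W)) Q (≤-trans (*-monoʳ-≤ Q (∑-mono n pointwise)) (*-cancelˡ-≤ d (begin
    d * (Q * totalIn a b)                    ≡⟨ e₁ d Q (totalIn a b) ⟩
    Q * (d * totalIn a b)                    ≤⟨ totalIn-upper (b ∸ a) (m+[n∸m]≡n a≤b) (m⊓n≤n _ Q) ⟩
    n * (d * (b ∸ a) + 2 * E)                ≤⟨ *-monoʳ-≤ n (+-mono-≤ (*-monoʳ-≤ d len≤) (multiple≤ 2 (s≤s (s≤s z≤n)))) ⟩
    n * (d * (10 * W + W) + d * W)           ≡⟨ e₂ n d W ⟩
    d * (12 * (n * W))                       ∎)))
    where
    open ≤-Reasoning
    a = lab u ∸ 5 * W
    b = (lab u + 5 * W + 1) ⊓ Q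
    a≤b : a ≤ b
    a≤b = ⊓-glb (≤-trans (m∸n≤m (lab u) (5 * W)) (≤-trans (m≤m+n (lab u) (5 * W)) (m≤m+n _ 1)))
                (≤-trans (m∸n≤m (lab u) (5 * W)) (<⇒≤ (proj₁ balanced u)))
    len≤ : b ∸ a ≤ 10 * W + W
    len≤ = m≤n+o⇒m∸n≤o b a (begin
      b                                      ≤⟨ m⊓n≤m _ Q ⟩
      lab u + 5 * W + 1                      ≤⟨ +-mono-≤ (+-monoˡ-≤ (5 * W) (m≤n+m∸n (lab u) (5 * W))) (>-nonZero⁻¹ W) ⟩
      5 * W + a + 5 * W + W                  ≡⟨ e₃ W a ⟩
      a + (10 * W + W)                       ∎)
      where
      e₃ : ∀ W a → 5 * W + a + 5 * W + W ≡ a + (10 * W + W)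
      e₃ = solve-∀
    pointwise : ∀ w → 𝟙 (isR w ∧ near u w) ≤ inside a b (lab w)
    pointwise w with isR w
    ... | false = z≤n
    ... | true with lab w <ᵇ a | lab w <ᵇ lab u + 5 * W + 1 in eq
    ...   | true  | _     = z≤n
    ...   | false | false = z≤n
    ...   | false | true  = ≤-reflexive (sym (cong 𝟙 (<⇒<ᵇ-true {n = b} (⊓-glb (<ᵇ-true (lab w) (lab u + 5 * W + 1) eq) (proj₁ balanced w)))))
    e₁ : ∀ d Q x → d * (Q * x) ≡ Q * (d * x)
    e₁ = solve-∀
    e₂ : ∀ n d W → n * (d * (10 * W + W) + d * W) ≡ d * (12 * (n * W))
    e₂ = solve-∀

  restNbr : ∀ u → isR u ≡ true → ∃ λ v → isR v ≡ true × adj G u v ≡ true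
  restNbr u _ = from (∑-pos⇒∃ n _ positive)
    where
    open ≤-Reasoning
    positive : 1 ≤ restDeg u
    positive = *-cancelˡ-< Q 0 (restDeg u) (+-cancelʳ-< (2 * E) (Q * 0) _ (begin-strict
      Q * 0 + 2 * E          ≡⟨ cong (_+ 2 * E) (*-zeroʳ Q) ⟩
      2 * E                  <⟨ *-monoˡ-< E {{>-nonZero (≤-trans (>-nonZero⁻¹ Q) Q≤E)}} {2} {3} (s≤s (s≤s (s≤s z≤n))) ⟩
      3 * E                  ≤⟨ multiple≤ 3 (s≤s (s≤s (s≤s z≤n))) ⟩
      d * W                  ≤⟨ *-monoʳ-≤ d (m≤n+m W F) ⟩
      d * (F + W)            ≤⟨ restDeg-lower u ⟩
      Q * restDeg u + 2 * E  ∎))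
    both : ∀ {x z} → (x ∧ z) ≡ true → z ≡ true × x ≡ true
    both {true} h = h , refl
    from : (∃ λ v → 1 ≤ 𝟙 (adj G u v ∧ isRest (k v))) → ∃ λ v → isR v ≡ true × adj G u v ≡ true
    from (v , h) = v , both (𝟙-true h)

  module WithMatching (mt : Fin n → Bool) (par : Fin n → Fin n)
    (par-ok : ∀ u → isR u ≡ true → isR (par u) ≡ true × adj G u (par u) ≡ true × mt (par u) ≡ true)
    (par-par : ∀ u → mt u ≡ true → par (par u) ≡ u) where

    open Process G isA isR α H lk θ ext par near hiding (index)
    open State

    -- Edge weights and weighted degrees

    module Weights (st : State) where

      wt : Fin n → Fin n → ℕ
      wt u v = κ * base (k u) (k v) + (y u v + y v u)
             + α * (𝟙 (isA u ∧ isR v) * c st u v + 𝟙 (isA v ∧ isR u) * c st v u) + fine (e st) u v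

      wt-sym : ∀ u v → wt u v ≡ wt v u
      wt-sym u v = cong₂ _+_ (cong₂ _+_ (cong₂ _+_ (cong (κ *_) (base-sym (k u) (k v))) (+-comm (y u v) (y v u)))
        (cong (α *_) (+-comm (𝟙 (isA u ∧ isR v) * c st u v) _))) (+-comm (𝟙 (link u v) * e st u) _)

      link-core : ∀ u v → isR u ≡ false → link u v ≡ false
      link-core u v ru with par u Fin.≟ v
      ... | yes _ = cong (_∧ isR v) ru
      ... | no _  = refl

      link-core′ : ∀ u v → isR v ≡ false → link u v ≡ false
      link-core′ u v rv with par u Fin.≟ v
      ... | yes _ = trans (cong (isR u ∧_) rv) (∧-zeroʳ (isR u))
      ... | no _  = refl

      fine-core : ∀ u v → isR u ≡ false → fine (e st) u v ≡ 0
      fine-core u v ru = cong₂ (λ b b′ → 𝟙 b * e st u + 𝟙 b′ * e st v) (link-core u v ru) (link-core′ v u ru)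

      fine≤ : ∀ u v → fine (e st) u v ≤ 2 * α
      fine≤ u v = ≤-trans (+-mono-≤ (one (link u v) u) (one (link v u) v)) (≤-reflexive (cong (α +_) (sym (+-identityʳ α))))
        where
        one : ∀ b w → 𝟙 b * e st w ≤ α
        one b w = ≤-trans (*-mono-≤ (𝟙≤1 b) (<⇒≤ (e<α st w))) (≤-reflexive (*-identityˡ α))

      -- In units of κ, what an edge at a rest vertex of level m can carry in any state of the
      -- process. The four summands exclude one another, so the same bound limits the edge weights
      -- and, summed up, the values of rest vertices at all times.
      load : ℕ → Kind → ℕ
      load m kd = base (rest m) kd + bulkSlot kd m + 𝟙 (isToggle kd) + 𝟙 (isRest kd)

      load≤1 : ∀ m kd → load m kd ≤ 1
      load≤1 m (bulk i) = ≤-trans (≤-reflexive (trans (+-identityʳ _) (+-identityʳ _))) one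
        where
        one : 𝟙 (not (i + m <ᵇ F + W)) + 𝟙 (ge (i + m) F ∧ (i + m <ᵇ F + W)) ≤ 1
        one with i + m <ᵇ F + W | ge (i + m) F
        ... | true  | true  = ≤-refl
        ... | true  | false = z≤n
        ... | false | true  = ≤-refl
        ... | false | false = ≤-refl
      load≤1 m (toggle _) = ≤-refl
      load≤1 m (rest _)   = ≤-refl

      y-rest : ∀ u v {m} → k u ≡ rest m → y u v ≡ 0
      y-rest u v eq = y-slot u v (cong (λ kd → slot kd (k v)) eq)

      slot-core : ∀ kd {kd′} → isRest kd′ ≡ false → slot kd kd′ ≡ false
      slot-core (bulk _)   {bulk _}   _ = refl
      slot-core (bulk _)   {toggle _} _ = refl
      slot-core (toggle _) {bulk _}   _ = refl
      slot-core (toggle _) {toggle _} _ = refl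
      slot-core (rest _)   {_}        _ = refl

      y-core : ∀ u v → isR u ≡ false → y v u ≡ 0
      y-core u v ru = y-slot v u (slot-core (k v) ru)

      wt-rest : ∀ u v {m} → k u ≡ rest m → wt u v ≤ κ * load m (k v)
      wt-rest u v {m} ku = by (k v) refl
        where
        open ≤-Reasoning
        ru : isR u ≡ true
        ru = cong isRest ku
        au : isA u ≡ false
        au = cong isToggle ku
        shape : ∀ {kv} → k v ≡ kv → wt u v ≡ κ * base (rest m) kv + y v u + α * (𝟙 (isToggle kv ∧ true) * c st v u) + fine (e st) u v
        shape kv≡ = cong (_+ fine (e st) u v) (cong₂ _+_ (cong₂ _+_ (cong₂ (λ a b → κ * base a b) ku kv≡) (cong (_+ y v u) (y-rest u v ku)))
          (cong (α *_) (cong₂ (λ b b′ → 𝟙 (b ∧ isR v) * c st u v + 𝟙 b′ * c st v u) au (cong₂ (λ a b → isToggle a ∧ b) kv≡ ru))))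
        by : ∀ kv → k v ≡ kv → wt u v ≤ κ * load m (k v)
        by (bulk i) kv = begin
          wt u v                                          ≡⟨ shape kv ⟩
          κ * b + y v u + α * 0 + fine (e st) u v         ≡⟨ cong₂ (λ x z → κ * b + y v u + x + z) (*-zeroʳ α) (trans (fine-sym u v) (fine-core v u (cong isRest kv))) ⟩
          κ * b + y v u + 0 + 0                           ≡⟨ trans (+-identityʳ _) (+-identityʳ _) ⟩
          κ * b + y v u                                   ≤⟨ +-monoʳ-≤ (κ * b) y≤ ⟩
          κ * b + κ * σ                                   ≡⟨ e₁ κ b σ ⟩
          κ * (b + σ + 0 + 0)                             ≡⟨ cong (λ kd → κ * load m kd) (sym kv) ⟩
          κ * load m (k v)                                ∎
          where
          b = base (rest m) (bulk i)
          σ = 𝟙 (slot (bulk i) (rest m))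
          e₁ : ∀ κ b s → κ * b + κ * s ≡ κ * (b + s + 0 + 0)
          e₁ = solve-∀
          y≤ : y v u ≤ κ * σ
          y≤ with slot (bulk i) (rest m) in eq
          ... | true  = ≤-trans (y≤cap v u) (≤-reflexive (trans (cong cap kv) (sym (*-identityʳ κ))))
          ... | false = ≤-trans (≤-reflexive (y-slot v u (trans (cong₂ slot kv ku) eq))) z≤n
          fine-sym : ∀ u v → fine (e st) u v ≡ fine (e st) v u
          fine-sym u v = +-comm (𝟙 (link u v) * e st u) _
        by (toggle i) kv = begin
          wt u v                                          ≡⟨ shape kv ⟩
          κ * 0 + y v u + α * (1 * c st v u) + fine (e st) u v
            ≡⟨ cong₂ (λ x z → x + y v u + α * (1 * c st v u) + z) (*-zeroʳ κ) (trans (+-comm (𝟙 (link u v) * e st u) _) (fine-core v u (cong isRest kv))) ⟩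
          0 + y v u + α * (1 * c st v u) + 0              ≡⟨ +-identityʳ _ ⟩
          y v u + α * (1 * c st v u)                      ≤⟨ +-mono-≤ (≤-trans (y≤cap v u) (≤-reflexive (cong cap kv))) (*-monoʳ-≤ α (*-monoʳ-≤ 1 (c≤2 st v u))) ⟩
          2 * α + α * (1 * 2)                             ≡⟨ e₁ α ⟩
          4 * α * (0 + 0 + 1 + 0)                         ≡⟨ cong (λ kd → κ * load m kd) (sym kv) ⟩
          κ * load m (k v)                                ∎
          where
          e₁ : ∀ α → 2 * α + α * (1 * 2) ≡ 4 * α * (0 + 0 + 1 + 0)
          e₁ = solve-∀
        by (rest i) kv = begin
          wt u v                                          ≡⟨ shape kv ⟩
          κ * 0 + y v u + α * 0 + fine (e st) u v         ≡⟨ cong₂ (λ x z → x + y v u + z + fine (e st) u v) (*-zeroʳ κ) (*-zeroʳ α) ⟩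
          y v u + 0 + fine (e st) u v                     ≡⟨ cong (λ x → x + 0 + fine (e st) u v) (y-rest v u kv) ⟩
          fine (e st) u v                                 ≤⟨ fine≤ u v ⟩
          2 * α                                           ≤⟨ m≤m+n (2 * α) (2 * α) ⟩
          2 * α + 2 * α                                   ≡⟨ e₁ α ⟩
          4 * α * (0 + 0 + 0 + 1)                         ≡⟨ cong (λ kd → κ * load m kd) (sym kv) ⟩
          κ * load m (k v)                                ∎
          where
          e₁ : ∀ α → 2 * α + 2 * α ≡ 4 * α * (0 + 0 + 0 + 1)
          e₁ = solve-∀

      wt-core : ∀ u v → isR u ≡ false → isR v ≡ false → wt u v ≡ κ * base (k u) (k v)
      wt-core u v ru rv = begin
        wt u v
          ≡⟨ cong₂ _+_ (cong₂ (λ a b → κ * base (k u) (k v) + a + α * b) (cong₂ _+_ (y-core v u rv) (y-core u v ru))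
               (cong₂ (λ b b′ → 𝟙 b * c st u v + 𝟙 b′ * c st v u) (∧-no (isA u) rv) (∧-no (isA v) ru))) (fine-core u v ru) ⟩
        κ * base (k u) (k v) + 0 + α * 0 + 0  ≡⟨ e₁ (κ * base (k u) (k v)) α ⟩
        κ * base (k u) (k v)                  ∎
        where
        open ≡-Reasoning
        e₁ : ∀ x α → x + 0 + α * 0 + 0 ≡ x
        e₁ = solve-∀
        ∧-no : ∀ a {b} → b ≡ false → a ∧ b ≡ false
        ∧-no a refl = ∧-zeroʳ a

      base≤1 : ∀ kd kd′ → base kd kd′ ≤ 1
      base≤1 (bulk i)   (bulk j)   = 𝟙≤1 (ge (i + j) F)
      base≤1 (bulk i)   (toggle j) = 𝟙≤1 (ge (i + j) F)
      base≤1 (bulk i)   (rest m)   = 𝟙≤1 (ge (i + m) (F + W))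
      base≤1 (toggle i) (bulk j)   = 𝟙≤1 (ge (i + j) F)
      base≤1 (toggle i) (toggle j) = 𝟙≤1 (ge (i + j) F)
      base≤1 (toggle i) (rest m)   = z≤n
      base≤1 (rest m)   (bulk i)   = 𝟙≤1 (ge (i + m) (F + W))
      base≤1 (rest m)   (toggle i) = z≤n
      base≤1 (rest m)   (rest i)   = z≤n

      isRest-inv : ∀ kd → isRest kd ≡ true → ∃ λ m → kd ≡ rest m
      isRest-inv (rest m) _ = m , refl

      wt≤κ : ∀ u v → wt u v ≤ κ
      wt≤κ u v = by (isR u) (isR v) refl refl
        where
        κ1 : κ * 1 ≡ κ
        κ1 = *-identityʳ κ
        resting : ∀ u v → isR u ≡ true → wt u v ≤ κ
        resting u v ru = ≤-trans (wt-rest u v (proj₂ (isRest-inv (k u) ru)))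
          (≤-trans (*-monoʳ-≤ κ (load≤1 (proj₁ (isRest-inv (k u) ru)) (k v))) (≤-reflexive κ1))
        by : ∀ b b′ → isR u ≡ b → isR v ≡ b′ → wt u v ≤ κ
        by true  _     ru _  = resting u v ru
        by false true  _  rv = ≤-trans (≤-reflexive (wt-sym u v)) (resting v u rv)
        by false false ru rv = ≤-trans (≤-reflexive (wt-core u v ru rv)) (≤-trans (*-monoʳ-≤ κ (base≤1 (k u) (k v))) (≤-reflexive κ1))

      total : Fin n → ℕ
      total u = ∑ n (λ v → 𝟙 (adj G u v) * wt u v)

      own across lent borrowed : Fin n → ℕ
      own u      = ∑ n (λ v → 𝟙 (adj G u v) * y u v)
      across u   = ∑ n (λ v → 𝟙 (adj G u v) * y v u)
      lent u     = ∑ n (λ v → 𝟙 (adj G u v) * (𝟙 (isA u ∧ isR v) * c st u v))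
      borrowed u = ∑ n (λ v → 𝟙 (adj G u v) * (𝟙 (isA v ∧ isR u) * c st v u))

      total-split : ∀ u → total u ≡ κ * baseCount (k u) u + (own u + across u) + α * (lent u + borrowed u) + fineSum (e st) u
      total-split u = begin
        total u
          ≡⟨ ∑-cong n (λ v → e₁ (𝟙 (adj G u v)) κ (base (k u) (k v)) (y u v) (y v u) α
               (𝟙 (isA u ∧ isR v) * c st u v) (𝟙 (isA v ∧ isR u) * c st v u) (fine (e st) u v)) ⟩
        ∑ n (λ v → κ * (𝟙 (adj G u v) * base (k u) (k v)) + (𝟙 (adj G u v) * y u v + 𝟙 (adj G u v) * y v u)
                 + α * (𝟙 (adj G u v) * (𝟙 (isA u ∧ isR v) * c st u v) + 𝟙 (adj G u v) * (𝟙 (isA v ∧ isR u) * c st v u))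
                 + 𝟙 (adj G u v) * fine (e st) u v)
          ≡⟨ trans (∑-distrib-+ n _ _) (cong (_+ fineSum (e st) u) (trans (∑-distrib-+ n _ _)
               (cong₂ _+_ (trans (∑-distrib-+ n _ _) (cong₂ _+_ (∑-*ˡ n κ _) (∑-distrib-+ n _ _)))
                          (trans (∑-*ˡ n α _) (cong (α *_) (∑-distrib-+ n _ _)))))) ⟩
        κ * baseCount (k u) u + (own u + across u) + α * (lent u + borrowed u) + fineSum (e st) u ∎
        where
        open ≡-Reasoning
        e₁ : ∀ a κ b y z α p q f → a * (κ * b + (y + z) + α * (p + q) + f)
             ≡ κ * (a * b) + (a * y + a * z) + α * (a * p + a * q) + a * f
        e₁ = solve-∀

      vanish : ∀ u (g : Fin n → ℕ) → (∀ v → g v ≡ 0) → ∑ n (λ v → 𝟙 (adj G u v) * g v) ≡ 0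
      vanish u g h = ≡0⇒∑≡0 n (λ v → trans (cong (𝟙 (adj G u v) *_) (h v)) (*-zeroʳ (𝟙 (adj G u v))))

      total-rest : ∀ u {m} → k u ≡ rest m → total u ≡ val st u
      total-rest u {m} ku = begin
        total u                                            ≡⟨ total-split u ⟩
        κ * bc + (own u + across u) + α * (lent u + borrowed u) + φ
          ≡⟨ cong₂ (λ a b → κ * bc + a + α * b + φ) (cong (_+ across u) (vanish u _ (λ v → y-rest u v ku)))
               (cong₂ _+_ (vanish u _ (λ v → cong (λ b → 𝟙 (b ∧ isR v) * c st u v) (cong isToggle ku))) borrowed≡) ⟩
        κ * bc + (0 + across u) + α * (0 + coarse (c st) u) + φ  ≡⟨ e₁ (κ * bc) (across u) α (coarse (c st) u) φ ⟩
        κ * bc + across u + φ + α * coarse (c st) u        ∎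
        where
        open ≡-Reasoning
        bc = baseCount (k u) u
        φ = fineSum (e st) u
        e₁ : ∀ a b α x f → a + (0 + b) + α * (0 + x) + f ≡ a + b + f + α * x
        e₁ = solve-∀
        borrowed≡ : borrowed u ≡ coarse (c st) u
        borrowed≡ = ∑-cong n (λ v → trans (cong (λ b → 𝟙 (adj G u v) * (𝟙 b * c st v u)) (trans (cong (isA v ∧_) (cong isRest ku)) (∧-identityʳ (isA v))))
                      (trans (sym (*-assoc (𝟙 (adj G u v)) _ _)) (cong (_* c st v u) (sym (𝟙-∧ (adj G u v) (isA v))))))

      core-split : ∀ u → isR u ≡ false → total u ≡ κ * baseCount (k u) u + own u + α * lent u
      core-split u ru = begin
        total u                                            ≡⟨ total-split u ⟩
        κ * bc + (own u + across u) + α * (lent u + borrowed u) + fineSum (e st) u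
          ≡⟨ cong₂ _+_ (cong₂ (λ a b → κ * bc + (own u + a) + α * (lent u + b))
               (vanish u _ (λ v → y-core u v ru))
               (vanish u _ (λ v → cong (λ b → 𝟙 b * c st v u) (trans (cong (isA v ∧_) ru) (∧-zeroʳ (isA v))))))
               (vanish u _ (λ v → fine-core u v ru)) ⟩
        κ * bc + (own u + 0) + α * (lent u + 0) + 0        ≡⟨ e₁ (κ * bc) (own u) α (lent u) ⟩
        κ * bc + own u + α * lent u                        ∎
        where
        open ≡-Reasoning
        bc = baseCount (k u) u
        e₁ : ∀ a b α x → a + (b + 0) + α * (x + 0) + 0 ≡ a + b + α * x
        e₁ = solve-∀

      total-bulk : ∀ u {i} → k u ≡ bulk i → total u ≡ posB (zB u)
      total-bulk u {i} ku = begin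
        total u                                            ≡⟨ core-split u (cong isRest ku) ⟩
        κ * bc + own u + α * lent u
          ≡⟨ cong (λ x → κ * bc + own u + α * x) (vanish u _ (λ v → cong (λ b → 𝟙 (b ∧ isR v) * c st u v) (cong isToggle ku))) ⟩
        κ * bc + own u + α * 0                             ≡⟨ trans (cong (κ * bc + own u +_) (*-zeroʳ α)) (+-identityʳ _) ⟩
        κ * bc + own u                                     ≡⟨ cong (_+ own u) (fixed≡ ku) ⟩
        fixed (k u) u + own u                              ≡⟨ y-sum u ⟩
        target (k u) u                                     ≡⟨ cong (λ kd → target kd u) ku ⟩
        posB (zB u)                                        ∎
        where
        open ≡-Reasoning
        bc = baseCount (k u) u
        fixed≡ : ∀ {kd} → kd ≡ bulk i → κ * baseCount kd u ≡ fixed kd u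
        fixed≡ refl = refl

      total-toggle : ∀ u {i} → k u ≡ toggle i → total u ≡ posA (zA u) + α * s st u
      total-toggle u {i} ku = begin
        total u                                            ≡⟨ core-split u (cong isRest ku) ⟩
        κ * bc + own u + α * lent u                        ≡⟨ cong (λ x → κ * bc + own u + α * x) lent≡ ⟩
        κ * bc + own u + α * (restDeg u + s st u)          ≡⟨ e₁ (κ * bc) (own u) α (restDeg u) (s st u) ⟩
        κ * bc + α * restDeg u + own u + α * s st u        ≡⟨ cong (λ x → x + own u + α * s st u) (fixed≡ ku) ⟩
        fixed (k u) u + own u + α * s st u                 ≡⟨ cong (_+ α * s st u) (y-sum u) ⟩
        target (k u) u + α * s st u                        ≡⟨ cong (λ kd → target kd u + α * s st u) ku ⟩
        posA (zA u) + α * s st u                           ∎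
        where
        open ≡-Reasoning
        bc = baseCount (k u) u
        e₁ : ∀ a b α r s → a + b + α * (r + s) ≡ a + α * r + b + α * s
        e₁ = solve-∀
        fixed≡ : ∀ {kd} → kd ≡ toggle i → κ * baseCount kd u + α * restDeg u ≡ fixed kd u
        fixed≡ refl = refl
        lent≡ : lent u ≡ restDeg u + s st u
        lent≡ = trans (∑-cong n (λ v → trans (cong (λ b → 𝟙 (adj G u v) * (𝟙 (b ∧ isR v) * c st u v)) (cong isToggle ku))
                  (trans (sym (*-assoc (𝟙 (adj G u v)) _ _)) (cong (_* c st u v) (sym (𝟙-∧ (adj G u v) (isR v)))))))
                  (bal st u (cong isToggle ku))

      total-upper : ∀ u {m} → k u ≡ rest m → Q * total u ≤ κ * (d * (m * X) + d * (2 * F + W) + 6 * E)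
      total-upper u {m} ku = begin
        Q * total u
          ≤⟨ *-monoʳ-≤ Q (∑-mono n (λ v → *-monoʳ-≤ (𝟙 (adj G u v)) (wt-rest u v ku))) ⟩
        Q * ∑ n (λ v → 𝟙 (adj G u v) * (κ * load m (k v)))
          ≡⟨ cong (Q *_) (trans (∑-cong n (λ v → e₁ (𝟙 (adj G u v)) κ (b v) (𝟙 (isA v)) (𝟙 (isR v))))
               (trans (∑-*ˡ n κ _) (cong (κ *_) (trans (∑-distrib-+ n _ _) (cong₂ _+_ (∑-distrib-+ n _ _) refl))))) ⟩
        Q * (κ * (∑ n (λ v → 𝟙 (adj G u v) * b v) + ∑ n (λ v → 𝟙 (adj G u v) * 𝟙 (isA v)) + ∑ n (λ v → 𝟙 (adj G u v) * 𝟙 (isR v))))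
          ≡⟨ cong₂ (λ x z → Q * (κ * (∑ n (λ v → 𝟙 (adj G u v) * b v) + x + z)))
               (∑-cong n (λ v → sym (𝟙-∧ (adj G u v) (isA v)))) (∑-cong n (λ v → sym (𝟙-∧ (adj G u v) (isR v)))) ⟩
        Q * (κ * (∑ n (λ v → 𝟙 (adj G u v) * b v) + toggleDeg u + restDeg u))
          ≤⟨ *-monoʳ-≤ Q (*-monoʳ-≤ κ (+-monoˡ-≤ (restDeg u) (+-monoˡ-≤ (toggleDeg u) (∑-mono n (λ v → *-monoʳ-≤ (𝟙 (adj G u v)) (rest-upper m (viewOf v))))))) ⟩
        Q * (κ * (I + toggleDeg u + restDeg u))
          ≡⟨ e₂ Q κ I (toggleDeg u) (restDeg u) ⟩
        κ * (Q * I + Q * toggleDeg u + Q * restDeg u)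
          ≤⟨ *-monoʳ-≤ κ (+-mono-≤ (+-mono-≤ I≤ (toggleDeg-upper u)) (restDeg-upper u)) ⟩
        κ * (d * (m * X) + 2 * E + (d * F + 2 * E) + (d * (F + W) + 2 * E))
          ≡⟨ cong (κ *_) (e₃ (d * (m * X)) d F W E) ⟩
        κ * (d * (m * X) + d * (2 * F + W) + 6 * E) ∎
        where
        open ≤-Reasoning
        b : Fin n → ℕ
        b v = base (rest m) (k v) + bulkSlot (k v) m
        I = nbrsIn u ((F ∸ m) * X) FX
        len = (F ∸ (F ∸ m)) * X
        len≡ : (F ∸ m) * X + len ≡ FX
        len≡ = trans (sym (*-distribʳ-+ X (F ∸ m) (F ∸ (F ∸ m)))) (cong (_* X) (m+[n∸m]≡n (m∸n≤m F m)))
        len≤ : F ∸ (F ∸ m) ≤ m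
        len≤ = m≤n+o⇒m∸n≤o F (F ∸ m) (subst (F ≤_) (+-comm m (F ∸ m)) (m≤n+m∸n F m))
        I≤ : Q * I ≤ d * (m * X) + 2 * E
        I≤ = ≤-trans (nbrsIn-upper u len len≡ FX≤Q) (+-monoˡ-≤ (2 * E) (*-monoʳ-≤ d (*-monoˡ-≤ X len≤)))
        e₁ : ∀ a κ b p q → a * (κ * (b + p + q)) ≡ κ * (a * b + a * p + a * q)
        e₁ = solve-∀
        e₂ : ∀ Q κ a b c → Q * (κ * (a + b + c)) ≡ κ * (Q * a + Q * b + Q * c)
        e₂ = solve-∀
        e₃ : ∀ x d F W E → x + 2 * E + (d * F + 2 * E) + (d * (F + W) + 2 * E) ≡ x + d * (2 * F + W) + 6 * E
        e₃ = solve-∀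

      total-lower : ∀ u {m} → k u ≡ rest m → m < F + W → κ * (d * (m * X)) ≤ Q * total u + κ * (d * (W * X) + 2 * E)
      total-lower u {m} ku m< with m <? W
      -- Below level W no bulk level reaches the threshold F + W; there the slack d W X alone
      -- exceeds the left side.
      ... | yes m<W = ≤-trans (*-monoʳ-≤ κ (≤-trans (*-monoʳ-≤ d (*-monoˡ-≤ X (<⇒≤ m<W))) (m≤m+n _ (2 * E)))) (m≤n+m _ (Q * total u))
      ... | no m≮W = begin
        κ * (d * (m * X))                                      ≡⟨ cong (λ x → κ * (d * (x * X))) (sym W+m′) ⟩
        κ * (d * ((W + m′) * X))                               ≡⟨ e₁ κ d W m′ X ⟩
        κ * (d * (m′ * X)) + κ * (d * (W * X))                 ≤⟨ +-monoˡ-≤ _ (*-monoʳ-≤ κ (nbrsIn-lower u (m′ * X) len≡ FX≤Q)) ⟩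
        κ * (Q * I + 2 * E) + κ * (d * (W * X))                ≤⟨ +-monoˡ-≤ _ (*-monoʳ-≤ κ (+-monoˡ-≤ (2 * E) (*-monoʳ-≤ Q I≤))) ⟩
        κ * (Q * baseCount (rest m) u + 2 * E) + κ * (d * (W * X)) ≡⟨ e₂ κ Q (baseCount (rest m) u) E (d * (W * X)) ⟩
        Q * (κ * baseCount (rest m) u) + κ * (d * (W * X) + 2 * E) ≤⟨ +-monoˡ-≤ _ (*-monoʳ-≤ Q base≤) ⟩
        Q * total u + κ * (d * (W * X) + 2 * E)                ∎
        where
        open ≤-Reasoning
        m′ = m ∸ W
        W+m′ : W + m′ ≡ m
        W+m′ = m+[n∸m]≡n (≮⇒≥ m≮W)
        m′≤F : m′ ≤ F
        m′≤F = m≤n+o⇒m∸n≤o m W (subst (m ≤_) (+-comm F W) (<⇒≤ m<))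
        m̄ = F ∸ m′
        m̄≡ : m′ + m̄ ≡ F
        m̄≡ = m+[n∸m]≡n m′≤F
        I = nbrsIn u (m̄ * X) FX
        len≡ : m̄ * X + m′ * X ≡ FX
        len≡ = trans (sym (*-distribʳ-+ X m̄ m′)) (cong (_* X) (trans (+-comm m̄ m′) m̄≡))
        I≤ : I ≤ baseCount (rest m) u
        I≤ = ∑-mono n (λ v → *-monoʳ-≤ (𝟙 (adj G u v)) (subst (λ x → inside (m̄ * X) FX (lab v) ≤ base (rest x) (k v)) W+m′ (rest-lower m′ m̄ m̄≡ (viewOf v))))
        base≤ : κ * baseCount (rest m) u ≤ total u
        base≤ = ≤-trans (≤-reflexive (cong (λ kd → κ * baseCount kd u) (sym ku)))
          (≤-trans (m≤m+n _ _) (≤-trans (m≤m+n _ _) (≤-trans (m≤m+n _ _) (≤-reflexive (sym (total-split u))))))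
        e₁ : ∀ κ d W m X → κ * (d * ((W + m) * X)) ≡ κ * (d * (m * X)) + κ * (d * (W * X))
        e₁ = solve-∀
        e₂ : ∀ κ Q b E w → κ * (Q * b + 2 * E) + κ * w ≡ Q * (κ * b) + κ * (w + 2 * E)
        e₂ = solve-∀

      -- The upper and lower bounds for a given level differ by 3 W X + W in units of κ d, plus 8 E,
      -- which is at most d W. This is at most 5 W X, the growth over 5 W levels, and explains the
      -- window 5 W in `near`.
      close : ∀ u w {m m′} → k u ≡ rest m → k w ≡ rest m′ → m < F + W → total u ≡ total w → m ≤ m′ + 5 * W
      close u w {m} {m′} ku kw m< eq = *-cancelˡ-≤ (κ * (d * X)) {{m*n≢0 κ (d * X) {{m*n≢0 4 α}} {{m*n≢0 d X}}}} (begin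
        κ * (d * X) * m                                              ≡⟨ e₁ κ d X m ⟩
        κ * (d * (m * X))                                            ≤⟨ total-lower u ku m< ⟩
        Q * total u + κ * (d * (W * X) + 2 * E)                      ≤⟨ +-monoˡ-≤ _ (≤-trans (≤-reflexive (cong (Q *_) eq)) (total-upper w kw)) ⟩
        κ * (d * (m′ * X) + d * (2 * (W * X) + W) + 6 * E) + κ * (d * (W * X) + 2 * E) ≡⟨ e₂ κ d m′ X W E ⟩
        κ * (d * (m′ * X) + d * (3 * (W * X) + W) + 8 * E)           ≤⟨ *-monoʳ-≤ κ (+-monoʳ-≤ _ (multiple≤ 8 (s≤s (s≤s (s≤s (s≤s (s≤s (s≤s (s≤s (s≤s z≤n)))))))))) ⟩
        κ * (d * (m′ * X) + d * (3 * (W * X) + W) + d * W)           ≡⟨ e₃ κ d m′ X W ⟩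
        κ * (d * (m′ * X) + d * (3 * (W * X) + 2 * W))               ≤⟨ *-monoʳ-≤ κ (+-monoʳ-≤ (d * (m′ * X)) (*-monoʳ-≤ d (+-monoʳ-≤ (3 * (W * X)) (*-monoʳ-≤ 2 (m≤m*n W X))))) ⟩
        κ * (d * (m′ * X) + d * (3 * (W * X) + 2 * (W * X)))         ≡⟨ e₄ κ d m′ X W ⟩
        κ * (d * X) * (m′ + 5 * W)                                   ∎)
        where
        open ≤-Reasoning
        e₁ : ∀ κ d X m → κ * (d * X) * m ≡ κ * (d * (m * X))
        e₁ = solve-∀
        e₂ : ∀ κ d m X W E → κ * (d * (m * X) + d * (2 * (W * X) + W) + 6 * E) + κ * (d * (W * X) + 2 * E)
             ≡ κ * (d * (m * X) + d * (3 * (W * X) + W) + 8 * E)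
        e₂ = solve-∀
        e₃ : ∀ κ d m X W → κ * (d * (m * X) + d * (3 * (W * X) + W) + d * W) ≡ κ * (d * (m * X) + d * (3 * (W * X) + 2 * W))
        e₃ = solve-∀
        e₄ : ∀ κ d m X W → κ * (d * (m * X) + d * (3 * (W * X) + 2 * (W * X))) ≡ κ * (d * X) * (m + 5 * W)
        e₄ = solve-∀

    open Weights

    restView : ∀ u {kd} → View (lab u) kd → isRest kd ≡ true → ∃ λ m → kd ≡ rest m × m < F + W × lab u ≡ FXF + m
    restView u (rest m m< ℓ≡) _ = m , refl , m< , ℓ≡

    window : ∀ st u w → isR u ≡ true → isR w ≡ true → val st u ≡ val st w → near u w ≡ true
    window st u w ru rw eq = from (restView u (viewOf u) ru) (restView w (viewOf w) rw)
      where
      from : (∃ λ m → k u ≡ rest m × m < F + W × lab u ≡ FXF + m) → (∃ λ m → k w ≡ rest m × m < F + W × lab w ≡ FXF + m) → near u w ≡ true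
      from (m , ku , m< , ℓu) (m′ , kw , m′< , ℓw) = cong₂ (λ a b → not a ∧ b) (≤⇒<ᵇ-false lower) (<⇒<ᵇ-true upper)
        where
        open ≤-Reasoning
        eq′ : total st u ≡ total st w
        eq′ = trans (total-rest st u ku) (trans eq (sym (total-rest st w kw)))
        lower : lab u ∸ 5 * W ≤ lab w
        lower = m≤n+o⇒m∸n≤o (lab u) (5 * W) (begin
          lab u                    ≡⟨ ℓu ⟩
          FXF + m                  ≤⟨ +-monoʳ-≤ FXF (close st u w ku kw m< eq′) ⟩
          FXF + (m′ + 5 * W)       ≡⟨ trans (sym (+-assoc FXF m′ (5 * W))) (cong (_+ 5 * W) (sym ℓw)) ⟩
          lab w + 5 * W            ≡⟨ +-comm (lab w) (5 * W) ⟩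
          5 * W + lab w            ∎)
        upper : lab w < lab u + 5 * W + 1
        upper = begin-strict
          lab w                    ≡⟨ ℓw ⟩
          FXF + m′                 ≤⟨ +-monoʳ-≤ FXF (close st w u kw ku m′< (sym eq′)) ⟩
          FXF + (m + 5 * W)        ≡⟨ trans (sym (+-assoc FXF m (5 * W))) (cong (_+ 5 * W) (sym ℓu)) ⟩
          lab u + 5 * W            <⟨ m<m+n (lab u + 5 * W) (s≤s z≤n) ⟩
          lab u + 5 * W + 1        ∎

    module _ (st : State) (hole : ∀ u → isR u ≡ true → index (val st u) ≡ 0)
      (distinct : ∀ u w → isR u ≡ true → isR w ≡ true → val st u ≡ val st w → u ≡ w) where

      total-injective : ∀ u v → total st u ≡ total st v → u ≡ v
      total-injective u v eq = by (viewOf u) (viewOf v) refl refl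
        where
        contra : ∀ {x y} → x ≢ y → index (total st u) ≡ x → index (total st v) ≡ y → u ≡ v
        contra x≢y ix iy = contradiction (trans (sym ix) (trans (cong index eq) iy)) x≢y
        ixB : ∀ w {i} → k w ≡ bulk i → 3 ≤ index (total st w)
        ixB w kw = subst (3 ≤_) (cong index (sym (total-bulk st w kw))) (posB-index (zB w))
        ixA : ∀ w {i} → k w ≡ toggle i → index (total st w) ≡ suc (s st w)
        ixA w kw = trans (cong index (total-toggle st w kw)) (posA-index (zA w) (s st w) (s≤1 st w))
        ixR : ∀ w {m} → k w ≡ rest m → index (total st w) ≡ 0
        ixR w kw = trans (cong index (total-rest st w kw)) (hole w (cong isRest kw))
        big : ∀ {x w} → x ≤ 2 → 3 ≤ index (total st w) → index (total st w) ≢ x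
        big x≤2 3≤ refl = contradiction x≤2 (<⇒≱ 3≤)
        by : ∀ {ku kv} → View (lab u) ku → View (lab v) kv → k u ≡ ku → k v ≡ kv → u ≡ v
        by (bulk _ _ _ _ _) (bulk _ _ _ _ _) ku kv =
          zB-injective u v (posB-injective _ _ (trans (sym (total-bulk st u ku)) (trans eq (total-bulk st v kv))))
        by (bulk _ _ _ _ _) (toggle _ _ _) ku kv = contra (big {w = u} (s≤s (s≤1 st v)) (ixB u ku)) refl (ixA v kv)
        by (bulk _ _ _ _ _) (rest _ _ _)   ku kv = contra (big {w = u} z≤n (ixB u ku)) refl (ixR v kv)
        by (toggle _ _ _) (bulk _ _ _ _ _) ku kv = contra (big {w = v} (s≤s (s≤1 st u)) (ixB v kv) ∘ sym) (ixA u ku) refl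
        by (toggle _ _ ℓu) (toggle _ _ ℓv) ku kv =
          zA-injective u v (subst (FX ≤_) (sym ℓu) (m≤m+n FX _)) (subst (FX ≤_) (sym ℓv) (m≤m+n FX _))
            (posA-injective (zA u) (s st u) (zA v) (s st v) (s≤1 st u) (s≤1 st v)
              (trans (sym (total-toggle st u ku)) (trans eq (total-toggle st v kv))))
        by (toggle _ _ _) (rest _ _ _)     ku kv = contra (λ ()) (ixA u ku) (ixR v kv)
        by (rest _ _ _) (bulk _ _ _ _ _)   ku kv = contra (big {w = v} z≤n (ixB v kv) ∘ sym) (ixR u ku) refl
        by (rest _ _ _) (toggle _ _ _)     ku kv = contra (λ ()) (ixR u ku) (ixA v kv)
        by (rest _ _ _) (rest _ _ _)       ku kv = distinct u v (cong isRest ku) (cong isRest kv)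
          (trans (sym (total-rest st u ku)) (trans eq (total-rest st v kv)))

      -- Raising every weight by 1 makes it positive and, by regularity, shifts all weighted degrees
      -- by the same d.
      weighting : Weighting G (suc κ)
      weighting = record
        { w     = λ u v → suc (wt st u v)
        ; w-sym = λ u v _ → cong suc (wt-sym st u v)
        ; w-pos = λ _ _ _ → s≤s z≤n
        ; w-le  = λ u v _ → s≤s (wt≤κ st u v) }

      wdeg≡ : ∀ u → wdeg weighting u ≡ d + total st u
      wdeg≡ u = trans (∑-cong n pointwise) (trans (∑-distrib-+ n _ _) (cong (_+ total st u) (reg u)))
        where
        pointwise : ∀ v → (if adj G u v then suc (wt st u v) else 0) ≡ 𝟙 (adj G u v) + 𝟙 (adj G u v) * wt st u v
        pointwise v with adj G u v
        ... | true  = cong suc (sym (*-identityˡ _))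
        ... | false = refl

      irregular : Irregular weighting
      irregular u v u≢v eq = u≢v (total-injective u v (+-cancelˡ-≡ d _ _ (trans (sym (wdeg≡ u)) (trans eq (wdeg≡ v)))))

    hasIrregular : HasIrregularWeighting G (suc κ)
    hasIrregular = from (Run.run (λ u _ → deg-ok u) window (λ u _ → few u) 2θ<αlk mt par-ok par-par (allFin n) ∈-allFin)
      where
      from : (∃ λ (st : State) → (∀ u → isR u ≡ true → index (val st u) ≡ 0)
                × (∀ u w → isR u ≡ true → isR w ≡ true → val st u ≡ val st w → u ≡ w)) → HasIrregularWeighting G (suc κ)
      from (st , hole , distinct) = weighting st hole distinct , irregular st hole distinct

  hasIrregularWeighting : HasIrregularWeighting G (suc (4 * α))
  hasIrregularWeighting = from (Matching.maximalMatching G isR restNbr)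
    where
    from : (∃ λ (mt : Fin n → Bool) → ∃ λ (par : Fin n → Fin n) →
      (∀ u → isR u ≡ true → isR (par u) ≡ true × adj G u (par u) ≡ true × mt (par u) ≡ true) ×
      (∀ u → mt u ≡ true → par (par u) ≡ u)) → HasIrregularWeighting G (suc (4 * α))
    from (mt , par , par-ok , par-par) = WithMatching.hasIrregular mt par par-ok par-par

-- Choice of parameters

integerRoot : ∀ e → 1 ≤ e → ∀ d → ∃ λ h → h ^ e ≤ d × d < suc h ^ e
integerRoot e@(suc _) _ zero = 0 , z≤n , ^-pos 1 e ≤-refl
integerRoot e 1≤e (suc d) with integerRoot e 1≤e d
... | h , lo , hi with suc h ^ e ≤? suc d
...   | yes p = suc h , p , ≤-<-trans hi (^-monoˡ-< e {{>-nonZero 1≤e}} (n<1+n (suc h)))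
...   | no ¬p = h , m≤n⇒m≤1+n lo , ≰⇒> ¬p

root-mono : ∀ e a h {d} → a ^ e ≤ d → d < suc h ^ e → a ≤ h
root-mono e a h lo hi with a ≤? h
... | yes p = p
... | no ¬p = contradiction (≤-trans (^-monoˡ-≤ e (≰⇒> ¬p)) lo) (<⇒≱ hi)

suc≤2^ : ∀ a → suc a ≤ 2 ^ a
suc≤2^ zero    = ≤-refl
suc≤2^ (suc a) = begin
  suc (suc a)         ≤⟨ +-mono-≤ (m^n>0 2 a) (suc≤2^ a) ⟩
  2 ^ a + 2 ^ a       ≡⟨ cong (2 ^ a +_) (sym (+-identityʳ (2 ^ a))) ⟩
  2 * 2 ^ a           ∎
  where open ≤-Reasoning

-- With a = h / E one has h ≤ E (a + 1), and a + 1 ≤ 2^a.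
power≤exp : ∀ E {{_ : NonZero E}} h → h ^ E ≤ E ^ E * 2 ^ h
power≤exp E h = begin
  h ^ E                        ≤⟨ ^-monoˡ-≤ E h≤ ⟩
  (E * suc a) ^ E              ≡⟨ ^-distribʳ-* E E (suc a) ⟩
  E ^ E * suc a ^ E            ≤⟨ *-monoʳ-≤ (E ^ E) (^-monoˡ-≤ E (suc≤2^ a)) ⟩
  E ^ E * (2 ^ a) ^ E          ≡⟨ cong (E ^ E *_) (^-*-assoc 2 a E) ⟩
  E ^ E * 2 ^ (a * E)          ≤⟨ *-monoʳ-≤ (E ^ E) (^-monoʳ-≤ 2 (m/n*n≤m h E)) ⟩
  E ^ E * 2 ^ h                ∎
  where
  open ≤-Reasoning
  a = h / E
  h≤ : h ≤ E * suc a
  h≤ = ≤-trans (floor-upper h E) (≤-reflexive (trans (+-comm (E * a) E) (sym (*-suc E a))))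

-- `power≤exp` with exponent E + 1 at h + 1; the surplus factor h + 1 pays for the constant.
exp-beats-power : ∀ E h → 32 * suc E ^ suc E ≤ h → 16 * suc h ^ E ≤ 2 ^ h
exp-beats-power E h large = *-cancelˡ-≤ (2 * C) {{>-nonZero (≤-trans 1≤C (m≤n*m C 2))}} (begin
  2 * C * (16 * suc h ^ E)      ≡⟨ e₁ C (suc h ^ E) ⟩
  32 * C * suc h ^ E            ≤⟨ *-monoˡ-≤ (suc h ^ E) (m≤n⇒m≤1+n large) ⟩
  suc h * suc h ^ E             ≤⟨ power≤exp (suc E) (suc h) ⟩
  C * (2 * 2 ^ h)               ≡⟨ e₂ C (2 ^ h) ⟩
  2 * C * 2 ^ h                 ∎)
  where
  open ≤-Reasoning
  C = suc E ^ suc E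
  1≤C : 1 ≤ C
  1≤C = m^n>0 (suc E) (suc E)
  e₁ : ∀ C x → 2 * C * (16 * x) ≡ 32 * C * x
  e₁ = solve-∀
  e₂ : ∀ C x → C * (2 * x) ≡ 2 * C * x
  e₂ = solve-∀

labelCount≡ : ∀ W X → labelCount W X ≡ W * (suc X * suc X)
labelCount≡ = e
  where
  e : ∀ W X → W * X * X + W * X + (W * X + W) ≡ W * ((1 + X) * (1 + X))
  e = solve-∀

-- Chosen so that with R = d / D the term 37 E, which is 74 h (X + 1)² R (X + 2), is at most (X + 2)
-- d, half of d W.
denominator : ℕ → ℕ → ℕ
denominator h T = 74 * (h * (suc (96 * (3 + T) + 1) * suc (96 * (3 + T) + 1)))

module Parameters (h T d : ℕ) (1≤h : 1 ≤ h) (3≤T : 3 ≤ T) where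

  X W D R t : ℕ
  X = 96 * (3 + T) + 1
  W = 2 * (X + 2)
  D = denominator h T

  instance
    D≢0 : NonZero D
    D≢0 = m*n≢0 74 (h * (suc X * suc X)) {{_}} {{m*n≢0 h (suc X * suc X) {{>-nonZero 1≤h}}}}

  R = d / D
  t = R * h

  suc-X≤D : suc X * suc X ≤ D
  suc-X≤D = ≤-trans (m≤n*m (suc X * suc X) h {{>-nonZero 1≤h}}) (m≤n*m (h * (suc X * suc X)) 74)

  module _ (4D²≤d : 4 * D * D ≤ d) where

    4D≤R : 4 * D ≤ R
    4D≤R = ≤-floor (4 * D) d D (≤-trans (≤-reflexive (*-comm D (4 * D))) 4D²≤d)

    2≤R : 2 ≤ R
    2≤R = ≤-trans (≤-trans (s≤s (s≤s z≤n)) (*-monoʳ-≤ 4 (>-nonZero⁻¹ D))) 4D≤R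

    -- R is about d / D, so the large deviation bound needs D of order at most √d. As D is of order
    -- h T², this is the source of the condition 4 p < q.
    2d≤R² : 2 * d ≤ R * R
    2d≤R² = begin
      2 * d                    ≤⟨ *-monoʳ-≤ 2 (floor-upper d D) ⟩
      2 * (D * R + D)          ≤⟨ *-monoʳ-≤ 2 (+-monoʳ-≤ (D * R) (m≤m*n D R {{>-nonZero (≤-trans (s≤s z≤n) 2≤R)}})) ⟩
      2 * (D * R + D * R)      ≡⟨ e D R ⟩
      4 * D * R                ≤⟨ *-monoˡ-≤ R 4D≤R ⟩
      R * R                    ∎
      where
      open ≤-Reasoning
      e : ∀ D R → 2 * (D * R + D * R) ≡ 4 * D * R
      e = solve-∀

    H≤t : 3 + T ≤ t
    H≤t = begin
      3 + T              ≤⟨ m≤n*m (3 + T) 96 ⟩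
      96 * (3 + T)       ≤⟨ m≤m+n _ 1 ⟩
      X                  ≤⟨ n≤1+n X ⟩
      suc X              ≤⟨ m≤m*n (suc X) (suc X) ⟩
      suc X * suc X      ≤⟨ suc-X≤D ⟩
      D                  ≤⟨ m≤n*m D 4 ⟩
      4 * D              ≤⟨ 4D≤R ⟩
      R                  ≤⟨ m≤m*n R h {{>-nonZero 1≤h}} ⟩
      R * h              ∎
      where open ≤-Reasoning

    room : (X + 2) * d + 37 * (t * labelCount W X) ≤ d * W
    room = begin
      (X + 2) * d + 37 * (t * labelCount W X)               ≡⟨ cong (λ x → (X + 2) * d + 37 * (t * x)) (labelCount≡ W X) ⟩
      (X + 2) * d + 37 * (R * h * (2 * (X + 2) * (suc X * suc X))) ≡⟨ e₁ (X + 2) d R h (suc X * suc X) ⟩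
      (X + 2) * d + (X + 2) * (74 * (h * (suc X * suc X)) * R)   ≤⟨ +-monoʳ-≤ ((X + 2) * d) (*-monoʳ-≤ (X + 2) (floor-lower d D)) ⟩
      (X + 2) * d + (X + 2) * d                             ≡⟨ e₂ (X + 2) d ⟩
      d * W                                                 ∎
      where
      open ≤-Reasoning
      e₁ : ∀ x d R h s → x * d + 37 * (R * h * (2 * x * s)) ≡ x * d + x * (74 * (h * s) * R)
      e₁ = solve-∀
      e₂ : ∀ x d → x * d + x * d ≡ d * (2 * x)
      e₂ = solve-∀

    labels≤d : suc (labelCount W X) ≤ d
    labels≤d = begin
      suc (labelCount W X)                       ≡⟨ cong suc (labelCount≡ W X) ⟩
      1 + 2 * (X + 2) * S                        ≤⟨ +-mono-≤ (*-mono-≤ (>-nonZero⁻¹ S {{S≢0}}) (>-nonZero⁻¹ S {{S≢0}})) (*-monoˡ-≤ S (*-monoʳ-≤ 2 X+2≤S)) ⟩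
      S * S + 2 * S * S                          ≤⟨ m≤m+n _ (S * S) ⟩
      S * S + 2 * S * S + S * S                  ≡⟨ e S ⟩
      4 * S * S                                  ≤⟨ *-mono-≤ (*-monoʳ-≤ 4 suc-X≤D) suc-X≤D ⟩
      4 * D * D                                  ≤⟨ 4D²≤d ⟩
      d                                          ∎
      where
      open ≤-Reasoning
      S = suc X * suc X
      S≢0 : NonZero S
      S≢0 = m*n≢0 (suc X) (suc X)
      X+2≤S : X + 2 ≤ S
      X+2≤S = ≤-trans (≤-trans (≤-reflexive (+-suc X 1)) (+-monoʳ-≤ (suc X) (s≤s z≤n))) (+-monoʳ-≤ (suc X) (m≤n*m (suc X) X {{>-nonZero (m≤n+m 1 (96 * (3 + T)))}}))
      e : ∀ S → S * S + 2 * S * S + S * S ≡ 4 * S * S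
      e = solve-∀

-- D is of order h X² and X is linear in T, so D² is of order h² T⁴. The 386 is 96 + 290, where X +
-- 1 = 96 T + 290.
D-bound : ∃ λ C → ∀ h T → 1 ≤ T → 4 * denominator h T * denominator h T ≤ C * (h * h * T ^ 4)
D-bound = 4 * 74 * 74 * 386 ^ 4 , λ h T 1≤T → lemma 4 74 386 h T (suc (96 * (3 + T) + 1)) (x≤ T 1≤T)
  where
  open ≤-Reasoning
  x≤ : ∀ T → 1 ≤ T → suc (96 * (3 + T) + 1) ≤ 386 * T
  x≤ T 1≤T = begin
    suc (96 * (3 + T) + 1)     ≡⟨ f T ⟩
    96 * T + 290               ≤⟨ +-monoʳ-≤ (96 * T) (m≤m*n 290 T {{>-nonZero 1≤T}}) ⟩
    96 * T + 290 * T           ≡⟨ sym (*-distribʳ-+ T 96 290) ⟩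
    386 * T                    ∎
    where
    f : ∀ T → 1 + (96 * (3 + T) + 1) ≡ 96 * T + 290
    f = solve-∀
  lemma : ∀ a b c h T x → x ≤ c * T → a * (b * (h * (x * x))) * (b * (h * (x * x))) ≤ a * b * b * c ^ 4 * (h * h * T ^ 4)
  lemma a b c h T x x≤ = begin
    a * (b * (h * (x * x))) * (b * (h * (x * x)))
      ≤⟨ *-mono-≤ (*-monoʳ-≤ a (*-monoʳ-≤ b (*-monoʳ-≤ h (*-mono-≤ x≤ x≤)))) (*-monoʳ-≤ b (*-monoʳ-≤ h (*-mono-≤ x≤ x≤))) ⟩
    a * (b * (h * (c * T * (c * T)))) * (b * (h * (c * T * (c * T))))
      ≡⟨ e a b h c T ⟩
    a * b * b * c ^ 4 * (h * h * T ^ 4) ∎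
    where
    e : ∀ a b h c T → a * (b * (h * (c * T * (c * T)))) * (b * (h * (c * T * (c * T)))) ≡ a * b * b * (c * (c * (c * (c * 1)))) * (h * h * (T * (T * (T * (T * 1)))))
    e = solve-∀

-- Rounding α up costs 4 d and the shift of the weights d, both covered by 28 d. What exceeds n is
-- then at most 3 n / T, and T > d^(p/q).
bound : ∀ p q d n T α → 1 ≤ n → 1 ≤ q → d ^ p < T ^ q → T * (4 * d * α) ≤ n * (3 + T) + 4 * d * T →
        BoundRat p q d n (suc (4 * α))
bound p q d n T α 1≤n 1≤q d^p< small = inj₂ (begin-strict
  m ^ q * d ^ p            ≤⟨ *-monoʳ-≤ (m ^ q) (<⇒≤ d^p<) ⟩
  m ^ q * T ^ q            ≡⟨ sym (^-distribʳ-* q m T) ⟩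
  (m * T) ^ q              ≤⟨ ^-monoˡ-≤ q mT≤ ⟩
  (3 * n) ^ q              <⟨ ^-monoˡ-< q {{>-nonZero 1≤q}} (*-monoˡ-< n {{>-nonZero 1≤n}} {3} {14} (s≤s (s≤s (s≤s (s≤s z≤n))))) ⟩
  (14 * n) ^ q             ∎)
  where
  open ≤-Reasoning
  m = d * suc (4 * α) ∸ (28 * d + n)
  mT≤ : m * T ≤ 3 * n
  mT≤ = begin
    m * T                                             ≡⟨ *-comm m T ⟩
    T * m                                             ≡⟨ *-distribˡ-∸ T (d * suc (4 * α)) (28 * d + n) ⟩
    T * (d * suc (4 * α)) ∸ T * (28 * d + n)          ≤⟨ m≤n+o⇒m∸n≤o _ (T * (28 * d + n)) core ⟩
    3 * n                                             ∎
    where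
    e₁ : ∀ T d α → T * (d * (1 + 4 * α)) ≡ T * (4 * d * α) + d * T
    e₁ = solve-∀
    e₂ : ∀ n T d → n * (3 + T) + 4 * d * T + d * T + 23 * d * T ≡ T * (28 * d + n) + 3 * n
    e₂ = solve-∀
    core : T * (d * suc (4 * α)) ≤ T * (28 * d + n) + 3 * n
    core = begin
      T * (d * suc (4 * α))                           ≡⟨ e₁ T d α ⟩
      T * (4 * d * α) + d * T                         ≤⟨ +-monoˡ-≤ (d * T) small ⟩
      n * (3 + T) + 4 * d * T + d * T                 ≤⟨ m≤m+n _ (23 * d * T) ⟩
      n * (3 + T) + 4 * d * T + d * T + 23 * d * T    ≡⟨ e₂ n T d ⟩
      T * (28 * d + n) + 3 * n                        ∎

module Main (p q : ℕ) (1≤p : 1 ≤ p) (4p<q : 4 * p < q) (scale : ℕ)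
  (D≤ : ∀ h T → 1 ≤ T → 4 * denominator h T * denominator h T ≤ scale * (h * h * T ^ 4)) where

  -- For h the integer part of the root of order 3 q of d: the 2 gives T ≥ 3, the next term lets one
  -- factor h absorb `scale` and the 2^(12 p) from h + 1 ≤ 2 h, and the last makes 2^h exceed 16 (h
  -- + 1)^(9 q), hence 16 d³, as the local lemma requires.
  h₀ d₀ : ℕ
  h₀ = 2 + (scale * 2 ^ (12 * p) + 32 * suc (9 * q) ^ suc (9 * q))
  d₀ = h₀ ^ (3 * q)

  1≤q : 1 ≤ q
  1≤q = ≤-trans (s≤s z≤n) 4p<q

  module _ (d : ℕ) (h : ℕ) (h₀≤h : h₀ ≤ h) (lo : h ^ (3 * q) ≤ d) (hi : d < suc h ^ (3 * q)) where

    T : ℕ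
    T = suc h ^ (3 * p)

    2≤h : 2 ≤ h
    2≤h = ≤-trans (m≤m+n 2 _) h₀≤h
    1≤h : 1 ≤ h
    1≤h = ≤-trans (s≤s z≤n) 2≤h
    instance
      h≢0 : NonZero h
      h≢0 = >-nonZero 1≤h

    1≤d : 1 ≤ d
    1≤d = ≤-trans (^-pos h (3 * q) 1≤h) lo

    3≤T : 3 ≤ T
    3≤T = ≤-trans (s≤s 2≤h) (≤-trans (≤-reflexive (sym (^-identityʳ (suc h)))) (^-monoʳ-≤ (suc h) (≤-trans 1≤p (m≤n*m p 3))))

    d^p<T^q : d ^ p < T ^ q
    d^p<T^q = begin-strict
      d ^ p                       <⟨ ^-monoˡ-< p {{>-nonZero 1≤p}} hi ⟩
      (suc h ^ (3 * q)) ^ p       ≡⟨ ^-*-assoc (suc h) (3 * q) p ⟩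
      suc h ^ (3 * q * p)         ≡⟨ cong (suc h ^_) (e p q) ⟩
      suc h ^ (3 * p * q)         ≡⟨ sym (^-*-assoc (suc h) (3 * p) q) ⟩
      T ^ q                       ∎
      where
      open ≤-Reasoning
      e : ∀ p q → 3 * q * p ≡ 3 * p * q
      e = solve-∀

    T⁴≤ : T ^ 4 ≤ 2 ^ (12 * p) * h ^ (12 * p)
    T⁴≤ = begin
      (suc h ^ (3 * p)) ^ 4       ≡⟨ ^-*-assoc (suc h) (3 * p) 4 ⟩
      suc h ^ (3 * p * 4)         ≡⟨ cong (suc h ^_) (e p) ⟩
      suc h ^ (12 * p)            ≤⟨ ^-monoˡ-≤ (12 * p) (+-mono-≤ 1≤h (≤-reflexive (sym (+-identityʳ h)))) ⟩
      (2 * h) ^ (12 * p)          ≡⟨ ^-distribʳ-* (12 * p) 2 h ⟩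
      2 ^ (12 * p) * h ^ (12 * p) ∎
      where
      open ≤-Reasoning
      e : ∀ p → 3 * p * 4 ≡ 12 * p
      e = solve-∀

    scale*≤d : scale * (h * h * T ^ 4) ≤ d
    scale*≤d = begin
      scale * (h * h * T ^ 4)                              ≤⟨ *-monoʳ-≤ scale (*-monoʳ-≤ (h * h) T⁴≤) ⟩
      scale * (h * h * (2 ^ (12 * p) * h ^ (12 * p)))      ≡⟨ e₁ scale h (2 ^ (12 * p)) (h ^ (12 * p)) ⟩
      scale * 2 ^ (12 * p) * (h * h * h ^ (12 * p))        ≤⟨ *-monoˡ-≤ (h * h * h ^ (12 * p)) (≤-trans (≤-trans (m≤m+n (scale * 2 ^ (12 * p)) _) (m≤n+m _ 2)) h₀≤h) ⟩
      h * (h * h * h ^ (12 * p))                           ≡⟨ e₂ h (h ^ (12 * p)) ⟩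
      -- This is 1 + 4 p ≤ q multiplied by 3. The root of order 3 q leaves three factors h: two
      -- belong to D² and the third pays for the constants.
      h ^ (3 + 12 * p)                                     ≤⟨ ^-monoʳ-≤ h (≤-trans (≤-reflexive (e₃ p)) (*-monoʳ-≤ 3 4p<q)) ⟩
      h ^ (3 * q)                                          ≤⟨ lo ⟩
      d                                                    ∎
      where
      open ≤-Reasoning
      e₁ : ∀ s h a b → s * (h * h * (a * b)) ≡ s * a * (h * h * b)
      e₁ = solve-∀
      e₂ : ∀ h b → h * (h * h * b) ≡ h * (h * (h * b))
      e₂ = solve-∀
      e₃ : ∀ p → 3 + 12 * p ≡ 3 * (1 + 4 * p)
      e₃ = solve-∀

    open Parameters h T d 1≤h 3≤T

    4D²≤d : 4 * D * D ≤ d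
    4D²≤d = ≤-trans (D≤ h T (≤-trans (s≤s z≤n) 3≤T)) scale*≤d

    rich : 16 * (d * d) * suc (labelCount W X) ≤ 2 ^ h
    rich = begin
      16 * (d * d) * suc (labelCount W X)      ≤⟨ *-monoʳ-≤ (16 * (d * d)) (labels≤d 4D²≤d) ⟩
      16 * (d * d) * d                         ≡⟨ e₁ d ⟩
      16 * d ^ 3                               ≤⟨ *-monoʳ-≤ 16 (^-monoˡ-≤ 3 (<⇒≤ hi)) ⟩
      16 * (suc h ^ (3 * q)) ^ 3               ≡⟨ cong (16 *_) (trans (^-*-assoc (suc h) (3 * q) 3) (cong (suc h ^_) (e₂ q))) ⟩
      16 * suc h ^ (9 * q)                     ≤⟨ exp-beats-power (9 * q) h (≤-trans (≤-trans (m≤n+m _ (scale * 2 ^ (12 * p))) (m≤n+m _ 2)) h₀≤h) ⟩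
      2 ^ h                                    ∎
      where
      open ≤-Reasoning
      e₁ : ∀ d → 16 * (d * d) * d ≡ 16 * (d * (d * (d * 1)))
      e₁ = solve-∀
      e₂ : ∀ q → 3 * q * 3 ≡ 9 * q
      e₂ = solve-∀

    module _ (n : ℕ) {{n≢0 : NonZero n}} (G : Graph n) (reg : Regular d G) where

      instance
        T≢0 : NonZero T
        T≢0 = m^n≢0 (suc h) (3 * p)
        d≢0 : NonZero d
        d≢0 = >-nonZero 1≤d
        4dT≢0 : NonZero (4 * d * T)
        4dT≢0 = m*n≢0 (4 * d) T {{m*n≢0 4 d}}
        X≢0 : NonZero X
        X≢0 = >-nonZero (m≤n+m 1 (96 * (3 + T)))
        W≢0 : NonZero W
        W≢0 = m*n≢0 2 (X + 2) {{_}} {{>-nonZero (≤-trans (s≤s z≤n) (m≤n+m 2 X))}}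

      α : ℕ
      α = suc (n * (3 + T) / (4 * d * T))

      α-lower : n * (3 + T) ≤ 4 * α * d * T
      α-lower = ≤-trans (floor-upper (n * (3 + T)) (4 * d * T)) (≤-reflexive (e d T (n * (3 + T) / (4 * d * T))))
        where
        e : ∀ d T f → 4 * d * T * f + 4 * d * T ≡ 4 * (1 + f) * d * T
        e = solve-∀

      α-upper : T * (4 * d * α) ≤ n * (3 + T) + 4 * d * T
      α-upper = ≤-trans (≤-reflexive (e d T (n * (3 + T) / (4 * d * T)))) (+-monoˡ-≤ (4 * d * T) (floor-lower (n * (3 + T)) (4 * d * T)))
        where
        e : ∀ d T f → T * (4 * d * (1 + f)) ≡ 4 * d * T * f + 4 * d * T
        e = solve-∀

      has : HasIrregularWeighting G (suc (4 * α))
      has = from (balancedLabelling G d reg 1≤d (labelCount W X) 1≤Q R h (2≤R 4D²≤d) (2d≤R² 4D²≤d) rich)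
        where
        1≤Q : 1 ≤ labelCount W X
        1≤Q = ≤-trans (>-nonZero⁻¹ W) (≤-trans (m≤n+m W (W * X)) (m≤n+m (W * X + W) (W * X * X + W * X)))
        from : ∃ (BalancedLabelling G d (labelCount W X) t) → HasIrregularWeighting G (suc (4 * α))
        from (lab , balanced) = Construct.hasIrregularWeighting G reg 1≤d W X T t α lab balanced 3≤T (room 4D²≤d) (H≤t 4D²≤d)
          (≤-reflexive (+-comm 1 (96 * (3 + T)))) α-lower

      conclusion : ∃ λ s → IrregularityStrength G s × BoundRat p q d n s
      conclusion = from (irregularityStrength≤ G (4 * α) has)
        where
        from : (∃ λ s → IrregularityStrength G s × s ≤ suc (4 * α)) → ∃ λ s → IrregularityStrength G s × BoundRat p q d n s
        from (s , str , s≤) = s , str , BoundRat-mono p q d n s≤ (bound p q d n T α (>-nonZero⁻¹ n) 1≤q d^p<T^q α-upper)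

  root-large : ∀ d → d₀ ≤ d → ∀ h → d < suc h ^ (3 * q) → h₀ ≤ h
  root-large d d₀≤d h hi = root-mono (3 * q) h₀ h d₀≤d hi

  -- The construction divides by n, so the graph without vertices is treated apart.
  empty : ∀ d → 1 ≤ d → (G : Graph 0) → ∃ λ s → IrregularityStrength G s × BoundRat p q d 0 s
  empty d 1≤d G = from (irregularityStrength≤ G 0 (record { w = λ () ; w-sym = λ () ; w-pos = λ () ; w-le = λ () } , λ ()))
    where
    from : (∃ λ s → IrregularityStrength G s × s ≤ 1) → ∃ λ s → IrregularityStrength G s × BoundRat p q d 0 s
    from (s , str , s≤1) = s , str , BoundRat-mono p q d 0 s≤1 (inj₁ (begin-strict
      d * 1             ≡⟨ *-comm d 1 ⟩
      1 * d             <⟨ *-monoˡ-< d {{>-nonZero 1≤d}} {1} {28} (s≤s (s≤s z≤n)) ⟩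
      28 * d            ≡⟨ sym (+-identityʳ _) ⟩
      28 * d + 0        ∎))
      where open ≤-Reasoning

  strengthBound : ∀ d → d₀ ≤ d → ∀ n (G : Graph n) → Regular d G → ∃ λ s → IrregularityStrength G s × BoundRat p q d n s
  strengthBound d d₀≤d n G reg = from (integerRoot (3 * q) (≤-trans 1≤q (m≤n*m q 3)) d) n G reg
    where
    from : (∃ λ h → h ^ (3 * q) ≤ d × d < suc h ^ (3 * q)) → ∀ n (G : Graph n) → Regular d G → ∃ λ s → IrregularityStrength G s × BoundRat p q d n s
    from (h , lo , hi) zero    G reg = empty d (1≤d d h (root-large d d₀≤d h hi) lo hi) G
    from (h , lo , hi) (suc n) G reg = conclusion d h (root-large d d₀≤d h hi) lo hi (suc n) G reg

-- Rational exponents p / q suffice: for real β choose one strictly between β and 1/4, since for d ≥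
-- 1 a larger exponent gives a stronger bound.
theorem3 : (p q : ℕ) → 1 ≤ p → 4 * p < q →
    Σ ℕ (λ d₀ → (d : ℕ) → d₀ ≤ d → (n : ℕ) → (G : Graph n) → Regular d G →
    Σ ℕ (λ s → IrregularityStrength G s × BoundRat p q d n s))
theorem3 p q 1≤p 4p<q = from D-bound
  where
  from : (∃ λ C → ∀ h T → 1 ≤ T → 4 * denominator h T * denominator h T ≤ C * (h * h * T ^ 4)) → _
  from (C , D≤) = Main.d₀ p q 1≤p 4p<q C D≤ , Main.strengthBound p q 1≤p 4p<q C D≤
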